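{- There is a polynomial $p$ such that the following holds. For any $n\ge1$, any non-empty $X\subseteq\{0,1\}^n$ with $P=\operatorname{conv}(X)$, and any $\varepsilon>0$, there exists a polytope $Q=\{(x,y)\in\mathbb{R}^n\times\mathbb{R}^{\operatorname{xc}(P)}\mid Bx+Cy\le d\}$ with $B\in\mathbb{Q}^{(4\operatorname{xc}(P)+2n)\times n}$, $C\in\mathbb{Q}^{(4\operatorname{xc}(P)+2n)\times\operatorname{xc}(P)}$, $d\in\mathbb{Q}^{4\operatorname{xc}(P)+2n}$ of total encoding length at most $p(n,\operatorname{xc}(P),\log(1/\varepsilon))$, such that $P\subseteq\operatorname{proj}_x(Q)\subseteq P+\varepsilon$. Furthermore, for every $c\in\mathbb{R}^n$, $\max\{c^Tx\mid x\in\operatorname{proj}_x(Q)\}-\max\{c^Tx\mid x\in P\}\le\varepsilon\|c\|_2$.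
   Context: $\operatorname{proj}_x(Q)=\{x\in\mathbb{R}^n\mid\exists y:(x,y)\in Q\}$. $P+\varepsilon=\{x+z\mid x\in P,\ \|z\|_2\le\varepsilon\}$. For a polytope $P$, an extension is a polyhedron $Q'\subseteq\mathbb{R}^m$ with a linear map $\pi$ such that $\pi(Q')=P$; an extended formulation is a description $Q'=\{z\mid C'z\le c',\ D'z=d'\}$, whose size is the number of inequalities; $\operatorname{xc}(P)$ is the minimum size of an extended formulation of $P$. -}

module Defs where

open import Algebra.Bundles using (CommutativeRing)
open import Algebra.Module.Bundles.Raw using (RawLeftModule)
open import Algebra.Module.Morphism.Structures using (module LeftModuleMorphisms)
open import Algebra.Structures using (IsCommutativeRing)
open import Data.Bool using (Bool; if_then_else_)
open import Data.Integer using (ℤ; ∣_∣; +_; -[1+_])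
open import Data.List using (List; foldr)
open import Data.Nat as ℕ using (ℕ; suc)
open import Data.Nat.Logarithm using (⌈log₂_⌉)
import Data.Nat.Properties as ℕ
open import Data.Product using (_×_; _,_; ∃; ∃-syntax; Σ-syntax)
open import Data.Rational using (ℚ; ↥_; ↧ₙ_)
open import Data.Vec as Vec using (Vec)
open import Data.Vec.Functional using (Vector)
open import Function using (_⇔_)
open import Level using (0ℓ) renaming (suc to lsuc)
open import Relation.Binary using (Rel; IsTotalOrder)
open import Relation.Nullary using (¬_)
open import Relation.Unary using (Pred; _∈_; _≐_; Satisfiable)

import Algebra.Properties.CommutativeMonoid.Sum as CommutativeMonoidSum
import Algebra.Properties.Semiring.Exp as SemiringExp
import Algebra.Properties.Semiring.Mult as SemiringMult
import Relation.Binary.Construct.NonStrictToStrict as ToStrict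

open CommutativeMonoidSum ℕ.+-0-commutativeMonoid using () renaming (sum to sumℕ)

Matrix : Set → ℕ → ℕ → Set
Matrix A r c = Vector (Vector A c) r

-- Real numbers, as a Dedekind-complete ordered field.  Classically there
-- is exactly one such field up to isomorphism.

record CompleteOrderedField : Set (lsuc 0ℓ) where
  infix  4 _≈_ _≤_
  infixl 6 _+_
  infixl 7 _*_
  infix  8 -_
  infix  9 _⁻¹
  field
    Carrier           : Set
    _≈_ _≤_           : Rel Carrier 0ℓ
    _+_ _*_           : Carrier → Carrier → Carrier
    -_                : Carrier → Carrier
    0# 1#             : Carrier
    _⁻¹               : Carrier → Carrier
    isCommutativeRing : IsCommutativeRing _≈_ _+_ _*_ -_ 0# 1#
    isTotalOrder      : IsTotalOrder _≈_ _≤_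
    0≉1               : ¬ (0# ≈ 1#)
    -- The value at 0# is unconstrained.
    ⁻¹-inverse        : ∀ x → ¬ (x ≈ 0#) → x * x ⁻¹ ≈ 1#
    +-monoˡ-≤         : ∀ z {x y} → x ≤ y → x + z ≤ y + z
    *-nonNegative     : ∀ {x y} → 0# ≤ x → 0# ≤ y → 0# ≤ x * y

  IsUpperBound : Pred Carrier 0ℓ → Carrier → Set
  IsUpperBound S u = ∀ x → x ∈ S → x ≤ u

  field
    supremum : (S : Pred Carrier 0ℓ) → Satisfiable S → ∃ (IsUpperBound S) →
               ∃[ s ] IsUpperBound S s × (∀ u → IsUpperBound S u → s ≤ u)

  commutativeRing : CommutativeRing 0ℓ 0ℓ
  commutativeRing = record { isCommutativeRing = isCommutativeRing }

  open CommutativeRing commutativeRing public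
    using (_-_; semiring; +-commutativeMonoid)
  open ToStrict _≈_ _≤_ public using (_<_)

-- Encoding length of rational data: the size of p/q in lowest terms is
-- 1 + ⌈log₂(|p|+1)⌉ + ⌈log₂(|q|+1)⌉, and arrays add their number of
-- entries to the sizes of the entries.

sizeℚ : ℚ → ℕ
sizeℚ q = 1 ℕ.+ ⌈log₂ suc ∣ ↥ q ∣ ⌉ ℕ.+ ⌈log₂ suc (↧ₙ q) ⌉

sizeVector : ∀ {n} → Vector ℚ n → ℕ
sizeVector {n} v = n ℕ.+ sumℕ (λ i → sizeℚ (v i))

sizeMatrix : ∀ {r c} → Matrix ℚ r c → ℕ
sizeMatrix {r} {c} A = r ℕ.* c ℕ.+ sumℕ (λ i → sumℕ (λ j → sizeℚ (A i j)))

module Polyhedra (𝓡 : CompleteOrderedField) where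
  open CompleteOrderedField 𝓡 public renaming (Carrier to ℝ)
  open CommutativeMonoidSum +-commutativeMonoid using (sum)
  open SemiringExp semiring using (_^_)
  open SemiringMult semiring using () renaming (_×_ to _·_)

  fromℕ : ℕ → ℝ
  fromℕ n = n · 1#

  fromℤ : ℤ → ℝ
  fromℤ (+ n)    = fromℕ n
  fromℤ -[1+ n ] = - fromℕ (suc n)

  fromℚ : ℚ → ℝ
  fromℚ q = fromℤ (↥ q) * fromℕ (↧ₙ q) ⁻¹

  -- L = log₂ x for x > 0: a rational (p - q)/b lies at or below L exactly
  -- when 2^((p - q)/b) ≤ x.
  IsLog₂ : ℝ → ℝ → Set
  IsLog₂ x L = ∀ (p q b : ℕ) → 1 ℕ.≤ b →
    (fromℕ p - fromℕ q ≤ fromℕ b * L) ⇔ (fromℕ 2 ^ p ≤ fromℕ 2 ^ q * x ^ b)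

  -- A list of monomials: (a , i , j , l) stands for a uⁱ vʲ wˡ.
  Polynomial₃ : Set
  Polynomial₃ = List (ℝ × ℕ × ℕ × ℕ)

  eval : Polynomial₃ → ℝ → ℝ → ℝ → ℝ
  eval p u v w =
    foldr (λ (a , i , j , l) s → a * (u ^ i * v ^ j * w ^ l) + s) 0# p

  ℝ^_ : ℕ → Set
  ℝ^ n = Vector ℝ n

  Subset : ℕ → Set₁
  Subset n = Pred (ℝ^ n) 0ℓ

  rawModule : ℕ → RawLeftModule ℝ 0ℓ 0ℓ
  rawModule n = record
    { Carrierᴹ = ℝ^ n
    ; _≈ᴹ_     = λ x y → ∀ i → x i ≈ y i
    ; _+ᴹ_     = λ x y i → x i + y i
    ; _*ₗ_     = λ a x i → a * x i
    ; 0ᴹ       = λ i → 0#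
    ; -ᴹ_      = λ x i → - x i
    }

  module _ {n : ℕ} where
    open RawLeftModule (rawModule n) public
      using () renaming (_≈ᴹ_ to _≋_; _+ᴹ_ to _⊕_)

  IsLinear : ∀ {m n} → (ℝ^ m → ℝ^ n) → Set
  IsLinear {m} {n} =
    LeftModuleMorphisms.IsLeftModuleHomomorphism (rawModule m) (rawModule n)

  _∙_ : ∀ {n} → ℝ^ n → ℝ^ n → ℝ
  x ∙ y = sum (λ i → x i * y i)

  _⊛_ : ∀ {r c} → Matrix ℝ r c → ℝ^ c → ℝ^ r
  (A ⊛ x) i = A i ∙ x

  _≦_ : ∀ {n} → ℝ^ n → ℝ^ n → Set
  x ≦ y = ∀ i → x i ≤ y i

  IsNorm : ∀ {n} → ℝ^ n → ℝ → Set
  IsNorm z r = 0# ≤ r × r * r ≈ z ∙ z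

  image : ∀ {m n} → (ℝ^ m → ℝ^ n) → Subset m → Subset n
  image f S x = ∃[ z ] z ∈ S × f z ≋ x

  conv : ∀ {n} → Subset n → Subset n
  conv {n} S x = Σ[ N ∈ ℕ ] Σ[ μ ∈ ℝ^ N ] Σ[ v ∈ Vector (ℝ^ n) N ]
    (∀ j → 0# ≤ μ j) × sum μ ≈ 1# × (∀ j → v j ∈ S) ×
    x ≋ (λ i → sum (λ j → μ j * v j i))

  -- The set S + ε, i.e. S plus the Euclidean ball of radius ε.
  thicken : ∀ {n} → Subset n → ℝ → Subset n
  thicken S ε x = ∃[ p ] ∃[ z ] p ∈ S × (∃[ r ] IsNorm z r × r ≤ ε) × x ≋ (p ⊕ z)

  IsMax : ∀ {n} → ℝ^ n → Subset n → ℝ → Set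
  IsMax c S M = (∃[ x ] x ∈ S × c ∙ x ≈ M) × (∀ x → x ∈ S → c ∙ x ≤ M)

  cube : ∀ {n} → Pred (Vec Bool n) 0ℓ → Subset n
  cube X x = ∃[ b ] b ∈ X × x ≋ (λ i → if Vec.lookup b i then 1# else 0#)

  polyhedron : ∀ {k l m} → Matrix ℝ k m → ℝ^ k → Matrix ℝ l m → ℝ^ l → Subset m
  polyhedron C c D d z = (C ⊛ z) ≦ c × (D ⊛ z) ≋ d

  -- The number l of equations does not count towards the size k.
  HasExtendedFormulation : ∀ {n} → Subset n → ℕ → Set
  HasExtendedFormulation {n} P k =
    Σ[ m ∈ ℕ ] Σ[ l ∈ ℕ ]
    Σ[ C ∈ Matrix ℝ k m ] Σ[ c ∈ ℝ^ k ] Σ[ D ∈ Matrix ℝ l m ] Σ[ d ∈ ℝ^ l ]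
    Σ[ π ∈ (ℝ^ m → ℝ^ n) ]
      IsLinear π × image π (polyhedron C c D d) ≐ P

  IsXc : ∀ {n} → Subset n → ℕ → Set
  IsXc P k = HasExtendedFormulation P k ×
             (∀ k′ → HasExtendedFormulation P k′ → k ℕ.≤ k′)

  rationalPolyhedron : ∀ {r n k} → Matrix ℚ r n → Matrix ℚ r k → Vector ℚ r →
                       Pred (ℝ^ n × ℝ^ k) 0ℓ
  rationalPolyhedron B C d (x , y) =
    (((λ i j → fromℚ (B i j)) ⊛ x) ⊕ ((λ i j → fromℚ (C i j)) ⊛ y))
      ≦ (λ i → fromℚ (d i))

  -- Together with being a polyhedron, this makes Q a polytope.
  IsBounded : ∀ {n k} → Pred (ℝ^ n × ℝ^ k) 0ℓ → Set
  IsBounded Q = ∃[ M ] (∀ x y → (x , y) ∈ Q →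
    (∀ i → - M ≤ x i × x i ≤ M) × (∀ j → - M ≤ y j × y j ≤ M))

  projₓ : ∀ {n k} → Pred (ℝ^ n × ℝ^ k) 0ℓ → Subset n
  projₓ Q x = ∃[ y ] (x , y) ∈ Q

{-# OPTIONS --safe #-}

-- Take an extended formulation of P with k inequalities and choose a lift of
-- every vertex of P.  By LP duality every c with entries in [-1, 1] has
-- multipliers u ≥ 0 such that c x + u s is a constant β ≤ max {c x | x ∈ P} on
-- the lifts, where s denotes the slacks; after rescaling the slacks to
-- [0, 1] the rows (c, u) are bounded.  Gaussian elimination with nearly maximal
-- pivots selects n + k of them that span all the others with coefficients of
-- absolute value 2^O(n + k).  Q consists of 0 ≤ y ≤ 1 and of the selected
-- equations c x + u y = β, with coefficients multiplied by a power of two and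
-- rounded to integers, up to an additive error n + k + 1 that the rounding
-- makes necessary.  On Q all equations c x + u y = β still hold approximately,
-- and since u y ≥ 0 no c separates x from P by more than a small amount; by
-- Farkas' lemma x is then close to P.

module Submission where

open import Defs
open import Algebra.Bundles using (CommutativeRing; RawRing)
open import Algebra.Module.Morphism.Structures using (module LeftModuleMorphisms)
open import Algebra.Solver.Ring.AlmostCommutativeRing
  using (fromCommutativeRing; _-Raw-AlmostCommutative⟶_)
open import Axiom.ExcludedMiddle using (ExcludedMiddle)
open import Data.Bool using (Bool; true; false; if_then_else_)
open import Data.Empty using (⊥; ⊥-elim)
open import Data.Fin as Fin using (Fin; zero; suc; _↑ˡ_; _↑ʳ_)
open import Data.Integer as ℤ using (ℤ; +_; -[1+_])
open import Data.Nat as ℕ using (ℕ; zero; suc)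
open import Data.Nat.Logarithm using (⌈log₂⌉-mono-≤; ⌈log₂2^n⌉≡n)
open import Data.Nat.Solver using (module +-*-Solver)
open import Data.Product using (_×_; _,_; proj₁; proj₂; ∃-syntax; Σ-syntax)
open import Data.Rational using (ℚ; mkℚ)
open import Data.Sum as Sum using (_⊎_; inj₁; inj₂)
open import Data.Vec as Vec using (Vec)
open import Data.Vec.Functional as Vector using (Vector; tail)
open import Data.Vec.Functional.Properties using (lookup-++ˡ; lookup-++ʳ)
open import Function using (_∘_; Equivalence)
open import Level using (0ℓ)
open import Relation.Binary.PropositionalEquality as ≡ using (_≡_)
open import Relation.Binary.Structures using (IsTotalOrder)
open import Relation.Nullary using (¬_; yes; no)
open import Relation.Nullary.Decidable using (dec⇒maybe; decidable-stable)
open import Relation.Unary using (Pred; Satisfiable; _⊆_)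

import Algebra.Properties.CommutativeMonoid.Sum as CommutativeMonoidSum
import Algebra.Properties.CommutativeSemigroup as CommutativeSemigroupProperties
import Algebra.Properties.Ring as RingProperties
import Algebra.Properties.Semiring.Exp as SemiringExp
import Algebra.Properties.Semiring.Mult as SemiringMult
import Algebra.Properties.Semiring.Sum as SemiringSum
import Algebra.Solver.Ring as RingSolver
import Data.Fin.Properties as Fin
import Data.Integer.Properties as ℤ
import Data.List as List
import Data.Maybe as Maybe
import Data.Nat.Coprimality as Coprimality
import Data.Nat.Properties as ℕ
import Data.Vec.Functional.Relation.Unary.All.Properties as All

-- Facet normals of P and the data of a formulation have no usable size bound, and a point that
-- nearly satisfies the facet inequalities may be far from P. Taking every c of the cube as a row
-- avoids both problems: a small violation of all rows is a small distance, without any condition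
-- number. The price is an infinite family of rows, in which a largest entry need not exist; hence
-- pivots within a factor 2 of the supremum, and a loss that passes from K to 3 K + 2 at each
-- elimination. The row count leaves no room: 2 k inequalities serve 0 ≤ y ≤ 1, and the remaining 2
-- (n + k) allow exactly n + k two-sided equations. Right-hand sides must therefore not count as a
-- further column. They disappear because residuals are measured from one lifted vertex, which
-- solves all equations. No inequality of Q bounds x directly, yet the rounding error grows with the
-- ℓ₁ norm of x. The distance estimate has the form κ (2 + ‖x‖₁) and is used twice: first to bound
-- ‖x‖₁ itself, then to obtain the final distance.

module Development (em : ExcludedMiddle 0ℓ) (𝓡 : CompleteOrderedField) where

  open Polyhedra 𝓡
  open +-*-Solver using ()
    renaming (solve to ℕ-solve; con to ℕ-con; _:+_ to _⊞_; _:*_ to _⊠_; _:=_ to _≋ℕ_)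
  open CommutativeMonoidSum ℕ.+-0-commutativeMonoid using () renaming (sum to sumℕ)
  open CommutativeRing commutativeRing using
    ( refl; sym; trans; reflexive; ring; +-cong; +-congˡ; +-congʳ
    ; *-cong; *-congˡ; *-congʳ; -‿cong; +-identityˡ; +-identityʳ; -‿inverseʳ
    ; *-identityˡ; *-comm; zeroˡ; zeroʳ; distribˡ)
  open IsTotalOrder isTotalOrder using (total; antisym)
    renaming (refl to ≤-refl; reflexive to ≤-reflexive; trans to ≤-trans
             ; ≤-respʳ-≈ to ≤-respʳ; ≤-respˡ-≈ to ≤-respˡ)
  open RingProperties ring using (-‿involutive; -‿distribˡ-*; -‿+-comm; -0#≈0#)
  open SemiringMult semiring using (×-homo-+; ×1-homo-*)
  open SemiringExp semiring using (_^_; ^-homo-*)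
  open SemiringSum semiring using (sum; sum-cong-≋; ∑-distrib-+; ∑-comm
    ; *-distribˡ-sum; *-distribʳ-sum)

  -- The integers inside the field, and a ring solver with integer coefficients.

  fromℕ-+ : ∀ m n → fromℕ (m ℕ.+ n) ≈ fromℕ m + fromℕ n
  fromℕ-+ = ×-homo-+ 1#

  fromℕ-* : ∀ m n → fromℕ (m ℕ.* n) ≈ fromℕ m * fromℕ n
  fromℕ-* = ×1-homo-*

  fromℕ-1 : fromℕ 1 ≈ 1#
  fromℕ-1 = +-identityʳ 1#

  fromℤ-neg : ∀ z → fromℤ (ℤ.- z) ≈ - fromℤ z
  fromℤ-neg (+ zero)  = sym -0#≈0#
  fromℤ-neg (+ suc n) = refl
  fromℤ-neg -[1+ n ]  = sym (-‿involutive _)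

  fromℤ-⊖ : ∀ m n → fromℤ (m ℤ.⊖ n) ≈ fromℕ m - fromℕ n
  fromℤ-⊖ m       zero    = sym (trans (+-congˡ -0#≈0#) (+-identityʳ _))
  fromℤ-⊖ zero    (suc n) = sym (+-identityˡ _)
  fromℤ-⊖ (suc m) (suc n) =
    trans (reflexive (≡.cong fromℤ (ℤ.[1+m]⊖[1+n]≡m⊖n m n)))
    (trans (fromℤ-⊖ m n) (sym (cancel 1# (fromℕ m) (fromℕ n))))
    where
    open CommutativeSemigroupProperties
      (CommutativeRing.+-commutativeSemigroup commutativeRing) using (interchange)
    cancel : ∀ a b c → (a + b) - (a + c) ≈ b - c
    cancel a b c = trans (+-congˡ (sym (-‿+-comm a c)))
      (trans (interchange a b (- a) (- c)) (trans (+-congʳ (-‿inverseʳ a)) (+-identityˡ _)))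

  fromℤ-+ : ∀ y z → fromℤ (y ℤ.+ z) ≈ fromℤ y + fromℤ z
  fromℤ-+ (+ m)    (+ n)    = fromℕ-+ m n
  fromℤ-+ (+ m)    -[1+ n ] = fromℤ-⊖ m (suc n)
  fromℤ-+ -[1+ m ] (+ n)    = trans (fromℤ-⊖ n (suc m)) (CommutativeRing.+-comm commutativeRing _ _)
  fromℤ-+ -[1+ m ] -[1+ n ] =
    trans (-‿cong (trans (reflexive (≡.cong (fromℕ ∘ suc) (≡.sym (ℕ.+-suc m n))))
      (fromℕ-+ (suc m) (suc n))))
          (sym (-‿+-comm _ _))

  fromℤ-* : ∀ y z → fromℤ (y ℤ.* z) ≈ fromℤ y * fromℤ z
  fromℤ-* (+ m) (+ n) = trans (reflexive (≡.cong fromℤ (≡.sym (ℤ.pos-* m n)))) (fromℕ-* m n)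
  fromℤ-* (+ m) -[1+ n ] = trans (reflexive
    (≡.cong fromℤ (≡.sym (ℤ.neg-distribʳ-* (+ m) (+ suc n)))))
    (trans (fromℤ-neg (+ m ℤ.* + suc n)) (trans (-‿cong (fromℤ-* (+ m) (+ suc n)))
    (RingProperties.-‿distribʳ-* ring _ _)))
  fromℤ-* -[1+ m ] (+ n) = trans (reflexive
    (≡.cong fromℤ (≡.sym (ℤ.neg-distribˡ-* (+ suc m) (+ n)))))
    (trans (fromℤ-neg (+ suc m ℤ.* + n)) (trans (-‿cong (fromℤ-* (+ suc m) (+ n)))
    (-‿distribˡ-* _ _)))
  fromℤ-* -[1+ m ] -[1+ n ] = trans (fromℕ-* (suc m) (suc n))
    (sym (trans (sym (-‿distribˡ-* _ _)) (trans
      (-‿cong (sym (RingProperties.-‿distribʳ-* ring _ _))) (-‿involutive _))))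

  ℤ-rawRing : RawRing 0ℓ 0ℓ
  ℤ-rawRing = ℤ.+-*-rawRing

  -- Agrees with fromℤ, but sends + 1 to 1# on the nose, so that the literal
  -- con (+ 1) of the ring solver denotes 1#.
  literal : ℤ → ℝ
  literal (+ 1) = 1#
  literal z     = fromℤ z

  literal≈fromℤ : ∀ z → literal z ≈ fromℤ z
  literal≈fromℤ (+ 0)           = refl
  literal≈fromℤ (+ 1)           = sym fromℕ-1
  literal≈fromℤ (+ suc (suc n)) = refl
  literal≈fromℤ -[1+ n ]        = refl

  ℤ⟶ℝ : ℤ-rawRing -Raw-AlmostCommutative⟶ fromCommutativeRing commutativeRing
  ℤ⟶ℝ = record
    { ⟦_⟧    = literal
    ; +-homo = λ y z → trans (literal≈fromℤ (y ℤ.+ z)) (trans (fromℤ-+ y z)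
        (sym (+-cong (literal≈fromℤ y) (literal≈fromℤ z))))
    ; *-homo = λ y z → trans (literal≈fromℤ (y ℤ.* z)) (trans (fromℤ-* y z)
        (sym (*-cong (literal≈fromℤ y) (literal≈fromℤ z))))
    ; -‿homo = λ z → trans (literal≈fromℤ (ℤ.- z))
      (trans (fromℤ-neg z) (sym (-‿cong (literal≈fromℤ z))))
    ; 0-homo = refl
    ; 1-homo = refl
    }

  module Solver = RingSolver ℤ-rawRing (fromCommutativeRing commutativeRing) ℤ⟶ℝ
    (λ y z → Maybe.map (λ eq → reflexive (≡.cong literal eq)) (dec⇒maybe (y ℤ.≟ z)))
  open Solver using (solve; _:=_; con; _:+_; _:*_; _:-_; :-_)

  -- Arithmetic in the ordered field.

  -- Linear inequalities are reduced to ring identities: x ≤ y follows once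
  -- y - x is exhibited as a sum of differences known to be nonnegative.

  +-mono : ∀ {a b c d} → a ≤ b → c ≤ d → a + c ≤ b + d
  +-mono {a} {b} {c} {d} a≤b c≤d = ≤-trans (+-monoˡ-≤ c a≤b)
    (≤-respʳ (CommutativeRing.+-comm commutativeRing d b)
      (≤-respˡ (CommutativeRing.+-comm commutativeRing c b) (+-monoˡ-≤ b c≤d)))

  lin₁ : ∀ {x y a b} → a ≤ b → y + a ≈ x + b → x ≤ y
  lin₁ {x} {y} {a} {b} a≤b eq = ≤-respˡ (solve 2 (λ x b → (x :+ b) :- b := x) refl x b)
    (≤-respʳ (trans (+-congʳ (sym eq)) (solve 2 (λ y a → (y :+ a) :- a := y) refl y a))
      (lemma a≤b))
    where
    lemma : a ≤ b → (x + b) - b ≤ (x + b) - a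
    lemma p = ≤-respˡ (solve 3 (λ x a b → a :+ (x :- a) := (x :+ b) :- b) refl x a b)
      (≤-respʳ (solve 3 (λ x a b → b :+ (x :- a) := (x :+ b) :- a) refl x a b)
        (+-monoˡ-≤ (x - a) p))

  lin₂ : ∀ {x y a b c d} → a ≤ b → c ≤ d → y + (a + c) ≈ x + (b + d) → x ≤ y
  lin₂ p q = lin₁ (+-mono p q)

  lin₃ : ∀ {x y a b c d e f} → a ≤ b → c ≤ d → e ≤ f → y + (a + (c + e)) ≈ x + (b + (d + f)) → x ≤ y
  lin₃ p q r = lin₂ p (+-mono q r)

  lin₄ : ∀ {x y a b c d e f g h} → a ≤ b → c ≤ d → e ≤ f → g ≤ h →
    y + (a + (c + (e + g))) ≈ x + (b + (d + (f + h))) → x ≤ y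
  lin₄ p q r s = lin₃ p q (+-mono r s)

  diff≥0 : ∀ {x y} → x ≤ y → 0# ≤ y - x
  diff≥0 {x} {y} p = lin₁ p (solve 2 (λ x y → (y :- x) :+ x := con (+ 0) :+ y) refl x y)

  *-monoˡ : ∀ {c a b} → 0# ≤ c → a ≤ b → c * a ≤ c * b
  *-monoˡ {c} {a} {b} 0≤c a≤b = lin₁ (*-nonNegative 0≤c (diff≥0 a≤b))
    (solve 3 (λ c a b → c :* b :+ con (+ 0) := c :* a :+ c :* (b :- a)) refl c a b)

  *-monoʳ : ∀ {c a b} → 0# ≤ c → a ≤ b → a * c ≤ b * c
  *-monoʳ {c} {a} {b} 0≤c a≤b = ≤-respˡ (*-comm c a) (≤-respʳ (*-comm c b) (*-monoˡ 0≤c a≤b))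

  neg-mono : ∀ {a b} → a ≤ b → - b ≤ - a
  neg-mono {a} {b} p = lin₁ p (solve 2 (λ a b → :- a :+ a := :- b :+ b) refl a b)

  sq≥0 : ∀ x → 0# ≤ x * x
  sq≥0 x with total 0# x
  ... | inj₁ p = *-nonNegative p p
  ... | inj₂ p = ≤-respʳ (solve 1 (λ x → :- x :* :- x := x :* x) refl x) (*-nonNegative q q)
    where
    q : 0# ≤ - x
    q = lin₁ p (solve 1 (λ x → :- x :+ x := con (+ 0) :+ con (+ 0)) refl x)

  0≤1 : 0# ≤ 1#
  0≤1 = ≤-respʳ (*-identityˡ 1#) (sq≥0 1#)

  fromℕ≥0 : ∀ n → 0# ≤ fromℕ n
  fromℕ≥0 zero = ≤-refl
  fromℕ≥0 (suc n) = ≤-respˡ (+-identityˡ 0#) (+-mono 0≤1 (fromℕ≥0 n))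

  fromℕ-mono : ∀ {m n} → m ℕ.≤ n → fromℕ m ≤ fromℕ n
  fromℕ-mono {n = n} ℕ.z≤n = fromℕ≥0 n
  fromℕ-mono (ℕ.s≤s p) = +-mono ≤-refl (fromℕ-mono p)

  1≤suc : ∀ n → 1# ≤ fromℕ (suc n)
  1≤suc n = ≤-respˡ (+-identityʳ 1#) (+-mono ≤-refl (fromℕ≥0 n))

  ≰⇒≥ : ∀ {x y} → ¬ (x ≤ y) → y ≤ x
  ≰⇒≥ {x} {y} p with total x y
  ... | inj₁ q = ⊥-elim (p q)
  ... | inj₂ q = q

  ≤? : ∀ x y → x ≤ y ⊎ y < x
  ≤? x y with em {x ≤ y}
  ... | yes p = inj₁ p
  ... | no ¬p = inj₂ (≰⇒≥ ¬p , λ y≈x → ¬p (≤-reflexive (sym y≈x)))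

  <⇒≰ : ∀ {x y} → x < y → ¬ (y ≤ x)
  <⇒≰ (p , q) r = q (antisym p r)

  ≰⇒> : ∀ {x y} → ¬ (y ≤ x) → x < y
  ≰⇒> {x} {y} p with ≤? y x
  ... | inj₁ q = ⊥-elim (p q)
  ... | inj₂ q = q

  1≰0 : ¬ (1# ≤ 0#)
  1≰0 p = 0≉1 (antisym 0≤1 p)

  0<1 : 0# < 1#
  0<1 = 0≤1 , 0≉1

  0<⇒≉0 : ∀ {x} → 0# < x → ¬ (x ≈ 0#)
  0<⇒≉0 (_ , q) p = q (sym p)

  inverseʳ : ∀ {x} → 0# < x → x * x ⁻¹ ≈ 1#
  inverseʳ p = ⁻¹-inverse _ (0<⇒≉0 p)

  ⁻¹≥0 : ∀ {x} → 0# < x → 0# ≤ x ⁻¹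
  ⁻¹≥0 {x} p with ≤? 0# (x ⁻¹)
  ... | inj₁ q = q
  ... | inj₂ (q , _) = ⊥-elim (1≰0 (lin₁ (*-monoˡ (proj₁ p) q)
    (trans (+-congˡ (inverseʳ p)) (solve 1 (λ x → con (+ 0) :+ con (+ 1) := con (+ 1) :+ x :* con
      (+ 0)) refl x))))

  *-cancelˡ-≤ : ∀ {c a b} → 0# < c → c * a ≤ c * b → a ≤ b
  *-cancelˡ-≤ {c} {a} {b} 0<c p = ≤-respˡ (lemma a) (≤-respʳ (lemma b) (*-monoˡ (⁻¹≥0 0<c) p))
    where
    lemma : ∀ x → c ⁻¹ * (c * x) ≈ x
    lemma x = trans (solve 3 (λ c i x → i :* (c :* x) := (c :* i) :* x) refl c (c ⁻¹) x)
      (trans (*-congʳ (inverseʳ 0<c)) (*-identityˡ x))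

  0<-resp-≤ : ∀ {x y} → 0# < x → x ≤ y → 0# < y
  0<-resp-≤ {x} {y} (p , q) r = ≤-trans p r , λ 0≈y → q (antisym p (≤-respʳ (sym 0≈y) r))

  *-pos : ∀ {x y} → 0# < x → 0# < y → 0# < x * y
  *-pos {x} {y} p q = ≰⇒> λ r → <⇒≰ q (*-cancelˡ-≤ p (≤-respʳ (sym (zeroʳ x)) r))

  ⁻¹-pos : ∀ {x} → 0# < x → 0# < x ⁻¹
  ⁻¹-pos {x} p = ≰⇒> λ r → 1≰0 (≤-respˡ (inverseʳ p) (≤-respʳ (zeroʳ x) (*-monoˡ (proj₁ p) r)))

  fromℕ-pos : ∀ n → 0# < fromℕ (suc n)
  fromℕ-pos n = 0<-resp-≤ 0<1 (1≤suc n)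

  sq-≤⇒≤ : ∀ {a b} → 0# ≤ b → a * a ≤ b * b → a ≤ b
  sq-≤⇒≤ {a} {b} 0≤b p with ≤? a b
  ... | inj₁ q = q
  ... | inj₂ b<a = *-cancelˡ-≤ (0<-resp-≤ b<a′ a≤a+b) (lin₁ p
      (solve 2 (λ a b → (a :+ b) :* b :+ a :* a := (a :+ b) :* a :+ b :* b) refl a b))
    where
    b<a′ : 0# < a
    b<a′ = ≤-trans 0≤b (proj₁ b<a) , λ 0≈a → <⇒≰ b<a (≤-trans (≤-reflexive (sym 0≈a)) 0≤b)
    a≤a+b : a ≤ a + b
    a≤a+b = lin₁ 0≤b (solve 2 (λ a b → (a :+ b) :+ con (+ 0) := a :+ b) refl a b)

  -- Two-sided bounds and absolute values.

  infix 4 _∈±_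
  -- Encodes |x| ≤ a as a pair of inequalities, to which the `lin` lemmas apply directly; the
  -- absolute value as a function occurs only in ℓ₁ norms and in rounding.
  _∈±_ : ℝ → ℝ → Set
  x ∈± a = - a ≤ x × x ≤ a

  ∈±-resp : ∀ {x y a} → x ≈ y → x ∈± a → y ∈± a
  ∈±-resp e (p , q) = ≤-respʳ e p , ≤-respˡ e q

  ∈±-mono : ∀ {x a b} → a ≤ b → x ∈± a → x ∈± b
  ∈±-mono r (p , q) = ≤-trans (neg-mono r) p , ≤-trans q r

  ∈±-neg : ∀ {x a} → x ∈± a → - x ∈± a
  ∈±-neg {x} {a} (p , q) = neg-mono q , ≤-respʳ (-‿involutive a) (neg-mono p)

  ∈±-+ : ∀ {x y a b} → x ∈± a → y ∈± b → x + y ∈± a + b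
  ∈±-+ (p , q) (r , s) = ≤-respˡ (-‿+-comm _ _) (+-mono p r) , +-mono q s

  ∈±-- : ∀ {x y a b} → x ∈± a → y ∈± b → x - y ∈± a + b
  ∈±-- p q = ∈±-+ p (∈±-neg q)

  -- 2 (a b ± x y) = (a + x) (b ± y) + (a - x) (b ∓ y)
  ∈±-* : ∀ {x y a b} → x ∈± a → y ∈± b → x * y ∈± a * b
  ∈±-* {x} {y} {a} {b} (p , q) (r , s) =
    halve (lin₂ (*-nonNegative x⁺ y⁺) (*-nonNegative x⁻ y⁻)
      (solve 4 (λ x y a b → con (+ 2) :* (x :* y) :+ (con (+ 0) :+ con (+ 0)) :=
        con (+ 2) :* (:- (a :* b)) :+ ((a :+ x) :* (b :+ y) :+ (a :- x) :* (b :- y))) refl x y a b))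
          ,
    halve (lin₂ (*-nonNegative x⁺ y⁻) (*-nonNegative x⁻ y⁺)
      (solve 4 (λ x y a b → con (+ 2) :* (a :* b) :+ (con (+ 0) :+ con (+ 0)) :=
        con (+ 2) :* (x :* y) :+ ((a :+ x) :* (b :- y) :+ (a :- x) :* (b :+ y))) refl x y a b))
    where
    halve : ∀ {u v} → fromℕ 2 * u ≤ fromℕ 2 * v → u ≤ v
    halve = *-cancelˡ-≤ (fromℕ-pos 1)
    pos : ∀ {u v} → - u ≤ v → 0# ≤ u + v
    pos {u} {v} t = lin₁ t (solve 2 (λ u v → (u :+ v) :+ :- u := con (+ 0) :+ v) refl u v)
    x⁺ : 0# ≤ a + x
    x⁺ = pos p
    x⁻ : 0# ≤ a - x
    x⁻ = diff≥0 q
    y⁺ : 0# ≤ b + y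
    y⁺ = pos r
    y⁻ : 0# ≤ b - y
    y⁻ = diff≥0 s

  ∈±-bound≥0 : ∀ {x a} → x ∈± a → 0# ≤ a
  ∈±-bound≥0 {x} {a} (p , q) = *-cancelˡ-≤ (fromℕ-pos 1)
    (lin₂ p q (solve 2 (λ x a → con (+ 2) :* a :+ (:- a :+ x) := con (+ 2) :* con (+ 0) :+ (x :+ a))
      refl x a))

  ∣_∣ʳ : ℝ → ℝ
  ∣ x ∣ʳ with total 0# x
  ... | inj₁ _ = x
  ... | inj₂ _ = - x

  ∈±∣∣ : ∀ x → x ∈± ∣ x ∣ʳ
  ∈±∣∣ x with total 0# x
  ... | inj₁ p = lin₂ p p (solve 1 (λ x → x :+ (con (+ 0) :+ con (+ 0)) := (:- x) :+ (x :+ x)) refl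
    x) , ≤-refl
  ... | inj₂ p = ≤-reflexive (-‿involutive x) ,
     lin₂ p p (solve 1 (λ x → :- x :+ (x :+ x) := x :+ (con (+ 0) :+ con (+ 0))) refl x)

  ∣∣-least : ∀ {x a} → x ∈± a → ∣ x ∣ʳ ≤ a
  ∣∣-least {x} (p , q) with total 0# x
  ... | inj₁ _ = q
  ... | inj₂ _ = proj₂ (∈±-neg (p , q))

  -- Finite sums and inner products.

  sum-mono : ∀ {n} {f g : ℝ^ n} → f ≦ g → sum f ≤ sum g
  sum-mono {zero}  p = ≤-refl
  sum-mono {suc n} p = +-mono (p zero) (sum-mono (p ∘ suc))

  sum-const : ∀ n a → sum {n} (λ _ → a) ≈ fromℕ n * a
  sum-const zero    a = sym (zeroˡ a)
  sum-const (suc n) a = trans (+-congˡ (sum-const n a))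
    (solve 2 (λ m a → a :+ m :* a := (con (+ 1) :+ m) :* a) refl (fromℕ n) a)

  sum-≤const : ∀ {n} {f : ℝ^ n} {a} → (∀ i → f i ≤ a) → sum f ≤ fromℕ n * a
  sum-≤const {n} {a = a} p = ≤-respʳ (sum-const n a) (sum-mono p)

  sum-0 : ∀ {n} {f : ℝ^ n} → (∀ i → f i ≈ 0#) → sum f ≈ 0#
  sum-0 {n} p = trans (sum-cong-≋ p) (trans (sum-const n 0#) (zeroʳ _))

  sum≥0 : ∀ {n} {f : ℝ^ n} → (∀ i → 0# ≤ f i) → 0# ≤ sum f
  sum≥0 {n} {f = f} p = ≤-respˡ (sum-0 {n} {f = λ i → 0#} λ _ → refl) (sum-mono p)

  term≤sum : ∀ {n} {f : ℝ^ n} → (∀ i → 0# ≤ f i) → ∀ i → f i ≤ sum f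
  term≤sum {f = f} p zero = lin₁ (sum≥0 (p ∘ suc))
    (solve 2 (λ a b → (a :+ b) :+ con (+ 0) := a :+ b) refl (f zero) (sum (tail f)))
  term≤sum {f = f} p (suc i) = lin₂ (p zero) (term≤sum (p ∘ suc) i)
    (solve 3 (λ a b c → (a :+ b) :+ (con (+ 0) :+ c) := c :+ (a :+ b)) refl (f zero) (sum (tail f))
      (f (suc i)))

  sum-∈± : ∀ {n} {f a : ℝ^ n} → (∀ i → f i ∈± a i) → sum f ∈± sum a
  sum-∈± {zero}  p = ≤-reflexive -0#≈0# , ≤-refl
  sum-∈± {suc n} p = ∈±-+ (p zero) (sum-∈± (p ∘ suc))

  ∙-congˡ : ∀ {n} {a x y : ℝ^ n} → x ≋ y → a ∙ x ≈ a ∙ y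
  ∙-congˡ p = sum-cong-≋ λ i → *-congˡ (p i)

  ∙-congʳ : ∀ {n} {a b x : ℝ^ n} → a ≋ b → a ∙ x ≈ b ∙ x
  ∙-congʳ p = sum-cong-≋ λ i → *-congʳ (p i)

  ∙-distribˡ : ∀ {n} (a x y : ℝ^ n) → a ∙ (λ i → x i + y i) ≈ a ∙ x + a ∙ y
  ∙-distribˡ a x y = trans (sum-cong-≋ λ i → distribˡ (a i) (x i) (y i))
    (∑-distrib-+ (λ i → a i * x i) (λ i → a i * y i))

  ∙-scaleˡ : ∀ {n} t (a x : ℝ^ n) → (λ i → t * a i) ∙ x ≈ t * (a ∙ x)
  ∙-scaleˡ t a x = trans (sum-cong-≋ λ i → CommutativeRing.*-assoc commutativeRing t (a i) (x i))
    (sym (*-distribˡ-sum t (λ i → a i * x i)))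

  ∙-comm : ∀ {n} (a x : ℝ^ n) → a ∙ x ≈ x ∙ a
  ∙-comm a x = sum-cong-≋ λ i → *-comm (a i) (x i)

  ∙-scaleʳ : ∀ {n} t (a x : ℝ^ n) → a ∙ (λ i → t * x i) ≈ t * (a ∙ x)
  ∙-scaleʳ t a x = trans (∙-comm a _) (trans (∙-scaleˡ t x a) (*-congˡ (∙-comm x a)))

  ∙-distribʳ : ∀ {n} (a b x : ℝ^ n) → (λ i → a i + b i) ∙ x ≈ a ∙ x + b ∙ x
  ∙-distribʳ a b x = trans (∙-comm _ x) (trans (∙-distribˡ x a b)
    (+-cong (∙-comm x a) (∙-comm x b)))

  ∙-neg : ∀ {n} (a x : ℝ^ n) → (λ i → - a i) ∙ x ≈ - (a ∙ x)
  ∙-neg a x = trans (∙-congʳ λ i → solve 1 (λ a → :- a := (:- con (+ 1)) :* a) refl (a i))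
    (trans (∙-scaleˡ _ a x) (solve 1 (λ s → (:- con (+ 1)) :* s := :- s) refl (a ∙ x)))

  ∙-sub : ∀ {n} (a b x : ℝ^ n) → (λ i → a i - b i) ∙ x ≈ a ∙ x - b ∙ x
  ∙-sub a b x = trans (∙-distribʳ a (λ i → - b i) x) (+-congˡ (∙-neg b x))

  ∙-nonNegative : ∀ {n} {a x : ℝ^ n} → (∀ i → 0# ≤ a i) → (∀ i → 0# ≤ x i) → 0# ≤ a ∙ x
  ∙-nonNegative p q = sum≥0 λ i → *-nonNegative (p i) (q i)

  -- Farkas' lemma and linear programming duality.

  module Forms {V : Set} (_⊹_⟨_⟩ : V → ℝ → V → V) where

    -- Vectors enter only through the values of forms, so the single operation v + a w suffices,
    -- without laws and without an equality on V. The elements of V may thus be vectors bundled with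
    -- proofs of equations.
    Linear : (V → ℝ) → Set
    Linear f = ∀ v a w → f (v ⊹ a ⟨ w ⟩) ≈ f v + a * f w

    linear-+ : ∀ {f g} → Linear f → Linear g → Linear (λ v → f v + g v)
    linear-+ {f} {g} p q v a w = trans (+-cong (p v a w) (q v a w))
      (solve 5 (λ x y a z t → (x :+ a :* y) :+ (z :+ a :* t) := (x :+ z) :+ a :* (y :+ t)) refl
        (f v) (f w) a (g v) (g w))

    linear-* : ∀ {f} t → Linear f → Linear (λ v → t * f v)
    linear-* {f} t p v a w = trans (*-congˡ (p v a w))
      (solve 4 (λ t x a y → t :* (x :+ a :* y) := t :* x :+ a :* (t :* y)) refl t (f v) a (f w))

    linear-neg : ∀ {f} → Linear f → Linear (λ v → - f v)
    linear-neg {f} p v a w = trans (-‿cong (p v a w))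
      (solve 3 (λ x a y → :- (x :+ a :* y) := :- x :+ a :* :- y) refl (f v) a (f w))

    linear-- : ∀ {f g} → Linear f → Linear g → Linear (λ v → f v - g v)
    linear-- p q = linear-+ p (linear-neg q)

    linear-∙ : ∀ {n} (c : ℝ^ n) {f : Fin n → V → ℝ} → (∀ i → Linear (f i)) →
               Linear (λ v → c ∙ (λ i → f i v))
    linear-∙ c {f} p v a w = trans (∙-congˡ {a = c} λ i → p i v a w)
      (trans (∙-distribˡ c (λ i → f i v) (λ i → a * f i w))
        (+-congˡ (∙-scaleʳ a c (λ i → f i w))))

    -- Bartl's proof: if the first form a₀ is needed, some v₁ has γ v₁ > 0 and
    -- a₀ v₁ > 0 although the other forms are nonpositive at v₁.  Projecting
    -- along v₁ onto the kernel of a₀ removes a₀ from the system.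
    farkas : ∀ {m} (a : Fin m → V → ℝ) → (∀ i → Linear (a i)) →
             ∀ {γ} → Linear γ → (∀ v → (∀ i → a i v ≤ 0#) → γ v ≤ 0#) →
             ∃[ u ] (∀ i → 0# ≤ u i) × (∀ v → γ v ≈ u ∙ (λ i → a i v))
    farkas {zero} a _ {γ} γ-linear γ≤0 =
      -- The vector v + (-2) v stands in for -v, so that both γ v and - γ v are at most 0.
      (λ ()) , (λ ()) , λ v → antisym (γ≤0 v λ ()) (lin₁ (γ≤0 (v ⊹ - fromℕ 2 ⟨ v ⟩) λ ())
        (trans (+-congˡ (γ-linear v _ v))
          (solve 1 (λ x → x :+ (x :+ :- con (+ 2) :* x) := con (+ 0) :+ con (+ 0)) refl (γ v))))
    farkas {suc m} a a-linear {γ} γ-linear γ≤0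
      with em {∃[ v ] (∀ i → a (suc i) v ≤ 0#) × ¬ (γ v ≤ 0#)}
    ... | no redundant =
      let u , u≥0 , γ≈ = farkas (tail a) (a-linear ∘ suc) γ-linear
            λ v p → decidable-stable em λ q → redundant (v , p , q)
      in (λ { zero → 0# ; (suc i) → u i }) , (λ { zero → ≤-refl ; (suc i) → u≥0 i }) ,
         λ v → trans (γ≈ v) (solve 2 (λ x s → s := con (+ 0) :* x :+ s) refl (a zero v) _)
    ... | yes (v₁ , tail≤0 , γv₁≰0) =
      let u , u≥0 , γ≈ = farkas (λ i → project (a (suc i)))
            (λ i → project-linear (a-linear (suc i)))
            (project-linear γ-linear) γ′≤0
          -- The coefficient κ r of a₀ is the one for which both sides agree at v₁; it is
          -- nonnegative because γ v₁ is and the other forms are nonpositive at v₁.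
          r = γ v₁ - u ∙ (λ i → a (suc i) v₁)
      in (λ { zero → κ * r ; (suc i) → u i }) ,
         (λ { zero → *-nonNegative (⁻¹≥0 0<a₀) (lin₂ (≰⇒≥ γv₁≰0) (u∙≤0 u u≥0)
                       (solve 2 (λ g s → (g :- s) :+ (con (+ 0) :+ s) := con (+ 0) :+
                         (g :+ con (+ 0))) refl (γ v₁) _))
            ; (suc i) → u≥0 i }) ,
         λ v → combine v u (γ≈ v)
      where
      a₀ = a zero v₁
      κ = a₀ ⁻¹
      0<a₀ : 0# < a₀
      0<a₀ = ≰⇒> λ p → γv₁≰0 (γ≤0 v₁ λ { zero → p ; (suc i) → tail≤0 i })
      project : (V → ℝ) → V → ℝ
      project f v = f v - κ * f v₁ * a zero v
      project-linear : ∀ {f} → Linear f → Linear (project f)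
      project-linear p = linear-- p (linear-* _ (a-linear zero))
      u∙≤0 : ∀ u → (∀ i → 0# ≤ u i) → u ∙ (λ i → a (suc i) v₁) ≤ 0#
      u∙≤0 u u≥0 = ≤-respʳ (trans (sum-cong-≋ λ i → zeroʳ (u i)) (sum-0 {m} λ _ → refl))
        (sum-mono λ i → *-monoˡ (u≥0 i) (tail≤0 i))
      γ′≤0 : ∀ v → (∀ i → project (a (suc i)) v ≤ 0#) → project γ v ≤ 0#
      γ′≤0 v p = ≤-respˡ (at-w γ-linear) (γ≤0 w λ
        { zero → ≤-reflexive (trans (a-linear zero v _ v₁)
            (trans (solve 3 (λ x k y → x :+ :- (k :* x) :* y := x :- x :* (y :* k)) refl (a zero v)
              κ a₀)
            (trans (+-congˡ (-‿cong (*-congˡ (inverseʳ 0<a₀))))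
              (solve 1 (λ x → x :- x :* con (+ 1) := con (+ 0)) refl (a zero v)))))
        ; (suc i) → ≤-respˡ (sym (at-w (a-linear (suc i)))) (p i) })
        where
        w = v ⊹ - (κ * a zero v) ⟨ v₁ ⟩
        at-w : ∀ {f} → Linear f → f w ≈ project f v
        at-w {f} l = trans (l v _ v₁)
          (solve 4 (λ x k y z → x :+ :- (k :* z) :* y := x :- k :* y :* z) refl (f v) κ (f v₁)
            (a zero v))
      combine : ∀ v u → project γ v ≈ u ∙ (λ i → project (a (suc i)) v) →
                γ v ≈ κ * (γ v₁ - u ∙ (λ i → a (suc i) v₁)) * a zero v + u ∙ (λ i → a (suc i) v)
      combine v u eq = trans (solve 2 (λ x y → x := (x :- y) :+ y) refl (γ v) (κ * γ v₁ * a zero v))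
        (trans (+-congʳ (trans eq expand))
          (solve 5 (λ s t k g z → (s :+ :- (k :* z) :* t) :+ k :* g :* z := k :* (g :- t) :* z :+ s)
            refl
            (u ∙ (λ i → a (suc i) v)) (u ∙ (λ i → a (suc i) v₁)) κ (γ v₁) (a zero v)))
        where
        expand : u ∙ (λ i → project (a (suc i)) v) ≈
                 u ∙ (λ i → a (suc i) v) + - (κ * a zero v) * (u ∙ (λ i → a (suc i) v₁))
        expand = trans (∙-congˡ {a = u} λ i → solve 4
          (λ x k y z → x :- k :* y :* z := x :+ :- (k :* z) :* y)
                         refl (a (suc i) v) κ (a (suc i) v₁) (a zero v))
          (trans (∙-distribˡ u (λ i → a (suc i) v) (λ i → - (κ * a zero v) * a (suc i) v₁))
            (+-congˡ (∙-scaleʳ _ u _)))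

    module Affine {h : V → ℝ} (h-linear : Linear h) where

      -- This is v / h v, written with the only operation at hand.
      normalise : V → V
      normalise v = v ⊹ (h v) ⁻¹ - 1# ⟨ v ⟩

      normalise-form : ∀ {f} → Linear f → ∀ v → f (normalise v) ≈ (h v) ⁻¹ * f v
      normalise-form {f} l v = trans (l v _ v)
        (solve 2 (λ x k → x :+ (k :- con (+ 1)) :* x := k :* x) refl (f v) ((h v) ⁻¹))

      normalise-h : ∀ v → 0# < h v → h (normalise v) ≈ 1#
      normalise-h v p = trans (normalise-form h-linear v) (trans (*-comm _ _) (inverseʳ p))

      normalise-≤0 : ∀ {f} → Linear f → ∀ v → 0# < h v → f v ≤ 0# → f (normalise v) ≤ 0#
      normalise-≤0 l v p q = ≤-respˡ (sym (normalise-form l v))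
        (≤-respʳ (zeroʳ _) (*-monoˡ (⁻¹≥0 p) q))

      -- Farkas' lemma with γ = h: a vector at which all forms are at most 0 and h is positive could
      -- be normalised to a feasible point.
      infeasible : ∀ {m} (a : Fin m → V → ℝ) → (∀ i → Linear (a i)) →
        ¬ (∃[ v ] h v ≈ 1# × (∀ i → a i v ≤ 0#)) →
        ∃[ u ] (∀ i → 0# ≤ u i) × (∀ v → h v ≈ u ∙ (λ i → a i v))
      infeasible a a-linear empty = farkas a a-linear h-linear λ v p →
        decidable-stable em λ h≰0 → empty (normalise v , normalise-h v (≰⇒> h≰0) ,
          λ i → normalise-≤0 (a-linear i) v (≰⇒> h≰0) (p i))

      -- The recession directions (h v = 0) are covered by adding a large
      -- multiple of v to a feasible point and normalising.
      dual : ∀ {m} (a : Fin m → V → ℝ) → (∀ i → Linear (a i)) → ∀ {γ} → Linear γ →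
        ∀ v₀ → h v₀ ≈ 1# → (∀ i → a i v₀ ≤ 0#) →
        (∀ v → h v ≈ 1# → (∀ i → a i v ≤ 0#) → γ v ≤ 0#) →
        ∃[ u₀ ] 0# ≤ u₀ × (∃[ u ] (∀ i → 0# ≤ u i) × (∀ v → γ v ≈ u ∙ (λ i → a i v) - u₀ * h v))
      dual {m} a a-linear {γ} γ-linear v₀ h₀ a₀ valid =
        let u , u≥0 , γ≈ = farkas a⁺ a⁺-linear γ-linear γ≤0
        in u zero , u≥0 zero , tail u , (u≥0 ∘ suc) , λ v → trans (γ≈ v)
           (solve 3 (λ u h s → u :* :- h :+ s := s :- u :* h) refl (u zero) (h v)
             (tail u ∙ (λ i → a i v)))
        where
        a⁺ : Fin (suc m) → V → ℝ
        a⁺ zero    v = - h v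
        a⁺ (suc i) v = a i v
        a⁺-linear : ∀ i → Linear (a⁺ i)
        a⁺-linear zero    = linear-neg h-linear
        a⁺-linear (suc i) = a-linear i
        γ≤0 : ∀ v → (∀ i → a⁺ i v ≤ 0#) → γ v ≤ 0#
        γ≤0 v p = decidable-stable em λ γ≰0 → contradict (≰⇒> γ≰0)
          where
          contradict : 0# < γ v → ⊥
          contradict 0<γ = 1≰0 (*-cancelˡ-≤ (⁻¹-pos 0<hw)
            (≤-respˡ γw≈ (≤-respʳ (sym (zeroʳ _)) (valid (normalise w)
              (normalise-h w 0<hw) λ i → normalise-≤0 (a-linear i) w 0<hw (aw≤0 i)))))
            where
            -- Chosen so that γ w = 1; after normalising, γ takes the value 1 / h w > 0, against
            -- `valid`.
            t = (1# - γ v₀) * γ v ⁻¹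
            w = v₀ ⊹ t ⟨ v ⟩
            0≤t : 0# ≤ t
            0≤t = *-nonNegative (lin₂ 0≤1 (valid v₀ h₀ a₀)
              (solve 1 (λ g → (con (+ 1) :- g) :+ (con (+ 0) :+ g) := con (+ 0) :+
                (con (+ 1) :+ con (+ 0))) refl (γ v₀)))
              (⁻¹≥0 0<γ)
            0<hw : 0# < h w
            0<hw = 0<-resp-≤ 0<1 (≤-respʳ (sym (h-linear v₀ t v))
              (lin₂ (≤-reflexive (sym h₀)) (*-nonNegative 0≤t (neg⁻ (p zero)))
              (solve 2 (λ x y → (x :+ y) :+ (con (+ 1) :+ con (+ 0)) := con (+ 1) :+ (x :+ y)) refl
                (h v₀) (t * h v))))
              where
              neg⁻ : ∀ {x} → - x ≤ 0# → 0# ≤ x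
              neg⁻ {x} q = lin₁ q (solve 1 (λ x → x :+ :- x := con (+ 0) :+ con (+ 0)) refl x)
            aw≤0 : ∀ i → a i w ≤ 0#
            aw≤0 i = ≤-respˡ (sym (a-linear i v₀ t v)) (≤-respʳ (+-identityˡ 0#)
              (+-mono (a₀ i) (≤-respʳ (zeroʳ t) (*-monoˡ 0≤t (p (suc i))))))
            γw≈ : γ (normalise w) ≈ (h w) ⁻¹ * 1#
            γw≈ = trans (normalise-form γ-linear w) (*-congˡ (trans (γ-linear v₀ t v)
              (trans (solve 3 (λ g k x → g :+ (con (+ 1) :- g) :* k :* x := g :+ (con (+ 1) :- g) :*
                (x :* k)) refl (γ v₀) (γ v ⁻¹) (γ v))
              (trans (+-congˡ (*-congˡ (inverseʳ 0<γ)))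
                (solve 1 (λ g → g :+ (con (+ 1) :- g) :* con (+ 1) := con (+ 1)) refl (γ v₀))))))

      -- If the supremum M were not attained, Farkas' lemma for the system with
      -- the additional inequality M ≤ γ would give a smaller upper bound.
      attains : ∀ {m} (a : Fin m → V → ℝ) → (∀ i → Linear (a i)) → ∀ {γ} → Linear γ →
        ∀ v₀ → h v₀ ≈ 1# → (∀ i → a i v₀ ≤ 0#) →
        ∀ U → (∀ v → h v ≈ 1# → (∀ i → a i v ≤ 0#) → γ v ≤ U) →
        ∃[ v ] h v ≈ 1# × (∀ i → a i v ≤ 0#) ×
          (∀ w → h w ≈ 1# → (∀ i → a i w ≤ 0#) → γ w ≤ γ v)
      attains {m} a a-linear {γ} γ-linear v₀ h₀ a₀ U bounded =
        from-sup (supremum (λ y → ∃[ v ] h v ≈ 1# × (∀ i → a i v ≤ 0#) × γ v ≈ y)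
          (γ v₀ , v₀ , h₀ , a₀ , refl)
          (U , λ { y (v , hv , av , γv≈y) → ≤-respˡ γv≈y (bounded v hv av) }))
        where
        from-sup : (∃[ M ] (∀ y → ∃[ v ] h v ≈ 1# × (∀ i → a i v ≤ 0#) × γ v ≈ y → y ≤ M) ×
                           (∀ u → (∀ y → ∃[ v ] h v ≈ 1# × (∀ i → a i v ≤ 0#) × γ v ≈ y → y ≤ u) → M
                             ≤ u)) →
                   ∃[ v ] h v ≈ 1# × (∀ i → a i v ≤ 0#) ×
                     (∀ w → h w ≈ 1# → (∀ i → a i w ≤ 0#) → γ w ≤ γ v)
        from-sup (M , upper , least) = pick (decidable-stable em λ none →
          refute (infeasible a⁺ a⁺-linear λ { (v , hv , av) → none
            (v , hv , (λ i → av (suc i)) , below hv (av zero)) }))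
          where
          a⁺ : Fin (suc m) → V → ℝ
          a⁺ zero    v = M * h v - γ v
          a⁺ (suc i) v = a i v
          a⁺-linear : ∀ i → Linear (a⁺ i)
          a⁺-linear zero    = linear-- (linear-* M h-linear) γ-linear
          a⁺-linear (suc i) = a-linear i
          below : ∀ {v} → h v ≈ 1# → M * h v - γ v ≤ 0# → M ≤ γ v
          below {v} hv p = lin₁ (≤-respˡ (+-congʳ (*-congˡ hv)) p)
            (solve 2 (λ M g → g :+ (M :* con (+ 1) :- g) := M :+ con (+ 0)) refl M (γ v))
          pick : ∃[ v ] h v ≈ 1# × (∀ i → a i v ≤ 0#) × M ≤ γ v →
                 ∃[ v ] h v ≈ 1# × (∀ i → a i v ≤ 0#) ×
                   (∀ w → h w ≈ 1# → (∀ i → a i w ≤ 0#) → γ w ≤ γ v)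
          pick (v , hv , av , M≤) = v , hv , av , λ w hw aw → ≤-trans
            (upper (γ w) (w , hw , aw , refl)) M≤
          refute : ∃[ u ] (∀ i → 0# ≤ u i) × (∀ v → h v ≈ u ∙ (λ i → a⁺ i v)) → ⊥
          refute (u , u≥0 , h≈) = <⇒≰ (⁻¹-pos 0<u₀)
            (lin₁ (least (M - κ) λ { y (v , hv , av , γv≈y) → ≤-respˡ γv≈y (smaller v hv av) })
            (solve 2 (λ M k → con (+ 0) :+ M := k :+ (M :- k)) refl M κ))
            where
            -- On feasible points the certificate becomes 1 ≤ u₀ (M - γ v), that is, γ v ≤ M - 1 /
            -- u₀.
            κ = u zero ⁻¹
            1≤ : ∀ v → h v ≈ 1# → (∀ i → a i v ≤ 0#) → 1# ≤ u zero * (M - γ v)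
            1≤ v hv av = lin₂ (≤-reflexive (trans (sym hv)
              (trans (h≈ v) (+-congʳ (*-congˡ (+-congʳ (trans (*-congˡ hv)
                (trans (*-comm M 1#) (*-identityˡ M)))))))))
              tail≤0
              (solve 3 (λ o x s → x :+ (o :+ s) := o :+ ((x :+ s) :+ con (+ 0))) refl 1#
                (u zero * (M - γ v)) _)
              where
              tail≤0 : tail u ∙ (λ i → a i v) ≤ 0#
              tail≤0 = ≤-respʳ (trans (sum-cong-≋ λ i → zeroʳ (tail u i)) (sum-0 {m} λ _ → refl))
                (sum-mono λ i → *-monoˡ (u≥0 (suc i)) (av i))
            0<u₀ : 0# < u zero
            0<u₀ = ≰⇒> λ u₀≤0 → 1≰0 (≤-trans (1≤ v₀ h₀ a₀) (≤-respʳ (zeroˡ _)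
              (*-monoʳ (diff≥0 (upper _ (v₀ , h₀ , a₀ , refl))) u₀≤0)))
            smaller : ∀ v → h v ≈ 1# → (∀ i → a i v ≤ 0#) → γ v ≤ M - κ
            smaller v hv av = *-cancelˡ-≤ 0<u₀ (lin₂ (1≤ v hv av) (≤-reflexive (inverseʳ 0<u₀))
              (solve 4 (λ u M g k → u :* (M :- k) :+ (con (+ 1) :+ u :* k) := u :* g :+
                (u :* (M :- g) :+ con (+ 1))) refl (u zero) M (γ v) κ))

  -- Archimedean property, rounding to integers, square roots.

  archimedean : ∀ x → ∃[ n ] x < fromℕ n
  archimedean x = decidable-stable em λ bounded →
    let below : ∀ n → fromℕ n ≤ x
        below n = decidable-stable em λ n≰x → bounded (n , ≰⇒> n≰x)
        s , upper , least = supremum (λ y → ∃[ n ] y ≈ fromℕ n) (0# , 0 , refl)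
          (x , λ { y (n , y≈n) → ≤-respˡ (sym y≈n) (below n) })
        -- Since n + 1 ≤ s for every n, the number s - 1 would be an upper bound as well.
        s≤s-1 = least (s - 1#) λ { y (n , y≈n) → lin₂ (upper _ (suc n , refl)) (≤-reflexive y≈n)
          (solve 3 (λ s n y → (s :- con (+ 1)) :+ ((con (+ 1) :+ n) :+ y) := y :+ (s :+ n)) refl s
            (fromℕ n) y) }
    in 1≰0 (lin₁ s≤s-1 (solve 1 (λ s → con (+ 0) :+ s := con (+ 1) :+ (s :- con (+ 1))) refl s))

  floorℕ : ∀ {x} → 0# ≤ x → ∃[ n ] fromℕ n ≤ x × x < fromℕ (suc n)
  floorℕ {x} 0≤x = let N , x<N = archimedean x in search N x<N
    where
    search : ∀ N → x < fromℕ N → ∃[ n ] fromℕ n ≤ x × x < fromℕ (suc n)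
    search zero    x<0 = ⊥-elim (<⇒≰ x<0 0≤x)
    search (suc N) x<1+N with ≤? (fromℕ N) x
    ... | inj₁ N≤x = N , N≤x , x<1+N
    ... | inj₂ x<N = search N x<N

  -- Rounding goes towards zero, so that magnitudes never grow and bounds on real coefficients carry
  -- over to the integers unchanged.
  truncate : ∀ x → ∃[ z ] (fromℤ z - x ∈± 1#) × fromℕ ℤ.∣ z ∣ ≤ ∣ x ∣ʳ
  truncate x with total 0# x
  ... | inj₁ 0≤x =
    let n , n≤x , x<1+n = floorℕ 0≤x
    in + n , (lin₁ (proj₁ x<1+n) (solve 2 (λ n x → (n :- x) :+ x := (:- con (+ 1)) :+
      (con (+ 1) :+ n)) refl (fromℕ n) x) ,
        lin₂ n≤x 0≤1 (solve 2 (λ n x → con (+ 1) :+ (n :+ con (+ 0)) := (n :- x) :+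
          (x :+ con (+ 1))) refl (fromℕ n) x)) ,
       n≤x
  ... | inj₂ x≤0 =
    let n , n≤-x , -x<1+n = floorℕ (≤-respˡ -0#≈0# (neg-mono x≤0))
        neg = fromℤ-neg (+ n)
    in ℤ.- (+ n) , ∈±-resp (+-congʳ (sym neg))
         (lin₂ n≤-x 0≤1 (solve 2 (λ n x → ((:- n) :- x) :+ (n :+ con (+ 0)) := (:- con (+ 1)) :+
           (:- x :+ con (+ 1))) refl (fromℕ n) x) ,
          lin₁ (proj₁ -x<1+n) (solve 2 (λ n x → con (+ 1) :+ :- x := ((:- n) :- x) :+
            (con (+ 1) :+ n)) refl (fromℕ n) x)) ,
       ≡.subst (λ m → fromℕ m ≤ - x) (≡.sym (ℤ.∣-i∣≡∣i∣ (+ n))) n≤-x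

  IsSquareRootSup : ℝ → ℝ → Set
  IsSquareRootSup a s = IsUpperBound (λ r → r * r ≤ a) s ×
    (∀ u → IsUpperBound (λ r → r * r ≤ a) u → s ≤ u)

  squareRootSup : ∀ {a s} → 0# ≤ a → 0# ≤ s → IsSquareRootSup a s → s * s ≈ a
  squareRootSup {a} {s} 0≤a 0≤s (upper , least) = antisym s²≤a a≤s²
    where
    S : ℝ → Set
    S r = r * r ≤ a
    a≤s² : a ≤ s * s
    a≤s² with ≤? a (s * s)
    ... | inj₁ p = p
    ... | inj₂ s²<a = ⊥-elim (<⇒≰ 0<δ (lin₁ (upper (s + δ) s+δ∈S)
        (solve 2 (λ s d → con (+ 0) :+ (s :+ d) := d :+ s) refl s δ)))
      where
      g = a - s * s
      0≤g : 0# ≤ g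
      0≤g = diff≥0 (proj₁ s²<a)
      0<g : 0# < g
      0<g = 0≤g , λ 0≈g → proj₂ s²<a (trans (trans (sym (+-identityʳ _)) (+-congˡ 0≈g))
        (solve 2 (λ a q → q :+ (a :- q) := a) refl a (s * s)))
      -- With δ = g / t one has δ ≤ 1, hence (s + δ)² ≤ s² + δ (2 s + 1) ≤ s² + g = a.
      t = fromℕ 2 * s + 1# + g
      0<t : 0# < t
      0<t = 0<-resp-≤ 0<1 (lin₃ 0≤s 0≤s 0≤g (solve 2 (λ s g → ((con (+ 2) :* s :+ con (+ 1)) :+ g)
         :+ (con (+ 0) :+ (con (+ 0) :+ con (+ 0))) := con (+ 1) :+ (s :+ (s :+ g))) refl s g))
      δ = g * t ⁻¹
      0<δ : 0# < δ
      0<δ = *-pos 0<g (⁻¹-pos 0<t)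
      δt≈g : δ * t ≈ g
      δt≈g = trans (solve 3 (λ g i t → (g :* i) :* t := g :* (t :* i)) refl g (t ⁻¹) t)
        (trans (*-congˡ (inverseʳ 0<t)) (solve 1 (λ g → g :* con (+ 1) := g) refl g))
      δ≤1 : δ ≤ 1#
      δ≤1 = *-cancelˡ-≤ 0<t (≤-respˡ (trans (sym δt≈g) (*-comm δ t)) (lin₃ 0≤s 0≤s 0≤1
        (solve 2 (λ s g → (con (+ 2) :* s :+ con (+ 1) :+ g) :* con (+ 1) :+
          (con (+ 0) :+ (con (+ 0) :+ con (+ 0)))
          := g :+ (s :+ (s :+ con (+ 1)))) refl s g)))
      s+δ∈S : S (s + δ)
      s+δ∈S = ≤-respˡ (sym (solve 2 (λ s d → (s :+ d) :* (s :+ d) := s :* s :+ con (+ 2) :* (s :* d)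
        :+ d :* d) refl s δ))
        (lin₃ (≤-respˡ (solve 3 (λ s d g → d :* (con (+ 2) :* s :+ con (+ 1) :+ g) := con (+ 2) :*
          (s :* d) :+ d :+ d :* g) refl s δ g)
                (≤-reflexive δt≈g))
              (*-monoˡ (proj₁ 0<δ) δ≤1) (*-nonNegative (proj₁ 0<δ) 0≤g)
          (solve 6 (λ a q sd d dg dd → a :+ ((con (+ 2) :* sd :+ d :+ dg) :+ (dd :+ con (+ 0)))
               := (q :+ con (+ 2) :* sd :+ dd) :+ ((a :- q) :+ (d :* con (+ 1) :+ dg)))
             refl a (s * s) (s * δ) δ (δ * g) (δ * δ)))
    s²≤a : s * s ≤ a
    s²≤a with ≤? (s * s) a
    ... | inj₁ p = p
    ... | inj₂ a<s² = ⊥-elim (<⇒≰ 0<δ (lin₁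
      (least (s - δ) λ r r²≤a → sq-≤⇒≤ (diff≥0 δ≤s) (≤-trans r²≤a a≤[s-δ]²))
        (solve 2 (λ s d → con (+ 0) :+ s := d :+ (s :- d)) refl s δ)))
      where
      g = s * s - a
      0≤g : 0# ≤ g
      0≤g = diff≥0 (proj₁ a<s²)
      0<g : 0# < g
      0<g = 0≤g , λ 0≈g → proj₂ a<s² (trans (trans (sym (+-identityʳ _)) (+-congˡ 0≈g))
        (solve 2 (λ a q → a :+ (q :- a) := q) refl a (s * s)))
      0<s : 0# < s
      0<s = 0≤s , λ 0≈s → <⇒≰ a<s² (≤-respˡ (trans (sym (zeroˡ 0#)) (*-cong 0≈s 0≈s)) 0≤a)
      -- A Newton step: for δ = g / (2 s) one has (s - δ)² = a + δ², so s - δ still bounds the set.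
      t = fromℕ 2 * s
      0<t : 0# < t
      0<t = *-pos (fromℕ-pos 1) 0<s
      δ = g * t ⁻¹
      0<δ : 0# < δ
      0<δ = *-pos 0<g (⁻¹-pos 0<t)
      δt≈g : δ * t ≈ g
      δt≈g = trans (solve 3 (λ g i t → (g :* i) :* t := g :* (t :* i)) refl g (t ⁻¹) t)
        (trans (*-congˡ (inverseʳ 0<t)) (solve 1 (λ g → g :* con (+ 1) := g) refl g))
      δ≤s : δ ≤ s
      δ≤s = *-cancelˡ-≤ 0<t (≤-respˡ (trans (sym δt≈g) (*-comm δ t)) (lin₂ 0≤a (sq≥0 s)
        (trans (+-congʳ (solve 1 (λ s → (con (+ 2) :* s) :* s := con (+ 2) :* (s :* s)) refl s))
          (solve 2 (λ q a → con (+ 2) :* q :+ (con (+ 0) :+ con (+ 0)) := (q :- a) :+ (a :+ q)) refl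
            (s * s) a))))
      a≤[s-δ]² : a ≤ (s - δ) * (s - δ)
      a≤[s-δ]² = ≤-respʳ (sym (solve 2 (λ s d → (s :- d) :* (s :- d) := s :* s :- d :*
        (con (+ 2) :* s) :+ d :* d) refl s δ))
        (lin₂ (≤-reflexive δt≈g) (sq≥0 δ)
          (solve 4 (λ q a dt dd → (q :- dt :+ dd) :+ (dt :+ con (+ 0)) := a :+ ((q :- a) :+ dd))
            refl (s * s) a (δ * t) (δ * δ)))

  sqrt : ∀ {a} → 0# ≤ a → ∃[ r ] 0# ≤ r × r * r ≈ a
  sqrt {a} 0≤a =
    let 0²≤a = ≤-respˡ (sym (zeroˡ 0#)) 0≤a
        s , upper , least = supremum (λ r → r * r ≤ a) (0# , 0²≤a) (a + 1# , λ r → bounded)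
        0≤s = upper 0# 0²≤a
    in s , 0≤s , squareRootSup 0≤a 0≤s (upper , least)
    where
    bounded : ∀ {r} → r * r ≤ a → r ≤ a + 1#
    bounded {r} r²≤a = sq-≤⇒≤ (≤-respˡ (+-identityˡ 0#) (+-mono 0≤a 0≤1))
      (lin₄ r²≤a 0≤a 0≤1 (sq≥0 a)
      (trans (+-congʳ (solve 1 (λ a → (a :+ con (+ 1)) :* (a :+ con (+ 1)) := a :* a :+ con (+ 2) :*
        a :+ con (+ 1)) refl a))
        (solve 3 (λ a q p → (p :+ con (+ 2) :* a :+ con (+ 1)) :+
          (q :+ (con (+ 0) :+ (con (+ 0) :+ con (+ 0))))
                        := q :+ (a :+ (a :+ (con (+ 1) :+ p)))) refl a (r * r) (a * a))))

  -- Selecting a well-conditioned spanning set of rows.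

  sq-pos : ∀ {x} → ¬ (x ≈ 0#) → 0# < x * x
  sq-pos {x} x≉0 = sq≥0 x , λ 0≈x² → x≉0 (trans
    (sym (trans (*-congˡ (⁻¹-inverse x x≉0)) (trans (*-comm x 1#) (*-identityˡ x))))
    (trans (solve 2 (λ x i → x :* (x :* i) := (x :* x) :* i) refl x (x ⁻¹))
      (trans (*-congʳ (sym 0≈x²)) (zeroˡ _))))

  -- Let s be the supremum of the squares. Some entry satisfies s ≤ 4 (f i)², since otherwise s / 4
  -- would be a smaller upper bound; the square of each ratio f j / f i is then at most 4.
  ∃-pivot : ∀ {I : Set} (f : I → ℝ) → I → ∃[ M ] (∀ i → f i ∈± M) →
            ∃[ i ] ∀ j → ∃[ m ] m ∈± fromℕ 2 × f j ≈ m * f i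
  ∃-pivot {I} f i₀ (M , f-bound) with em {∃[ j ] ¬ (f j ≈ 0#)}
  -- A zero column still receives a pivot, with multipliers 0, so that the number of selected rows
  -- does not depend on the rank.
  ... | no all-zero = i₀ , λ j → 0# ,
    (lin₁ (fromℕ≥0 2) (solve 0 (con (+ 0) :+ con (+ 0) := (:- con (+ 2)) :+ con (+ 2)) refl) ,
      fromℕ≥0 2) ,
    trans (decidable-stable em λ p → all-zero (j , p)) (sym (zeroˡ _))
  ... | yes (j₀ , fj₀≉0) = i , λ j → f j * f i ⁻¹ , bound j , multiple j
    where
    sup = supremum (λ y → ∃[ j ] y ≈ f j * f j) (_ , i₀ , refl)
      (M * M , λ { y (j , y≈) → ≤-respˡ (sym y≈) (proj₂ (∈±-* (f-bound j) (f-bound j))) })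
    s = proj₁ sup
    sq≤s : ∀ j → f j * f j ≤ s
    sq≤s j = proj₁ (proj₂ sup) _ (j , refl)
    0<s : 0# < s
    0<s = 0<-resp-≤ (sq-pos fj₀≉0) (sq≤s j₀)
    κ = fromℕ 4 ⁻¹
    large : ∃[ i ] s ≤ fromℕ 4 * (f i * f i)
    large = decidable-stable em λ small → <⇒≰ 0<s
      (let s≤κs = proj₂ (proj₂ sup) (κ * s) λ { y (j , y≈) → *-cancelˡ-≤ (fromℕ-pos 3)
             (≤-respˡ (*-congˡ (sym y≈)) (≤-respʳ (4κ s) (≰⇒≥ λ p → small (j , p)))) }
           4s≤s = ≤-respʳ (sym (4κ s)) (*-monoˡ (fromℕ≥0 4) s≤κs)
       in *-cancelˡ-≤ (fromℕ-pos 2) (lin₁ 4s≤s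
            (solve 1 (λ s → con (+ 3) :* con (+ 0) :+ con (+ 4) :* s := con (+ 3) :* s :+ s) refl
              s)))
      where
      4κ : ∀ s → s ≈ fromℕ 4 * (κ * s)
      4κ s = sym (trans (solve 3 (λ a b c → a :* (b :* c) := (a :* b) :* c) refl (fromℕ 4) κ s)
        (trans (*-congʳ (inverseʳ (fromℕ-pos 3))) (*-identityˡ s)))
    i = proj₁ large
    fi≉0 : ¬ (f i ≈ 0#)
    fi≉0 p = <⇒≰ 0<s (≤-respʳ (trans (*-congˡ (trans (*-congˡ p) (zeroʳ _))) (zeroʳ _))
      (proj₂ large))
    multiple : ∀ j → f j ≈ f j * f i ⁻¹ * f i
    multiple j = sym (trans (solve 3 (λ a b c → (a :* b) :* c := a :* (c :* b)) refl (f j) (f i ⁻¹)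
      (f i))
      (trans (*-congˡ (⁻¹-inverse _ fi≉0)) (solve 1 (λ a → a :* con (+ 1) := a) refl (f j))))
    bound : ∀ j → f j * f i ⁻¹ ∈± fromℕ 2
    bound j = ≤-respʳ (-‿involutive m) (neg-mono
      (sq-≤⇒≤ (fromℕ≥0 2) (≤-respˡ (solve 1 (λ m → m :* m := :- m :* :- m) refl m) m²≤4))) ,
              sq-≤⇒≤ (fromℕ≥0 2) m²≤4
      where
      m = f j * f i ⁻¹
      m²≤4 : m * m ≤ fromℕ 2 * fromℕ 2
      m²≤4 = *-cancelˡ-≤ (sq-pos fi≉0) (≤-respˡ
        (trans (*-cong (multiple j) (multiple j))
          (solve 2 (λ m c → (m :* c) :* (m :* c) := (c :* c) :* (m :* m)) refl m (f i)))
        (≤-trans (sq≤s j) (≤-respʳ (solve 1 (λ c → con (+ 4) :* c := c :* (con (+ 2) :* con (+ 2)))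
          refl (f i * f i)) (proj₂ large))))

  -- In closed form 3^N - 1.
  spanLoss : ℕ → ℕ
  spanLoss zero    = 0
  spanLoss (suc N) = 3 ℕ.* spanLoss N ℕ.+ 2

  -- The dual form of the statement that each f i is a combination of the rows f (g l) whose
  -- coefficients have absolute sum at most K. In this form no coefficients have to be tracked
  -- through the elimination.
  Spans : ∀ {N} {I : Set} → (I → ℝ^ N) → ∀ {L} → (Fin L → I) → ℝ → Set
  Spans f g K = ∀ w θ → (∀ l → f (g l) ∙ w ∈± θ) → ∀ i → f i ∙ w ∈± K * θ

  eliminate : ∀ {N} {I : Set} → (I → ℝ^ (suc N)) → I → (I → ℝ) → I → ℝ^ N
  eliminate f p m i j = f i (suc j) - m i * f p (suc j)

  eliminate-∙ : ∀ {N} {I : Set} (f : I → ℝ^ (suc N)) p m → (∀ i → f i zero ≈ m i * f p zero) →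
                ∀ w i → eliminate f p m i ∙ tail w ≈ f i ∙ w - m i * (f p ∙ w)
  eliminate-∙ f p m multiple w i = trans (∙-sub (tail (f i)) (λ j → m i * f p (suc j)) (tail w))
    (trans (+-congˡ (-‿cong (∙-scaleˡ (m i) (tail (f p)) (tail w))))
      (trans (solve 5 (λ T m t c w₀ → T :- m :* t := (((m :* c) :* w₀) :+ T) :- m :* (c :* w₀ :+ t))
        refl
          (tail (f i) ∙ tail w) (m i) (tail (f p) ∙ tail w) (f p zero) (w zero))
        (+-congʳ (+-congʳ (*-congʳ (sym (multiple i)))))))

  -- On the selected indices the eliminated rows are at most θ + 2 θ, so all eliminated rows are at
  -- most 3 K θ; restoring the multiple of the pivot row adds 2 θ.
  spans-step : ∀ {N} {I : Set} (f : I → ℝ^ (suc N)) p m → (∀ i → m i ∈± fromℕ 2) →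
               (∀ i → f i zero ≈ m i * f p zero) → ∀ {g : Fin N → I} {K} →
               Spans (eliminate f p m) g K → Spans f (p Vector.∷ g) (fromℕ 3 * K + fromℕ 2)
  spans-step f p m m-bound multiple {g} {K} spans w θ small i =
    ∈±-resp (trans (+-congʳ (f′∙w i)) (solve 2 (λ x y → (x :- y) :+ y := x) refl (f i ∙ w)
      (m i * (f p ∙ w))))
      (∈±-mono (≤-reflexive (solve 2 (λ s t → s :* (t :+ con (+ 2) :* t) :+ con (+ 2) :* t :=
        (con (+ 3) :* s :+ con (+ 2)) :* t) refl K θ))
        (∈±-+
          (spans (tail w) (θ + fromℕ 2 * θ) (λ l → ∈±-resp (sym (f′∙w (g l)))
            (∈±-- (small (suc l)) (∈±-* (m-bound (g l)) (small zero)))) i)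
          (∈±-* (m-bound i) (small zero))))
    where
    f′∙w = eliminate-∙ f p m multiple w

  -- Gaussian elimination whose pivot row has, up to a factor 2, the largest
  -- entry in its column: every multiplier is then at most 2.
  ∃-spanner : ∀ N {I : Set} (f : I → ℝ^ N) → I → ∀ {M} → (∀ i j → f i j ∈± M) →
              ∃[ g ] Spans f {N} g (fromℕ (spanLoss N))
  ∃-spanner zero f i₀ _ = (λ ()) , λ w θ _ i →
    ≤-reflexive (solve 1 (λ t → :- (con (+ 0) :* t) := con (+ 0)) refl θ) , ≤-reflexive
      (sym (zeroˡ θ))
  ∃-spanner (suc N) f i₀ f-bound =
    let p , multiples = ∃-pivot (λ i → f i zero) i₀ (_ , λ i → f-bound i zero)
        m i = proj₁ (multiples i)
        m-bound i = proj₁ (proj₂ (multiples i))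
        -- The bound on the entries grows from M to M + 2 M. It serves to make the suprema exist;
        -- the loss depends on N alone.
        g , spans = ∃-spanner N (eliminate f p m) i₀ λ i j →
          ∈±-- (f-bound i (suc j)) (∈±-* (m-bound i) (f-bound p (suc j)))
    in p Vector.∷ g , λ w θ small i → ∈±-mono
         (≤-reflexive (*-congʳ (sym (trans (fromℕ-+ (3 ℕ.* spanLoss N) 2)
           (+-congʳ (fromℕ-* 3 (spanLoss N)))))))
         (spans-step f p m m-bound (λ i → proj₂ (proj₂ (multiples i))) spans w θ small i)

  -- Slack factorizations and the dual distance criterion.

  sum-↑ : ∀ p {q} (f : ℝ^ (p ℕ.+ q)) → sum f ≈ sum (λ i → f (i ↑ˡ q)) + sum (λ i → f (p ↑ʳ i))
  sum-↑ zero    f = sym (+-identityˡ _)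
  sum-↑ (suc p) f = trans (+-congˡ (sum-↑ p (tail f)))
    (solve 3 (λ x y z → x :+ (y :+ z) := (x :+ y) :+ z) refl (f zero) _ _)

  ∙-++ : ∀ {p q} {V : Set} (u : ℝ^ (p ℕ.+ q)) (a : Vector (V → ℝ) p) (b : Vector (V → ℝ) q) v →
         u ∙ (λ i → (a Vector.++ b) i v) ≈
         (λ i → u (i ↑ˡ q)) ∙ (λ i → a i v) + (λ i → u (p ↑ʳ i)) ∙ (λ i → b i v)
  ∙-++ {p} {q} u a b v = trans (sum-↑ p _) (+-cong
    (∙-congˡ {a = λ i → u (i ↑ˡ q)} λ i → reflexive (≡.cong (λ f → f v) (lookup-++ˡ a b i)))
    (∙-congˡ {a = λ i → u (p ↑ʳ i)} λ i → reflexive (≡.cong (λ f → f v) (lookup-++ʳ a b i))))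

  ∙-const : ∀ {n} (u : ℝ^ n) t → u ∙ (λ _ → t) ≈ sum u * t
  ∙-const u t = sym (*-distribʳ-sum t u)

  ∙-∈± : ∀ {n} {c x : ℝ^ n} {a b} → (∀ i → c i ∈± a) → (∀ i → x i ∈± b) → c ∙ x ∈± fromℕ n * (a * b)
  ∙-∈± {n} {a = a} {b} p q = ∈±-mono (≤-reflexive (sum-const n (a * b)))
    (sum-∈± λ i → ∈±-* (p i) (q i))

  -- Yannakakis' nonnegative factorization of the slacks β - c · p t, with rows indexed by all c of
  -- the cube in place of the facets. The bounds on `Y` and u keep the rounded coefficients small.
  record SlackFactorization {n : ℕ} {T : Set} (p : T → ℝ^ n) (k : ℕ) : Set where
    field
      Y    : T → ℝ^ k
      Y≥0  : ∀ t j → 0# ≤ Y t j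
      Y≤1  : ∀ t j → Y t j ≤ 1#
      row  : (c : ℝ^ n) → (∀ i → c i ∈± 1#) → ∃[ u ] (∀ j → 0# ≤ u j × u j ≤ fromℕ (2 ℕ.* n)) ×
             (∃[ β ] (∀ t → c ∙ p t + u ∙ Y t ≈ β) × (∃[ t ] β ≤ c ∙ p t))

  scale-cancel : ∀ σ (y : ℝ) → 0# ≤ y → y ≤ σ →
                 ∃[ z ] 0# ≤ z × z ≤ 1# × σ * z ≈ y
  scale-cancel σ y 0≤y y≤σ with ≤? σ 0#
  -- Here y = 0 too, so 0 is as good as any z in [0, 1]; the case arises for an inequality that is
  -- tight at every lift.
  ... | inj₁ σ≤0 = 0# , ≤-refl , 0≤1 , trans (zeroʳ σ) (antisym 0≤y (≤-trans y≤σ σ≤0))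
  ... | inj₂ 0<σ = σ ⁻¹ * y , *-nonNegative (⁻¹≥0 0<σ) 0≤y ,
    *-cancelˡ-≤ 0<σ (≤-respˡ (sym σσ⁻¹y) (≤-respʳ (sym (trans (*-comm σ 1#) (*-identityˡ σ))) y≤σ))
      , σσ⁻¹y
    where
    σσ⁻¹y : σ * (σ ⁻¹ * y) ≈ y
    σσ⁻¹y = trans (solve 3 (λ a b c → a :* (b :* c) := (a :* b) :* c) refl σ (σ ⁻¹) y)
      (trans (*-congʳ (inverseʳ 0<σ)) (*-identityˡ y))

  -- An extended formulation in homogeneous form: h is the homogenizing coordinate, s j are the
  -- slacks and π is the projection. Finiteness of the vertex set enters through `maximum`, and
  -- `valid` expresses by linear functionals that feasible points project into P.
  module Extension
    {V : Set} (_⊹_⟨_⟩ : V → ℝ → V → V)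
    {h : V → ℝ} (h-linear : Forms.Linear _⊹_⟨_⟩ h)
    {k : ℕ} {s : Fin k → V → ℝ} (s-linear : ∀ j → Forms.Linear _⊹_⟨_⟩ (s j))
    {n : ℕ} {π : Fin n → V → ℝ} (π-linear : ∀ i → Forms.Linear _⊹_⟨_⟩ (π i))
    {T : Set} (maximum : (f : T → ℝ) → ∃[ t ] (∀ t′ → f t′ ≤ f t))
    (lift : T → V) (lift-h : ∀ t → h (lift t) ≈ 1#) (lift-s : ∀ t j → 0# ≤ s j (lift t))
    (valid : ∀ v → h v ≈ 1# → (∀ j → 0# ≤ s j v) → ∀ c M →
             (∀ t → c ∙ (λ i → π i (lift t)) ≤ M) → c ∙ (λ i → π i v) ≤ M)
    (t₀ : T)
    where

    open Forms _⊹_⟨_⟩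
    open Affine h-linear

    p : T → ℝ^ n
    p t i = π i (lift t)

    private
      -s : Fin k → V → ℝ
      -s j v = - s j v

      -s-linear : ∀ j → Linear (-s j)
      -s-linear j = linear-neg (s-linear j)

      ≥0⇒-≤0 : ∀ {x} → 0# ≤ x → - x ≤ 0#
      ≥0⇒-≤0 q = ≤-respʳ -0#≈0# (neg-mono q)

      -≤0⇒≥0 : ∀ {x} → - x ≤ 0# → 0# ≤ x
      -≤0⇒≥0 q = ≤-respˡ -0#≈0# (≤-respʳ (-‿involutive _) (neg-mono q))

      ∙-negʳ : ∀ (u : ℝ^ k) v → u ∙ (λ j → -s j v) ≈ - (u ∙ (λ j → s j v))
      ∙-negʳ u v = trans (∙-comm u _) (trans (∙-neg _ u) (-‿cong (∙-comm _ u)))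

    -- Duality is applied to the valid inequality c · π ≤ M h, where M is the maximum over the
    -- lifts. The multiplier of -h shifts the constant to β = M - u₀, which stays below the value at
    -- the maximiser.
    certificate : ∀ c → ∃[ u ] (∀ j → 0# ≤ u j) × (∃[ β ]
      (∀ t → c ∙ p t + u ∙ (λ j → s j (lift t)) ≈ β) × (∃[ t ] β ≤ c ∙ p t))
    certificate c =
      let t* , max = maximum (λ t → c ∙ p t)
          M = c ∙ p t*
          u₀ , u₀≥0 , u , u≥0 , γ≈ = dual -s -s-linear {γ = λ v → c ∙ (λ i → π i v) - M * h v}
            (linear-- (linear-∙ c π-linear) (linear-* M h-linear))
            (lift t₀) (lift-h t₀) (λ j → ≥0⇒-≤0 (lift-s t₀ j))
            λ v hv -s≤0 → below hv (valid v hv (λ j → -≤0⇒≥0 (-s≤0 j)) c M max)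
      in u , u≥0 , M - u₀ ,
         (λ t → identity M u₀ (c ∙ p t) (u ∙ (λ j → s j (lift t))) (lift-h t)
            (trans (γ≈ (lift t)) (+-congʳ (∙-negʳ u (lift t))))) ,
         t* , subtract≤ u₀≥0
      where
      below : ∀ {cp M hv} → hv ≈ 1# → cp ≤ M → cp - M * hv ≤ 0#
      below {cp} {M} hv≈1 cp≤M = ≤-respˡ (+-congˡ (-‿cong (*-congˡ (sym hv≈1)))) (lin₁ cp≤M
        (solve 2 (λ x m → con (+ 0) :+ x := (x :- m :* con (+ 1)) :+ m) refl cp M))
      subtract≤ : ∀ {M u₀} → 0# ≤ u₀ → M - u₀ ≤ M
      subtract≤ {M} {u₀} u₀≥0 = lin₁ u₀≥0 (solve 2 (λ M u → M :+ con (+ 0) := (M :- u) :+ u) refl M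
        u₀)
      identity : ∀ M u₀ cp us {hv} → hv ≈ 1# → cp - M * hv ≈ - us - u₀ * hv → cp + us ≈ M - u₀
      identity M u₀ cp us {hv} hv≈1 eq = trans
        (solve 3 (λ cp us M → cp :+ us := (cp :- M :* con (+ 1)) :+ (us :+ M)) refl cp us M)
        (trans (+-congʳ (trans (+-congˡ (-‿cong (*-congˡ (sym hv≈1))))
          (trans eq (+-congˡ (-‿cong (*-congˡ hv≈1))))))
          (solve 3 (λ us M u₀ → (:- us :- u₀ :* con (+ 1)) :+ (us :+ M) := M :- u₀) refl us M u₀))

    -- The slacks are rescaled to have maximum 1 over the lifts; then a
    -- multiplier is itself the product of a slack and a multiplier, hence at
    -- most the slack of the inequality at some vertex.
    factorization : (∀ t i → p t i ∈± 1#) → SlackFactorization p k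
    factorization p-bound = record
      { Y   = λ t j → proj₁ (scaled t j)
      ; Y≥0 = λ t j → proj₁ (proj₂ (scaled t j))
      ; Y≤1 = λ t j → proj₁ (proj₂ (proj₂ (scaled t j)))
      ; row = λ c c-bound →
          let u , u≥0 , β , eq , t , β≤ = certificate c
          in (λ j → u j * σ j) , (λ j → *-nonNegative (u≥0 j) (σ≥0 j) , bounded c c-bound u u≥0 β eq
            t β≤ j) ,
             β , (λ t → trans (+-congˡ (sum-cong-≋ λ j →
               trans (solve 3 (λ u s z → (u :* s) :* z := u :* (s :* z)) refl (u j) (σ j)
                 (proj₁ (scaled t j)))
                 (*-congˡ (proj₂ (proj₂ (proj₂ (scaled t j))))))) (eq t)) , t , β≤
      }
      where
      argmax : ∀ j → ∃[ t ] (∀ t′ → s j (lift t′) ≤ s j (lift t))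
      argmax j = maximum (λ t → s j (lift t))
      σ : ℝ^ k
      σ j = s j (lift (proj₁ (argmax j)))
      σ≥0 : ∀ j → 0# ≤ σ j
      σ≥0 j = lift-s _ j
      scaled : ∀ t j → ∃[ z ] 0# ≤ z × z ≤ 1# × σ j * z ≈ s j (lift t)
      scaled t j = scale-cancel (σ j) (s j (lift t)) (lift-s t j) (proj₂ (argmax j) t)
      bounded : ∀ c → (∀ i → c i ∈± 1#) → ∀ u → (∀ j → 0# ≤ u j) → ∀ β →
        (∀ t → c ∙ p t + u ∙ (λ j → s j (lift t)) ≈ β) → ∀ t → β ≤ c ∙ p t →
        ∀ j → u j * σ j ≤ fromℕ (2 ℕ.* n)
      bounded c c-bound u u≥0 β eq t β≤ j = ≤-respʳ (sym (fromℕ-* 2 n))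
        -- The slack in question is β - c · p t′ ≤ c · p t - c · p t′, and each of the two products
        -- lies between - n and n.
        (≤-trans (term≤sum (λ j′ → *-nonNegative (u≥0 j′) (lift-s t′ j′)) j)
          (lin₄ (≤-reflexive (eq t′)) β≤ (proj₁ (c∙p t′)) (proj₂ (c∙p t))
            (solve 5 (λ n cp′ us β cp → con (+ 2) :* n :+
              ((cp′ :+ us) :+ (β :+ (:- (n :* (con (+ 1) :* con (+ 1))) :+ cp)))
                := us :+ (β :+ (cp :+ (cp′ :+ n :* (con (+ 1) :* con (+ 1)))))) refl
              (fromℕ n) (c ∙ p t′) (u ∙ (λ j → s j (lift t′))) β (c ∙ p t))))
        where
        t′ = proj₁ (argmax j)
        c∙p : ∀ t → c ∙ p t ∈± fromℕ n * (1# * 1#)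
        c∙p t = ∙-∈± c-bound (p-bound t)

    box-∙ : ∀ (u x : ℝ^ n) τ v → h v ≈ 1# →
            u ∙ (λ i → (x i * h v - π i v) - τ * h v) ≈ (u ∙ x - u ∙ (λ i → π i v)) - sum u * τ
    box-∙ u x τ v hv = trans (∙-congˡ {a = u} λ i → +-cong
      (+-congʳ (trans (*-congˡ hv) (trans (*-comm _ _) (*-identityˡ _))))
        (-‿cong (trans (*-congˡ hv) (trans (*-comm _ _) (*-identityˡ _)))))
      (trans (∙-comm u _) (trans (∙-sub _ _ u) (+-cong
        (trans (∙-sub x (λ i → π i v) u) (+-cong (∙-comm x u) (-‿cong (∙-comm _ u))))
        (-‿cong (trans (∙-comm _ u) (∙-const u τ))))))

    box⁻-∙ : ∀ (u x : ℝ^ n) τ v → h v ≈ 1# →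
            u ∙ (λ i → - (x i * h v - π i v) - τ * h v) ≈ (u ∙ (λ i → π i v) - u ∙ x) - sum u * τ
    box⁻-∙ u x τ v hv = trans (∙-congˡ {a = u} λ i → +-cong
      (trans (-‿cong (+-congʳ (trans (*-congˡ hv) (trans (*-comm _ _) (*-identityˡ _)))))
          (solve 2 (λ x y → :- (x :- y) := y :- x) refl (x i) (π i v)))
        (-‿cong (trans (*-congˡ hv) (trans (*-comm _ _) (*-identityˡ _)))))
      (trans (∙-comm u _) (trans (∙-sub _ _ u) (+-cong
        (trans (∙-sub (λ i → π i v) x u) (+-cong (∙-comm _ u) (-‿cong (∙-comm x u))))
        (-‿cong (trans (∙-comm _ u) (∙-const u τ))))))

    -- If the box of radius τ around x missed the feasible projections, Farkas multipliers `up` and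
    -- `dn` of its two sides would give c = up - dn with c · x ≥ c · p t + τ W + 1 for all t, where
    -- W is their total weight.
    ∃-near : ∀ x τ → (∀ c W → (∀ i → c i ∈± W) → ∃[ t ] c ∙ x ≤ c ∙ p t + τ * W) →
             ∃[ v ] h v ≈ 1# × (∀ j → 0# ≤ s j v) × (∀ i → x i - π i v ∈± τ)
    ∃-near x τ close = decidable-stable em λ far →
      let u , u≥0 , h≈ = infeasible forms forms-linear λ (v , hv , ≤0) → far
            (v , hv , (λ j → -≤0⇒≥0 (All.++⁻ˡ (λ f → f v ≤ 0#) -s {boxes} ≤0 j)) , λ i →
              lower v hv i (All.++⁻ʳ (λ f → f v ≤ 0#) upper (All.++⁻ʳ (λ f → f v ≤ 0#) -s ≤0) i) ,
              higher v hv i (All.++⁻ˡ (λ f → f v ≤ 0#) upper {lower′}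
                (All.++⁻ʳ (λ f → f v ≤ 0#) -s ≤0) i))
      in refute u u≥0 h≈
      where
      upper lower′ : Fin n → V → ℝ
      upper  i v = (x i * h v - π i v) - τ * h v
      lower′ i v = - (x i * h v - π i v) - τ * h v
      boxes : Fin (n ℕ.+ n) → V → ℝ
      boxes = upper Vector.++ lower′
      forms : Fin (k ℕ.+ (n ℕ.+ n)) → V → ℝ
      forms = -s Vector.++ boxes
      difference-linear : ∀ i → Linear (λ v → x i * h v - π i v)
      difference-linear i = linear-- (linear-* (x i) h-linear) (π-linear i)
      forms-linear : ∀ i → Linear (forms i)
      forms-linear = All.++⁺ Linear -s-linear (All.++⁺ Linear
        (λ i → linear-- (difference-linear i) (linear-* τ h-linear))
        (λ i → linear-- (linear-neg (difference-linear i)) (linear-* τ h-linear)))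
      higher : ∀ v → h v ≈ 1# → ∀ i → upper i v ≤ 0# → x i - π i v ≤ τ
      higher v hv i q = lin₁ (≤-respˡ (+-cong (+-congʳ (*-congˡ hv)) (-‿cong (*-congˡ hv))) q)
        (solve 3 (λ x p t → t :+ ((x :* con (+ 1) :- p) :- t :* con (+ 1)) := (x :- p) :+ con (+ 0))
          refl (x i) (π i v) τ)
      lower : ∀ v → h v ≈ 1# → ∀ i → lower′ i v ≤ 0# → - τ ≤ x i - π i v
      lower v hv i q = lin₁ (≤-respˡ (+-cong (-‿cong (+-congʳ (*-congˡ hv))) (-‿cong (*-congˡ hv)))
        q)
        (solve 3 (λ x p t → (x :- p) :+ (:- (x :* con (+ 1) :- p) :- t :* con (+ 1)) := (:- t) :+
          con (+ 0)) refl (x i) (π i v) τ)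
      refute : ∀ u → (∀ i → 0# ≤ u i) → (∀ v → h v ≈ u ∙ (λ i → forms i v)) → ⊥
      refute u u≥0 h≈ =
        -- The total weight of the box multipliers bounds every |c i| and is also the factor with
        -- which τ enters the certificate.
        refute-at (close c (sum up + sum dn) λ i →
          ∈±-mono (+-mono (term≤sum up≥0 i) (term≤sum dn≥0 i)) (difference-∈± (up≥0 i) (dn≥0 i)))
        where
        w : ℝ^ k
        w j = u (j ↑ˡ (n ℕ.+ n))
        up dn : ℝ^ n
        up i = u (k ↑ʳ (i ↑ˡ n))
        dn i = u (k ↑ʳ (n ↑ʳ i))
        w≥0 : ∀ j → 0# ≤ w j
        w≥0 j = u≥0 _
        up≥0 : ∀ i → 0# ≤ up i
        up≥0 i = u≥0 _
        dn≥0 : ∀ i → 0# ≤ dn i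
        dn≥0 i = u≥0 _
        c : ℝ^ n
        c i = up i - dn i
        difference-∈± : ∀ {a b} → 0# ≤ a → 0# ≤ b → a - b ∈± a + b
        difference-∈± {a} {b} p q =
          lin₂ p p (solve 2 (λ a b → (a :- b) :+ (con (+ 0) :+ con (+ 0)) := (:- (a :+ b)) :+
            (a :+ a)) refl a b) ,
          lin₂ q q (solve 2 (λ a b → (a :+ b) :+ (con (+ 0) :+ con (+ 0)) := (a :- b) :+ (b :+ b))
            refl a b)
        combined : ∀ t → 1# ≈ - (w ∙ (λ j → s j (lift t))) +
          (((up ∙ x - up ∙ p t) - sum up * τ) + ((dn ∙ p t - dn ∙ x) - sum dn * τ))
        combined t = trans (sym (lift-h t)) (trans (h≈ (lift t)) (trans (∙-++ u -s boxes (lift t))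
          (+-cong (∙-negʳ w (lift t)) (trans (∙-++ (λ i → u (k ↑ʳ i)) upper lower′ (lift t))
            (+-cong (box-∙ up x τ (lift t) (lift-h t)) (box⁻-∙ dn x τ (lift t) (lift-h t)))))))
        contradictory : ∀ {ux dx ut dt A B ws} →
          1# ≈ - ws + (((ux - ut) - A * τ) + ((dt - dx) - B * τ)) →
          ux - dx ≤ (ut - dt) + τ * (A + B) → 0# ≤ ws → ⊥
        contradictory {ux} {dx} {ut} {dt} {A} {B} {ws} eq c∙x≤ ws≥0 = 1≰0
          (lin₃ (≤-reflexive eq) c∙x≤ ws≥0
          (solve 8 (λ ux dx ut dt A B τ ws →
            con (+ 0) :+ (con (+ 1) :+ ((ux :- dx) :+ con (+ 0))) :=
            con (+ 1) :+ ((:- ws :+ (((ux :- ut) :- A :* τ) :+ ((dt :- dx) :- B :* τ)))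
              :+ (((ut :- dt) :+ τ :* (A :+ B)) :+ ws))) refl ux dx ut dt A B τ ws))
        refute-at : ∃[ t ] c ∙ x ≤ c ∙ p t + τ * (sum up + sum dn) → ⊥
        refute-at (t , c∙x≤) = contradictory (combined t)
          (≤-respˡ (∙-sub up dn x) (≤-respʳ (+-congʳ (∙-sub up dn (p t))) c∙x≤))
          (∙-nonNegative {a = w} w≥0 (λ j → lift-s t j))

  -- Closeness tested by linear functionals.

  ++-∙-++ : ∀ {p q} (a x : ℝ^ p) (b y : ℝ^ q) → (a Vector.++ b) ∙ (x Vector.++ y) ≈ a ∙ x + b ∙ y
  ++-∙-++ {p} {q} a x b y = trans (sum-↑ p _) (+-cong
    (sum-cong-≋ λ i → reflexive (≡.cong₂ _*_ (lookup-++ˡ a b i) (lookup-++ˡ x y i)))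
    (sum-cong-≋ λ i → reflexive (≡.cong₂ _*_ (lookup-++ʳ a b i) (lookup-++ʳ x y i))))

  ∙-∈±-sum : ∀ {n} {e x : ℝ^ n} {a : ℝ^ n} → (∀ i → e i ∈± 1#) → (∀ i → x i ∈± a i) → e ∙ x ∈± sum a
  ∙-∈±-sum {a = a} p q = ∈±-mono (≤-reflexive (sum-cong-≋ λ i → *-identityˡ (a i)))
    (sum-∈± λ i → ∈±-* (p i) (q i))

  ∈±-divide : ∀ {d r a} → 0# < d → d * r ∈± d * a → r ∈± a
  ∈±-divide {d} {r} {a} 0<d (p , q) =
    *-cancelˡ-≤ 0<d (≤-respˡ (solve 2 (λ d a → :- (d :* a) := d :* :- a) refl d a) p) , *-cancelˡ-≤
      0<d q

  nonNegative⇒∈± : ∀ {x a} → 0# ≤ x → x ≤ a → x ∈± a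
  nonNegative⇒∈± {x} {a} p q = lin₂ p (≤-trans p q)
    (solve 2 (λ x a → x :+ (con (+ 0) :+ con (+ 0)) := (:- a) :+ (x :+ a)) refl x a) , q

  ∥_∥₁ : ∀ {n} → ℝ^ n → ℝ
  ∥ x ∥₁ = sum (λ i → ∣ x i ∣ʳ)

  -- By duality this says that x has ℓ₁ distance at most τ from the hull of the points. W is any
  -- bound on the entries of c, so no maximum norm has to be formed.
  Close : ∀ {n} {T : Set} → (T → ℝ^ n) → ℝ^ n → ℝ → Set
  Close p x τ = ∀ c W → (∀ i → c i ∈± W) → ∃[ t ] c ∙ x ≤ c ∙ p t + τ * W

  close-mono : ∀ {n} {T : Set} {p : T → ℝ^ (suc n)} {x τ τ′} → τ ≤ τ′ → Close p x τ → Close p x τ′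
  close-mono τ≤τ′ close c W c-bound =
    let t , q = close c W c-bound
    in t , ≤-trans q (+-mono ≤-refl (*-monoʳ (∈±-bound≥0 (c-bound zero)) τ≤τ′))

  close-homogeneous : ∀ {n} {T : Set} {p : T → ℝ^ (suc n)} {x τ} → T →
    (∀ c → (∀ i → c i ∈± 1#) → ∃[ t ] c ∙ x ≤ c ∙ p t + τ) → Close p x τ
  close-homogeneous {n} {p = p} {x} {τ} t₀ unit c W c-bound with ≤? W 0#
  ... | inj₁ W≤0 = t₀ , ≤-reflexive (trans (vanish x)
    (sym (trans (+-cong (vanish (p t₀)) (trans (*-congˡ W≈0) (zeroʳ τ))) (+-identityʳ 0#))))
    where
    W≈0 : W ≈ 0#
    W≈0 = antisym W≤0 (∈±-bound≥0 (c-bound zero))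
    c≈0 : ∀ i → c i ≈ 0#
    c≈0 i = antisym (≤-trans (proj₂ (c-bound i)) W≤0)
      (≤-trans (≤-reflexive (trans (sym -0#≈0#) (-‿cong (sym W≈0)))) (proj₁ (c-bound i)))
    vanish : ∀ z → c ∙ z ≈ 0#
    vanish z = sum-0 λ i → trans (*-congʳ (c≈0 i)) (zeroˡ (z i))
  ... | inj₂ 0<W = rescale (unit (λ i → W ⁻¹ * c i) λ i → ∈±-divide 0<W
        (∈±-resp (sym (cancel (c i))) (∈±-mono
          (≤-reflexive (sym (trans (*-comm W 1#) (*-identityˡ W)))) (c-bound i))))
    where
    cancel : ∀ z → W * (W ⁻¹ * z) ≈ z
    cancel z = trans (solve 3 (λ a b c → a :* (b :* c) := (a :* b) :* c) refl W (W ⁻¹) z)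
      (trans (*-congʳ (inverseʳ 0<W)) (*-identityˡ z))
    rescale : (∃[ t ] (λ i → W ⁻¹ * c i) ∙ x ≤ (λ i → W ⁻¹ * c i) ∙ p t + τ) → ∃[ t ] c ∙ x ≤ c ∙ p
      t + τ * W
    rescale (t , q) = t , ≤-respˡ (trans (*-congˡ (∙-scaleˡ _ c x)) (cancel _))
      (≤-respʳ (trans (distribˡ W _ τ) (+-cong (trans (*-congˡ (∙-scaleˡ _ c (p t))) (cancel _))
        (*-comm W τ)))
        (*-monoˡ (proj₁ 0<W) q))

  -- Rounding the selected equations.

  module Rounding {n k : ℕ} {T : Set} {p : T → ℝ^ (suc n)} (F : SlackFactorization p k)
    (p-bound : ∀ t i → p t i ∈± 1#) (t₀ : T) (D : ℕ) (0<D : 0# < fromℕ D) where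

    open SlackFactorization F

    private
      N : ℕ
      N = suc n ℕ.+ k

      δ Δ K m : ℝ
      δ = fromℕ D
      Δ = fromℕ (suc N)
      K = fromℕ (spanLoss N)
      m = fromℕ (suc n)

    Row : Set
    Row = Σ[ c ∈ ℝ^ (suc n) ] (∀ i → c i ∈± 1#)

    coefX : Row → ℝ^ (suc n)
    coefX (c , _) = c

    coefY : Row → ℝ^ k
    coefY (c , c-bound) = proj₁ (row c c-bound)

    coefY≥0 : ∀ r j → 0# ≤ coefY r j
    coefY≥0 (c , c-bound) j = proj₁ (proj₁ (proj₂ (row c c-bound)) j)

    coefY≤ : ∀ r j → coefY r j ≤ fromℕ (2 ℕ.* suc n)
    coefY≤ (c , c-bound) j = proj₂ (proj₁ (proj₂ (row c c-bound)) j)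

    rhs : Row → ℝ
    rhs (c , c-bound) = proj₁ (proj₂ (proj₂ (row c c-bound)))

    rhs-identity : ∀ r t → coefX r ∙ p t + coefY r ∙ Y t ≈ rhs r
    rhs-identity (c , c-bound) = proj₁ (proj₂ (proj₂ (proj₂ (row c c-bound))))

    rhs-attained : ∀ r → ∃[ t ] rhs r ≤ coefX r ∙ p t
    rhs-attained (c , c-bound) = proj₂ (proj₂ (proj₂ (proj₂ (row c c-bound))))

    1≤2n : 1# ≤ fromℕ (2 ℕ.* suc n)
    1≤2n = 1≤suc (n ℕ.+ 1 ℕ.* suc n)

    rhs-bound : ∀ r → rhs r ∈± fromℕ (2 ℕ.* suc n)
    rhs-bound r = ∈±-mono (≤-trans (≤-reflexive
      (solve 1 (λ m → m :* (con (+ 1) :* con (+ 1)) := m) refl m)) (fromℕ-mono (ℕ.m≤m+n (suc n) _)))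
      (≤-trans (proj₁ (dot-bound t₀)) (≤-respʳ (rhs-identity r t₀)
        (lin₁ (∙-nonNegative {a = coefY r} (coefY≥0 r) (Y≥0 t₀))
         (solve 2 (λ x y → (x :+ y) :+ con (+ 0) := x :+ y) refl (coefX r ∙ p t₀) _))) ,
       ≤-trans (proj₂ (rhs-attained r)) (proj₂ (dot-bound (proj₁ (rhs-attained r)))))
      where
      dot-bound : ∀ t → coefX r ∙ p t ∈± m * (1# * 1#)
      dot-bound t = ∙-∈± (proj₂ r) (p-bound t)

    residual : Row → ℝ^ (suc n) → ℝ^ k → ℝ
    residual r x y = (coefX r ∙ x + coefY r ∙ y) - rhs r

    private
      vector : Row → ℝ^ N
      vector r = coefX r Vector.++ coefY r

      -- The base point (p t₀, Y t₀) solves every equation, so residuals are linear in the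
      -- displacement from it. Right-hand sides then need no column of their own, and N rather than
      -- N + 1 rows are selected.
      displacement : ℝ^ (suc n) → ℝ^ k → ℝ^ N
      displacement x y = (λ i → x i - p t₀ i) Vector.++ (λ j → y j - Y t₀ j)

      ∙-subʳ : ∀ {n} (a x y : ℝ^ n) → a ∙ (λ i → x i - y i) ≈ a ∙ x - a ∙ y
      ∙-subʳ a x y = trans (∙-comm a _) (trans (∙-sub x y a)
        (+-cong (∙-comm x a) (-‿cong (∙-comm y a))))

      vector-∙ : ∀ r x y → vector r ∙ displacement x y ≈ residual r x y
      vector-∙ r x y = trans (++-∙-++ (coefX r) _ (coefY r) _)
        (trans (+-cong (∙-subʳ (coefX r) x (p t₀)) (∙-subʳ (coefY r) y (Y t₀)))
          (trans (solve 4 (λ a b c d → (a :- b) :+ (c :- d) := (a :+ c) :- (b :+ d)) refl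
              (coefX r ∙ x) (coefX r ∙ p t₀) (coefY r ∙ y) (coefY r ∙ Y t₀))
            (+-congˡ (-‿cong (rhs-identity r t₀)))))

      vector-bound : ∀ r i → vector r i ∈± fromℕ (2 ℕ.* suc n)
      vector-bound r = All.++⁺ (_∈± fromℕ (2 ℕ.* suc n)) (λ i → ∈±-mono 1≤2n (proj₂ r i))
        (λ j → nonNegative⇒∈± (coefY≥0 r j) (coefY≤ r j))

      spanner : ∃[ g ] Spans vector {N} g K
      spanner = ∃-spanner N vector ((λ _ → 0#) , λ _ → ≤-trans (neg-mono 0≤1) (≤-reflexive -0#≈0#) ,
        0≤1) vector-bound

    basis : Fin N → Row
    basis = proj₁ spanner

    basis-spans : ∀ {x y θ} → (∀ l → residual (basis l) x y ∈± θ) → ∀ r → residual r x y ∈± K * θ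
    basis-spans {x} {y} {θ} small r = ∈±-resp (vector-∙ r x y)
      (proj₂ spanner (displacement x y) θ (λ l → ∈±-resp (sym (vector-∙ (basis l) x y)) (small l))
        r)

    roundX : Fin N → Fin (suc n) → ℤ
    roundX l i = proj₁ (truncate (δ * coefX (basis l) i))

    roundY : Fin N → Fin k → ℤ
    roundY l j = proj₁ (truncate (δ * coefY (basis l) j))

    roundRhs : Fin N → ℤ
    roundRhs l = proj₁ (truncate (δ * rhs (basis l)))

    private
      truncate-bound : ∀ {z} → z ∈± fromℕ (2 ℕ.* suc n) → fromℕ ℤ.∣ proj₁ (truncate (δ * z)) ∣ ≤
        fromℕ (D ℕ.* (2 ℕ.* suc n))
      truncate-bound {z} b = ≤-trans (proj₂ (proj₂ (truncate (δ * z))))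
        (≤-trans (∣∣-least (∈±-* (≤-trans (lin₁ (proj₁ 0<D)
          (solve 1 (λ d → con (+ 0) :+ con (+ 0) := (:- d) :+ d) refl δ)) (proj₁ 0<D) , ≤-refl) b))
          (≤-reflexive (sym (fromℕ-* D (2 ℕ.* suc n)))))

    roundX-bound : ∀ l i → fromℕ ℤ.∣ roundX l i ∣ ≤ fromℕ (D ℕ.* (2 ℕ.* suc n))
    roundX-bound l i = truncate-bound (∈±-mono 1≤2n (proj₂ (basis l) i))

    roundY-bound : ∀ l j → fromℕ ℤ.∣ roundY l j ∣ ≤ fromℕ (D ℕ.* (2 ℕ.* suc n))
    roundY-bound l j = truncate-bound (nonNegative⇒∈± (coefY≥0 (basis l) j) (coefY≤ (basis l) j))

    roundRhs-bound : ∀ l → fromℕ ℤ.∣ roundRhs l ∣ ≤ fromℕ (D ℕ.* (2 ℕ.* suc n))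
    roundRhs-bound l = truncate-bound (rhs-bound (basis l))

    rounded : Fin N → ℝ^ (suc n) → ℝ^ k → ℝ
    rounded l x y = ((λ i → fromℤ (roundX l i)) ∙ x + (λ j → fromℤ (roundY l j)) ∙ y) - fromℤ
      (roundRhs l)

    -- Each rounded number is off by at most 1: the coefficients of x contribute ‖x‖₁, those of y at
    -- most k, and the right-hand side 1.
    rounding-error : ∀ l x y → (∀ j → y j ∈± 1#) →
                     rounded l x y - δ * residual (basis l) x y ∈± (∥ x ∥₁ + fromℕ k) + 1#
    rounding-error l x y y-bound = ∈±-resp collect (∈±-- (∈±-+
        (∙-∈±-sum (λ i → proj₁ (proj₂ (truncate (δ * coefX (basis l) i)))) (λ i → ∈±∣∣ (x i)))
        (∈±-mono (≤-reflexive (trans (sum-const k 1#) (trans (*-comm _ 1#) (*-identityˡ _))))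
          (∙-∈±-sum {a = λ _ → 1#} (λ j → proj₁ (proj₂ (truncate (δ * coefY (basis l) j))))
            y-bound)))
        (proj₁ (proj₂ (truncate (δ * rhs (basis l))))))
      where
      bx : ℝ^ (suc n)
      bx i = fromℤ (roundX l i)
      by : ℝ^ k
      by j = fromℤ (roundY l j)
      collect : ((λ i → bx i - δ * coefX (basis l) i) ∙ x + (λ j → by j - δ * coefY (basis l) j) ∙
        y)
                 - (fromℤ (roundRhs l) - δ * rhs (basis l)) ≈ rounded l x y - δ * residual (basis l)
                   x y
      collect = trans (+-congʳ (+-cong
          (trans (∙-sub bx (λ i → δ * coefX (basis l) i) x)
            (+-congˡ (-‿cong (∙-scaleˡ δ (coefX (basis l)) x))))
          (trans (∙-sub by (λ j → δ * coefY (basis l) j) y)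
            (+-congˡ (-‿cong (∙-scaleˡ δ (coefY (basis l)) y))))))
        (solve 7 (λ a b c d e f t → ((a :- t :* b) :+ (c :- t :* d)) :- (e :- t :* f) :=
          ((a :+ c) :- e) :- t :* ((b :+ d) :- f)) refl
          (bx ∙ x) (coefX (basis l) ∙ x) (by ∙ y) (coefY (basis l) ∙ y) (fromℤ (roundRhs l))
            (rhs (basis l)) δ)

    Feasible : ℝ^ (suc n) → ℝ^ k → Set
    Feasible x y = (∀ j → 0# ≤ y j) × (∀ j → y j ≤ 1#) × (∀ l → rounded l x y ∈± Δ)

    private
      unΔ : Δ ≈ (m + fromℕ k) + 1#
      unΔ = trans (+-congˡ (fromℕ-+ (suc n) k))
        (solve 2 (λ m k → con (+ 1) :+ (m :+ k) := (m :+ k) :+ con (+ 1)) refl m (fromℕ k))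

    -- Residuals vanish at lifted vertices, so only the rounding error remains. With ‖p t‖₁ ≤ m it
    -- is at most m + k + 1, which is the origin of the tolerance Δ.
    vertex-feasible : ∀ t → Feasible (p t) (Y t)
    vertex-feasible t = Y≥0 t , Y≤1 t , λ l → ∈±-resp (exact l)
      (∈±-mono (≤-trans (+-mono (+-mono norm≤ ≤-refl) ≤-refl) (≤-reflexive (sym unΔ)))
        (rounding-error l (p t) (Y t) λ j → nonNegative⇒∈± (Y≥0 t j) (Y≤1 t j)))
      where
      norm≤ : ∥ p t ∥₁ ≤ m
      norm≤ = ≤-respʳ (trans (*-comm _ 1#) (*-identityˡ _))
        (sum-≤const (λ i → ∣∣-least (p-bound t i)))
      exact : ∀ l → rounded l (p t) (Y t) - δ * residual (basis l) (p t) (Y t) ≈ rounded l (p t)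
        (Y t)
      exact l = trans (+-congˡ (-‿cong (*-congˡ
        (trans (+-congʳ (rhs-identity (basis l) t)) (-‿inverseʳ _)))))
        (solve 2 (λ r d → r :- d :* con (+ 0) := r) refl (rounded l (p t) (Y t)) δ)

    module _ {κ : ℝ} (κ-large : K * Δ ≤ κ * δ) {x : ℝ^ (suc n)} {y : ℝ^ k} (feasible : Feasible x y)
      where

      private
        y≥0 = proj₁ feasible
        y≤1 = proj₁ (proj₂ feasible)
        equations = proj₂ (proj₂ feasible)

        R S : ℝ
        R = ∥ x ∥₁
        S = fromℕ 2 + R

        R≥0 : 0# ≤ R
        R≥0 = sum≥0 λ i → ∈±-bound≥0 (∈±∣∣ (x i))

        S≥0 : 0# ≤ S
        S≥0 = ≤-respˡ (+-identityˡ 0#) (+-mono (fromℕ≥0 2) R≥0)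

        -- The slab tolerance plus the rounding error, brought into the form Δ times a factor; the
        -- surplus on the right is (Δ - 1) R + m.
        total-error : Δ + ((R + fromℕ k) + 1#) ≤ Δ * S
        total-error = lin₂ (*-nonNegative (diff≥0 (1≤suc N)) R≥0) (fromℕ≥0 (suc n))
          (trans (+-congʳ (solve 2 (λ d r → d :* (con (+ 2) :+ r) := con (+ 2) :* d :+ d :* r) refl
            Δ R))
            (trans (+-congʳ (+-congʳ (trans (solve 1 (λ d → con (+ 2) :* d := d :+ d) refl Δ)
              (+-congˡ unΔ))))
              (solve 4 (λ d r m k → ((d :+ ((m :+ k) :+ con (+ 1))) :+ d :* r) :+
                (con (+ 0) :+ con (+ 0)) :=
                (d :+ ((r :+ k) :+ con (+ 1))) :+ ((d :- con (+ 1)) :* r :+ m)) refl Δ R m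
                  (fromℕ k))))

        basis-residual : ∀ l → δ * residual (basis l) x y ∈± Δ * S
        basis-residual l = ∈±-mono total-error (∈±-resp
          (solve 2 (λ a b → a :- (a :- b) := b) refl (rounded l x y) _)
          (∈±-- (equations l) (rounding-error l x y λ j → nonNegative⇒∈± (y≥0 j) (y≤1 j))))

        θ : ℝ
        θ = Δ * S * δ ⁻¹

        Kθ≤ : K * θ ≤ κ * S
        Kθ≤ = *-cancelˡ-≤ 0<D (≤-respˡ (sym (trans
            (solve 5 (λ t k d s i → t :* (k :* ((d :* s) :* i)) := ((k :* d) :* s) :* (t :* i)) refl
              δ K Δ S (δ ⁻¹))
            (trans (*-congˡ (inverseʳ 0<D)) (trans (*-comm _ 1#) (*-identityˡ _)))))
          (≤-respʳ (solve 3 (λ k d s → (k :* d) :* s := d :* (k :* s)) refl κ δ S)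
            (*-monoʳ S≥0 κ-large)))

        δθ≈ : δ * θ ≈ Δ * S
        δθ≈ = trans (solve 3 (λ d a i → d :* (a :* i) := (d :* i) :* a) refl δ (Δ * S) (δ ⁻¹))
          (trans (*-congʳ (inverseʳ 0<D)) (*-identityˡ _))

        row-residual : ∀ r → residual r x y ∈± κ * S
        row-residual r = ∈±-mono Kθ≤ (basis-spans {x} {y} (λ l → ∈±-divide 0<D
          (∈±-mono (≤-reflexive (sym δθ≈)) (basis-residual l))) r)

      -- In c · x = residual + β - u · y the residual is at most κ S, β is at most some c · p t, and
      -- u · y ≥ 0. Homogeneity extends this from the cube to all c.
      feasible⇒close : Close p x (κ * (fromℕ 2 + ∥ x ∥₁))
      feasible⇒close = close-homogeneous {p = p} {x = x} t₀ λ c c-bound → proj₁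
        (rhs-attained (c , c-bound)) , bound (c , c-bound)
        where
        bound : ∀ r → coefX r ∙ x ≤ coefX r ∙ p (proj₁ (rhs-attained r)) + κ * S
        bound r = lin₃ (proj₂ (row-residual r)) (proj₂ (rhs-attained r))
          (∙-nonNegative {a = coefY r} (coefY≥0 r) y≥0)
          (solve 5 (λ a b c d s → (d :+ s) :+ (((a :+ b) :- c) :+ (c :+ con (+ 0))) := a :+
            (s :+ (d :+ b))) refl
            (coefX r ∙ x) (coefY r ∙ y) (rhs r) (coefX r ∙ p (proj₁ (rhs-attained r))) (κ * S))

  -- Powers of two and encoding lengths.

  n<2^n : ∀ n → n ℕ.< 2 ℕ.^ n
  n<2^n zero    = ℕ.s≤s ℕ.z≤n
  n<2^n (suc n) = ℕ.≤-trans (ℕ.+-mono-≤ (ℕ.m^n>0 2 n) (n<2^n n))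
    (ℕ.≤-reflexive (≡.cong (2 ℕ.^ n ℕ.+_) (≡.sym (ℕ.+-identityʳ _))))

  spanLoss<4^N : ∀ N → suc (spanLoss N) ℕ.≤ 2 ℕ.^ (2 ℕ.* N)
  spanLoss<4^N zero    = ℕ.≤-refl
  spanLoss<4^N (suc N) = ℕ.≤-trans (ℕ.≤-reflexive three)
    (ℕ.≤-trans (ℕ.*-mono-≤ (ℕ.n≤1+n 3) (spanLoss<4^N N)) (ℕ.≤-reflexive four))
    where
    three : suc (3 ℕ.* spanLoss N ℕ.+ 2) ≡ 3 ℕ.* suc (spanLoss N)
    three = ℕ-solve 1 (λ s → ℕ-con 1 ⊞ (ℕ-con 3 ⊠ s ⊞ ℕ-con 2) ≋ℕ ℕ-con 3 ⊠ (ℕ-con 1 ⊞ s)) ≡.refl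
      (spanLoss N)
    four : 4 ℕ.* 2 ℕ.^ (2 ℕ.* N) ≡ 2 ℕ.^ (2 ℕ.* suc N)
    four = ≡.sym (≡.trans (≡.cong (2 ℕ.^_) (ℕ.*-suc 2 N)) (ℕ.^-distribˡ-+-* 2 2 (2 ℕ.* N)))

  fromℕ-^ : ∀ n → fromℕ (2 ℕ.^ n) ≈ fromℕ 2 ^ n
  fromℕ-^ zero    = fromℕ-1
  fromℕ-^ (suc n) = trans (fromℕ-* 2 (2 ℕ.^ n)) (*-congˡ (fromℕ-^ n))

  sumℕ-≤ : ∀ {n} {f : Vector ℕ n} {a} → (∀ i → f i ℕ.≤ a) → sumℕ f ℕ.≤ n ℕ.* a
  sumℕ-≤ {zero}  p = ℕ.z≤n
  sumℕ-≤ {suc n} p = ℕ.+-mono-≤ (p zero) (sumℕ-≤ (p ∘ suc))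

  integer : ℤ → ℚ
  integer z = mkℚ z 0 (Coprimality.sym (Coprimality.1-coprimeTo _))

  fromℚ-integer : ∀ z → fromℚ (integer z) ≈ fromℤ z
  fromℚ-integer z = trans (*-congˡ 1⁻¹≈1) (trans (*-comm _ 1#) (*-identityˡ _))
    where
    1⁻¹≈1 : fromℕ 1 ⁻¹ ≈ 1#
    1⁻¹≈1 = trans (sym (*-identityˡ _)) (trans (*-congʳ (sym fromℕ-1)) (inverseʳ (fromℕ-pos 0)))

  -- The strict bound gives suc |z| ≤ 2^T, so the numerator costs T; the denominator 1 and the
  -- constant term cost 1 each.
  sizeℚ-integer : ∀ {z T} → ℤ.∣ z ∣ ℕ.< 2 ℕ.^ T → sizeℚ (integer z) ℕ.≤ T ℕ.+ 2
  sizeℚ-integer {z} {T} z<2^T = ℕ.≤-trans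
    (ℕ.+-monoˡ-≤ 1 (ℕ.s≤s (ℕ.≤-trans (⌈log₂⌉-mono-≤ z<2^T) (ℕ.≤-reflexive (⌈log₂2^n⌉≡n T)))))
    (ℕ.≤-reflexive (ℕ-solve 1 (λ t → (ℕ-con 1 ⊞ t) ⊞ ℕ-con 1 ≋ℕ t ⊞ ℕ-con 2) ≡.refl T))

  sizeMatrix-≤ : ∀ {r c} {A : Matrix ℚ r c} {s} → (∀ i j → sizeℚ (A i j) ℕ.≤ s) →
                 sizeMatrix A ℕ.≤ r ℕ.* (c ℕ.* suc s)
  sizeMatrix-≤ {r} {c} {s = s} p = ℕ.≤-trans (ℕ.+-monoʳ-≤ (r ℕ.* c) (sumℕ-≤ λ i → sumℕ-≤ (p i)))
    (ℕ.≤-reflexive (ℕ-solve 3 (λ r c s → r ⊠ c ⊞ r ⊠ (c ⊠ s) ≋ℕ r ⊠ (c ⊠ (ℕ-con 1 ⊞ s))) ≡.refl r c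
      s))

  sizeVector-≤ : ∀ {r} {v : Vector ℚ r} {s} → (∀ i → sizeℚ (v i) ℕ.≤ s) → sizeVector v ℕ.≤ r ℕ.* suc
    s
  sizeVector-≤ {r} {s = s} p = ℕ.≤-trans (ℕ.+-monoʳ-≤ r (sumℕ-≤ p))
    (ℕ.≤-reflexive (≡.sym (ℕ.*-suc r s)))

  -- Polynomials

  eval-++ : ∀ p q u v w → eval (p List.++ q) u v w ≈ eval p u v w + eval q u v w
  eval-++ List.[]      q u v w = sym (+-identityˡ _)
  eval-++ (m List.∷ p) q u v w = trans (+-congˡ (eval-++ p q u v w))
    (solve 3 (λ x y z → x :+ (y :+ z) := (x :+ y) :+ z) refl _ (eval p u v w) (eval q u v w))

  Monomial : Set
  Monomial = ℝ × ℕ × ℕ × ℕ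

  evalMonomial : Monomial → ℝ → ℝ → ℝ → ℝ
  evalMonomial (a , i , j , l) u v w = a * (u ^ i * v ^ j * w ^ l)

  _*ᵐ_ : Monomial → Monomial → Monomial
  (a , i , j , l) *ᵐ (b , i′ , j′ , l′) = a * b , i ℕ.+ i′ , j ℕ.+ j′ , l ℕ.+ l′

  evalMonomial-* : ∀ m m′ u v w → evalMonomial (m *ᵐ m′) u v w ≈ evalMonomial m u v w * evalMonomial
    m′ u v w
  evalMonomial-* (a , i , j , l) (b , i′ , j′ , l′) u v w =
    trans (*-congˡ (*-cong (*-cong (^-homo-* u i i′) (^-homo-* v j j′)) (^-homo-* w l l′)))
      (solve 8 (λ a b u u′ v v′ w w′ → (a :* b) :* (((u :* u′) :* (v :* v′)) :* (w :* w′)) :=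
          (a :* ((u :* v) :* w)) :* (b :* ((u′ :* v′) :* w′))) refl a b (u ^ i) (u ^ i′) (v ^ j)
            (v ^ j′) (w ^ l) (w ^ l′))

  eval-map-* : ∀ m p u v w → eval (List.map (m *ᵐ_) p) u v w ≈ evalMonomial m u v w * eval p u v w
  eval-map-* m List.[]       u v w = sym (zeroʳ _)
  eval-map-* m (m′ List.∷ p) u v w = trans
    (+-cong (evalMonomial-* m m′ u v w) (eval-map-* m p u v w)) (sym (distribˡ _ _ _))

  _*ᵖ_ : Polynomial₃ → Polynomial₃ → Polynomial₃
  List.[]      *ᵖ q = List.[]
  (m List.∷ p) *ᵖ q = List.map (m *ᵐ_) q List.++ (p *ᵖ q)

  eval-* : ∀ p q u v w → eval (p *ᵖ q) u v w ≈ eval p u v w * eval q u v w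
  eval-* List.[]      q u v w = sym (zeroˡ _)
  eval-* (m List.∷ p) q u v w = trans (eval-++ (List.map (m *ᵐ_) q) (p *ᵖ q) u v w)
    (trans (+-cong (eval-map-* m q u v w) (eval-* p q u v w))
      (solve 3 (λ m p q → m :* q :+ p :* q := (m :+ p) :* q) refl _ (eval p u v w) (eval q u v w)))

  -- The combinators below build the list of monomials along a formula, so that the size bound can
  -- be estimated as an ordinary expression.
  IsPolynomial : (ℝ → ℝ → ℝ → ℝ) → Set
  IsPolynomial f = ∃[ p ] ∀ u v w → eval p u v w ≈ f u v w

  infixl 6 _⟨+⟩_
  infixl 7 _⟨*⟩_

  _⟨+⟩_ : ∀ {f g} → IsPolynomial f → IsPolynomial g → IsPolynomial (λ u v w → f u v w + g u v w)
  (p , p≈) ⟨+⟩ (q , q≈) = p List.++ q , λ u v w → trans (eval-++ p q u v w)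
    (+-cong (p≈ u v w) (q≈ u v w))

  _⟨*⟩_ : ∀ {f g} → IsPolynomial f → IsPolynomial g → IsPolynomial (λ u v w → f u v w * g u v w)
  (p , p≈) ⟨*⟩ (q , q≈) = p *ᵖ q , λ u v w → trans (eval-* p q u v w) (*-cong (p≈ u v w) (q≈ u v w))

  constant : ∀ a → IsPolynomial (λ _ _ _ → a)
  constant a = List.[ a , 0 , 0 , 0 ] , λ u v w →
    solve 1 (λ a → a :* (con (+ 1) :* con (+ 1) :* con (+ 1)) :+ con (+ 0) := a) refl a

  var₁ : IsPolynomial (λ u _ _ → u)
  var₁ = List.[ 1# , 1 , 0 , 0 ] , λ u v w →
    solve 1 (λ u → con (+ 1) :* ((u :* con (+ 1)) :* con (+ 1) :* con (+ 1)) :+ con (+ 0) := u) refl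
      u

  var₂ : IsPolynomial (λ _ v _ → v)
  var₂ = List.[ 1# , 0 , 1 , 0 ] , λ u v w →
    solve 1 (λ v → con (+ 1) :* (con (+ 1) :* (v :* con (+ 1)) :* con (+ 1)) :+ con (+ 0) := v) refl
      v

  var₃ : IsPolynomial (λ _ _ w → w)
  var₃ = List.[ 1# , 0 , 0 , 1 ] , λ u v w →
    solve 1 (λ w → con (+ 1) :* (con (+ 1) :* con (+ 1) :* (w :* con (+ 1))) :+ con (+ 0) := w) refl
      w

  -- The rational inequality system

  data Constraint (n k : ℕ) : Set where
    nonneg atMost1 : Fin k → Constraint n k
    upper lower    : Fin (n ℕ.+ k) → Constraint n k

  module _ {n k : ℕ} where

    -- The 2 (n + k) slab sides are split: those of the last k equations join the 2 k bounds on y,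
    -- those of the first n form the second block. The number of rows is then 4 k + 2 n on the nose.
    decode₄ : Fin 4 × Fin k → Constraint n k
    decode₄ (zero                 , j) = nonneg j
    decode₄ (suc zero             , j) = atMost1 j
    decode₄ (suc (suc zero)       , j) = upper (n ↑ʳ j)
    decode₄ (suc (suc (suc zero)) , j) = lower (n ↑ʳ j)

    decode₂ : Fin 2 × Fin n → Constraint n k
    decode₂ (zero     , i) = upper (i ↑ˡ k)
    decode₂ (suc zero , i) = lower (i ↑ˡ k)

    decode : Fin (4 ℕ.* k ℕ.+ 2 ℕ.* n) → Constraint n k
    decode r = Sum.[ decode₄ ∘ Fin.remQuot {4} k , decode₂ ∘ Fin.remQuot {2} n ]
      (Fin.splitAt (4 ℕ.* k) r)

    private
      encode₄ : ∀ a j → decode (Fin.combine {4} a j ↑ˡ (2 ℕ.* n)) ≡ decode₄ (a , j)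
      encode₄ a j = ≡.trans (≡.cong Sum.[ decode₄ ∘ Fin.remQuot {4} k , decode₂ ∘ Fin.remQuot {2} n
        ] (Fin.splitAt-↑ˡ (4 ℕ.* k) _ (2 ℕ.* n)))
        (≡.cong decode₄ (Fin.remQuot-combine a j))

      encode₂ : ∀ a i → decode ((4 ℕ.* k) ↑ʳ Fin.combine {2} a i) ≡ decode₂ (a , i)
      encode₂ a i = ≡.trans (≡.cong Sum.[ decode₄ ∘ Fin.remQuot {4} k , decode₂ ∘ Fin.remQuot {2} n
        ] (Fin.splitAt-↑ʳ (4 ℕ.* k) (2 ℕ.* n) _))
        (≡.cong decode₂ (Fin.remQuot-combine a i))

    decode-surjective : ∀ c → ∃[ r ] decode r ≡ c
    decode-surjective (nonneg j)  = _ , encode₄ zero j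
    decode-surjective (atMost1 j) = _ , encode₄ (suc zero) j
    decode-surjective (upper l) with Fin.splitAt n l in eq
    ... | inj₁ i = _ , ≡.trans (encode₂ zero i) (≡.cong upper (Fin.splitAt⁻¹-↑ˡ eq))
    ... | inj₂ j = _ , ≡.trans (encode₄ (suc (suc zero)) j) (≡.cong upper (Fin.splitAt⁻¹-↑ʳ eq))
    decode-surjective (lower l) with Fin.splitAt n l in eq
    ... | inj₁ i = _ , ≡.trans (encode₂ (suc zero) i) (≡.cong lower (Fin.splitAt⁻¹-↑ˡ eq))
    ... | inj₂ j = _ , ≡.trans (encode₄ (suc (suc (suc zero))) j)
      (≡.cong lower (Fin.splitAt⁻¹-↑ʳ eq))

  unit : ∀ {n} → Fin n → Fin n → ℤ
  unit zero    zero    = + 1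
  unit zero    (suc j) = + 0
  unit (suc i) zero    = + 0
  unit (suc i) (suc j) = unit i j

  unit-bound : ∀ {n} (i j : Fin n) → ℤ.∣ unit i j ∣ ℕ.≤ 1
  unit-bound zero    zero    = ℕ.≤-refl
  unit-bound zero    (suc j) = ℕ.z≤n
  unit-bound (suc i) zero    = ℕ.z≤n
  unit-bound (suc i) (suc j) = unit-bound i j

  unit-∙ : ∀ {n} (i : Fin n) (y : ℝ^ n) → (λ j → fromℤ (unit i j)) ∙ y ≈ y i
  unit-∙ zero    y = trans (+-cong (*-congʳ fromℕ-1) (sum-0 λ j → zeroˡ (y (suc j))))
    (solve 1 (λ y → con (+ 1) :* y :+ con (+ 0) := y) refl (y zero))
  unit-∙ (suc i) y = trans (+-cong (zeroˡ (y zero)) (unit-∙ i (tail y))) (+-identityˡ _)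

  module IntegerSystem {n k : ℕ} (A : Fin (n ℕ.+ k) → Fin n → ℤ) (A′ : Fin (n ℕ.+ k) → Fin k → ℤ)
    (b : Fin (n ℕ.+ k) → ℤ) (Δ : ℕ) where

    coefficient : Constraint n k → Fin n → ℤ
    coefficient (nonneg j)  i = + 0
    coefficient (atMost1 j) i = + 0
    coefficient (upper l)   i = A l i
    coefficient (lower l)   i = ℤ.- A l i

    coefficient′ : Constraint n k → Fin k → ℤ
    coefficient′ (nonneg j)  j′ = ℤ.- unit j j′
    coefficient′ (atMost1 j) j′ = unit j j′
    coefficient′ (upper l)   j′ = A′ l j′
    coefficient′ (lower l)   j′ = ℤ.- A′ l j′

    bound : Constraint n k → ℤ
    bound (nonneg j)  = + 0
    bound (atMost1 j) = + 1
    bound (upper l)   = b l ℤ.+ + Δ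
    bound (lower l)   = ℤ.- b l ℤ.+ + Δ

    Satisfied : Constraint n k → ℝ^ n → ℝ^ k → Set
    Satisfied c x y = (λ i → fromℤ (coefficient c i)) ∙ x + (λ j → fromℤ (coefficient′ c j)) ∙ y ≤
      fromℤ (bound c)

    InSlab : Fin (n ℕ.+ k) → ℝ^ n → ℝ^ k → Set
    InSlab l x y = ((λ i → fromℤ (A l i)) ∙ x + (λ j → fromℤ (A′ l j)) ∙ y) - fromℤ (b l) ∈± fromℕ Δ

    private
      0∙ : ∀ {m} (x : ℝ^ m) → (λ _ → 0#) ∙ x ≈ 0#
      0∙ x = sum-0 λ i → zeroˡ (x i)

      -∙ : ∀ {m} (f : Fin m → ℤ) x → (λ i → fromℤ (ℤ.- f i)) ∙ x ≈ - ((λ i → fromℤ (f i)) ∙ x)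
      -∙ f x = trans (∙-congʳ λ i → fromℤ-neg (f i)) (∙-neg _ x)

      nonneg-lhs : ∀ j x y → (λ i → fromℤ (coefficient (nonneg j) i)) ∙ x +
        (λ i → fromℤ (coefficient′ (nonneg j) i)) ∙ y ≈ - y j
      nonneg-lhs j x y = trans (+-cong (0∙ x) (trans (-∙ (unit j) y) (-‿cong (unit-∙ j y))))
        (+-identityˡ _)

      atMost1-lhs : ∀ j x y → (λ i → fromℤ (coefficient (atMost1 j) i)) ∙ x +
        (λ i → fromℤ (coefficient′ (atMost1 j) i)) ∙ y ≈ y j
      atMost1-lhs j x y = trans (+-cong (0∙ x) (unit-∙ j y)) (+-identityˡ _)

    satisfied⇒feasible : ∀ {x y} → (∀ c → Satisfied c x y) →
      (∀ j → 0# ≤ y j) × (∀ j → y j ≤ 1#) × (∀ l → InSlab l x y)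
    satisfied⇒feasible {x} {y} sat =
      (λ j → lin₁ (≤-respˡ (nonneg-lhs j x y) (sat (nonneg j)))
        (solve 1 (λ y → y :+ :- y := con (+ 0) :+ con (+ 0)) refl (y j))) ,
      (λ j → ≤-respˡ (atMost1-lhs j x y) (≤-respʳ fromℕ-1 (sat (atMost1 j)))) ,
      λ l → lin₁ (≤-respˡ (+-cong (-∙ (A l) x) (-∙ (A′ l) y))
        (≤-respʳ (trans (fromℤ-+ (ℤ.- b l) (+ Δ)) (+-congʳ (fromℤ-neg (b l)))) (sat (lower l))))
              (solve 4 (λ a c b d → ((a :+ c) :- b) :+ (:- a :+ :- c) := (:- d) :+ (:- b :+ d)) refl
                _ _ (fromℤ (b l)) (fromℕ Δ)) ,
            lin₁ (≤-respʳ (fromℤ-+ (b l) (+ Δ)) (sat (upper l)))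
              (solve 4 (λ a c b d → d :+ (a :+ c) := ((a :+ c) :- b) :+ (b :+ d)) refl _ _
                (fromℤ (b l)) (fromℕ Δ))

    feasible⇒satisfied : ∀ {x y} → (∀ j → 0# ≤ y j) × (∀ j → y j ≤ 1#) × (∀ l → InSlab l x y) →
      ∀ c → Satisfied c x y
    feasible⇒satisfied {x} {y} (y≥0 , y≤1 , slab) (nonneg j) =
      ≤-respˡ (sym (nonneg-lhs j x y)) (≤-respʳ -0#≈0# (neg-mono (y≥0 j)))
    feasible⇒satisfied {x} {y} (y≥0 , y≤1 , slab) (atMost1 j) =
      ≤-respˡ (sym (atMost1-lhs j x y)) (≤-respʳ (sym fromℕ-1) (y≤1 j))
    feasible⇒satisfied {x} {y} (y≥0 , y≤1 , slab) (upper l) =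
      ≤-respʳ (sym (fromℤ-+ (b l) (+ Δ))) (lin₁ (proj₂ (slab l))
        (solve 4 (λ a c b d → (b :+ d) :+ ((a :+ c) :- b) := (a :+ c) :+ d) refl _ _ (fromℤ (b l))
          (fromℕ Δ)))
    feasible⇒satisfied {x} {y} (y≥0 , y≤1 , slab) (lower l) =
      ≤-respˡ (sym (+-cong (-∙ (A l) x) (-∙ (A′ l) y)))
        (≤-respʳ (sym (trans (fromℤ-+ (ℤ.- b l) (+ Δ)) (+-congʳ (fromℤ-neg (b l)))))
        (lin₁ (proj₁ (slab l)) (solve 4 (λ a c b d → (:- b :+ d) :+ :- d := (:- a :+ :- c) :+
          ((a :+ c) :- b)) refl _ _ (fromℤ (b l)) (fromℕ Δ))))

    module _ {M : ℕ} (1≤M : 1 ℕ.≤ M) (A≤ : ∀ l i → ℤ.∣ A l i ∣ ℕ.≤ M)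
      (A′≤ : ∀ l j → ℤ.∣ A′ l j ∣ ℕ.≤ M)
             (b≤ : ∀ l → ℤ.∣ b l ∣ ℕ.≤ M) where

      coefficient-≤ : ∀ c i → ℤ.∣ coefficient c i ∣ ℕ.≤ M
      coefficient-≤ (nonneg j)  i = ℕ.z≤n
      coefficient-≤ (atMost1 j) i = ℕ.z≤n
      coefficient-≤ (upper l)   i = A≤ l i
      coefficient-≤ (lower l)   i = ≡.subst (ℕ._≤ M) (≡.sym (ℤ.∣-i∣≡∣i∣ (A l i))) (A≤ l i)

      coefficient′-≤ : ∀ c j → ℤ.∣ coefficient′ c j ∣ ℕ.≤ M
      coefficient′-≤ (nonneg j)  j′ = ≡.subst (ℕ._≤ M) (≡.sym (ℤ.∣-i∣≡∣i∣ (unit j j′)))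
        (ℕ.≤-trans (unit-bound j j′) 1≤M)
      coefficient′-≤ (atMost1 j) j′ = ℕ.≤-trans (unit-bound j j′) 1≤M
      coefficient′-≤ (upper l)   j′ = A′≤ l j′
      coefficient′-≤ (lower l)   j′ = ≡.subst (ℕ._≤ M) (≡.sym (ℤ.∣-i∣≡∣i∣ (A′ l j′))) (A′≤ l j′)

      bound-≤ : ∀ c → ℤ.∣ bound c ∣ ℕ.≤ M ℕ.+ Δ
      bound-≤ (nonneg j)  = ℕ.z≤n
      bound-≤ (atMost1 j) = ℕ.≤-trans 1≤M (ℕ.m≤m+n M Δ)
      bound-≤ (upper l)   = ℕ.≤-trans (ℤ.∣i+j∣≤∣i∣+∣j∣ (b l) (+ Δ)) (ℕ.+-monoˡ-≤ Δ (b≤ l))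
      bound-≤ (lower l)   = ℕ.≤-trans (ℤ.∣i+j∣≤∣i∣+∣j∣ (ℤ.- b l) (+ Δ))
        (ℕ.+-monoˡ-≤ Δ (≡.subst (ℕ._≤ M) (≡.sym (ℤ.∣-i∣≡∣i∣ (b l))) (b≤ l)))

  -- Convex hulls and vertices of the cube.

  ∙-combination : ∀ {n N} (c : ℝ^ n) (μ : ℝ^ N) (v : Vector (ℝ^ n) N) →
                  c ∙ (λ i → sum (λ j → μ j * v j i)) ≈ μ ∙ (λ j → c ∙ v j)
  ∙-combination c μ v = trans (sum-cong-≋ λ i → *-distribˡ-sum (c i) (λ j → μ j * v j i))
    (trans (∑-comm (λ i j → c i * (μ j * v j i)))
      (sum-cong-≋ λ j → trans
        (sum-cong-≋ λ i → solve 3 (λ c m v → c :* (m :* v) := m :* (c :* v)) refl (c i) (μ j)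
          (v j i))
        (sym (*-distribˡ-sum (μ j) (λ i → c i * v j i)))))

  average-≤ : ∀ {N} {μ f : ℝ^ N} {M} → (∀ j → 0# ≤ μ j) → sum μ ≈ 1# → (∀ j → f j ≤ M) → μ ∙ f ≤ M
  average-≤ {μ = μ} {M = M} μ≥0 Σμ≈1 f≤M = ≤-respʳ
    (trans (∙-const μ M) (trans (*-congʳ Σμ≈1) (*-identityˡ M)))
    (sum-mono λ j → *-monoˡ (μ≥0 j) (f≤M j))

  average-∈± : ∀ {N} {μ f : ℝ^ N} {M} → (∀ j → 0# ≤ μ j) → sum μ ≈ 1# → (∀ j → f j ∈± M) → μ ∙ f ∈±
    M
  average-∈± {μ = μ} {M = M} μ≥0 Σμ≈1 f-bound = ∈±-mono
    (≤-reflexive (trans (∙-const μ M) (trans (*-congʳ Σμ≈1) (*-identityˡ M))))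
    (sum-∈± λ j → ∈±-* (nonNegative⇒∈± (μ≥0 j) ≤-refl) (f-bound j))

  conv-≤ : ∀ {n} {S : Subset n} (c : ℝ^ n) M → (∀ s → S s → c ∙ s ≤ M) → ∀ {x} → conv S x → c ∙ x ≤
    M
  conv-≤ c M S≤M (N , μ , v , μ≥0 , Σμ≈1 , v∈S , x≋) =
    ≤-respˡ (sym (trans (∙-congˡ {a = c} x≋) (∙-combination c μ v)))
      (average-≤ μ≥0 Σμ≈1 λ j → S≤M (v j) (v∈S j))

  conv-∈± : ∀ {n} {S : Subset n} {M} → (∀ s → S s → ∀ i → s i ∈± M) → ∀ {x} → conv S x → ∀ i → x i
    ∈± M
  conv-∈± S-bound (N , μ , v , μ≥0 , Σμ≈1 , v∈S , x≋) i =
    ∈±-resp (sym (x≋ i)) (average-∈± μ≥0 Σμ≈1 λ j → S-bound (v j) (v∈S j) i)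

  ⊆conv : ∀ {n} {S : Subset n} {s} → S s → conv S s
  ⊆conv {s = s} s∈S = 1 , (λ _ → 1#) , (λ _ → s) , (λ _ → 0≤1) , +-identityʳ 1# , (λ _ → s∈S) ,
    λ i → solve 1 (λ s → s := con (+ 1) :* s :+ con (+ 0)) refl (s i)

  maximum-Vec : ∀ n (f : Vec Bool n → ℝ) → ∃[ t ] (∀ t′ → f t′ ≤ f t)
  maximum-Vec zero    f = Vec.[] , λ { Vec.[] → ≤-refl }
  maximum-Vec (suc n) f =
    let t , t-max = maximum-Vec n (f ∘ (true Vec.∷_))
        u , u-max = maximum-Vec n (f ∘ (false Vec.∷_))
    in Sum.[ (λ t≤u → false Vec.∷ u , λ { (true Vec.∷ w) → ≤-trans (t-max w) t≤u ; (false Vec.∷ w) →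
      u-max w })
           , (λ u≤t → true Vec.∷ t , λ { (true Vec.∷ w) → t-max w ; (false Vec.∷ w) → ≤-trans
             (u-max w) u≤t })
           ] (total (f (true Vec.∷ t)) (f (false Vec.∷ u)))

  vertex : ∀ {n} → Vec Bool n → ℝ^ n
  vertex b i = if Vec.lookup b i then 1# else 0#

  vertex-bound : ∀ {n} (b : Vec Bool n) i → vertex b i ∈± 1#
  vertex-bound b i with Vec.lookup b i
  ... | true  = nonNegative⇒∈± 0≤1 ≤-refl
  ... | false = nonNegative⇒∈± ≤-refl 0≤1

  -- Retracts Vec Bool n onto X, so that X inherits its finiteness.
  retract : ∀ {n} (X : Pred (Vec Bool n) 0ℓ) → Satisfiable X →
            ∀ b → ∃[ b′ ] X b′ × (X b → b ≡ b′)
  retract X (b₀ , b₀∈X) b with em {X b}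
  ... | yes b∈X = b , b∈X , λ _ → ≡.refl
  ... | no  b∉X = b₀ , b₀∈X , λ b∈X → ⊥-elim (b∉X b∈X)

  -- The slack factorization of a given extended formulation.

  module Formulation {n : ℕ} {X : Pred (Vec Bool n) 0ℓ} (X-nonempty : Satisfiable X) {k : ℕ}
    (formulation : HasExtendedFormulation (conv (cube X)) k) where

    private
      dim = proj₁ formulation
      eqs = proj₁ (proj₂ formulation)
      C : Matrix ℝ k dim
      C = proj₁ (proj₂ (proj₂ formulation))
      c : ℝ^ k
      c = proj₁ (proj₂ (proj₂ (proj₂ formulation)))
      D : Matrix ℝ eqs dim
      D = proj₁ (proj₂ (proj₂ (proj₂ (proj₂ formulation))))
      d : ℝ^ eqs
      d = proj₁ (proj₂ (proj₂ (proj₂ (proj₂ (proj₂ formulation)))))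
      π : ℝ^ dim → ℝ^ n
      π = proj₁ (proj₂ (proj₂ (proj₂ (proj₂ (proj₂ (proj₂ formulation))))))
      π-isLinear : IsLinear π
      π-isLinear = proj₁ (proj₂ (proj₂ (proj₂ (proj₂ (proj₂ (proj₂ (proj₂ formulation)))))))
      image⊆P : ∀ {x} → image π (polyhedron C c D d) x → conv (cube X) x
      image⊆P = proj₁ (proj₂ (proj₂ (proj₂ (proj₂ (proj₂ (proj₂ (proj₂ (proj₂ formulation))))))))
      P⊆image : ∀ {x} → conv (cube X) x → image π (polyhedron C c D d) x
      P⊆image = proj₂ (proj₂ (proj₂ (proj₂ (proj₂ (proj₂ (proj₂ (proj₂ (proj₂ formulation))))))))

      -- The subspace D z = d s, with its equations built into the elements. They receive no
      -- multipliers, which is why equations do not count towards k.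
      Homogenized : Set
      Homogenized = Σ[ z ∈ ℝ^ dim ] Σ[ s ∈ ℝ ] (∀ j → D j ∙ z ≈ d j * s)

      _⊹_⟨_⟩ : Homogenized → ℝ → Homogenized → Homogenized
      (z , s , eq) ⊹ a ⟨ z′ , s′ , eq′ ⟩ = (λ i → z i + a * z′ i) , s + a * s′ , λ j →
        trans (∙-distribˡ (D j) z (λ i → a * z′ i))
          (trans (+-cong (eq j) (trans (∙-scaleʳ a (D j) z′) (*-congˡ (eq′ j))))
          (solve 4 (λ d s a s′ → d :* s :+ a :* (d :* s′) := d :* (s :+ a :* s′)) refl (d j) s a
            s′))

      open Forms _⊹_⟨_⟩

      h : Homogenized → ℝ
      h (z , s , _) = s

      h-linear : Linear h
      h-linear v a w = refl

      slack : Fin k → Homogenized → ℝ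
      slack j (z , s , _) = c j * s - C j ∙ z

      slack-linear : ∀ j → Linear (slack j)
      slack-linear j = linear-- (linear-* {f = h} (c j) h-linear)
        (linear-∙ (C j) {f = λ i v → proj₁ v i} λ i v a w → refl)

      π-form : Fin n → Homogenized → ℝ
      π-form i (z , _) = π z i

      π-linear : ∀ i → Linear (π-form i)
      π-linear i (z , _) a (z′ , _) = trans (LinearMap.+ᴹ-homo z (λ j → a * z′ j) i)
        (+-congˡ (LinearMap.*ₗ-homo a z′ i))
        where module LinearMap = LeftModuleMorphisms.IsLeftModuleHomomorphism π-isLinear

      retraction : ∀ b → ∃[ b′ ] X b′ × (X b → b ≡ b′)
      retraction = retract X X-nonempty

      ρ : Vec Bool n → Vec Bool n
      ρ b = proj₁ (retraction b)

      vertex∈cube : ∀ t → cube X (vertex (ρ t))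
      vertex∈cube t = ρ t , proj₁ (proj₂ (retraction t)) , λ i → refl

      lifted : ∀ t → image π (polyhedron C c D d) (vertex (ρ t))
      lifted t = P⊆image (⊆conv {S = cube X} (vertex∈cube t))

      lift : Vec Bool n → Homogenized
      lift t = proj₁ (lifted t) , 1# , λ j → trans (proj₂ (proj₁ (proj₂ (lifted t))) j)
        (sym (trans (*-comm _ 1#) (*-identityˡ _)))

      lift-slack : ∀ t j → 0# ≤ slack j (lift t)
      lift-slack t j = diff≥0 (≤-respʳ (sym (trans (*-comm _ 1#) (*-identityˡ _)))
        (proj₁ (proj₁ (proj₂ (lifted t))) j))

      feasible⇒P : ∀ v → h v ≈ 1# → (∀ j → 0# ≤ slack j v) → conv (cube X) (λ i → π-form i v)
      feasible⇒P (z , s , eq) s≈1 slack≥0 = image⊆P (z ,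
        ((λ j → lin₁ (slack≥0 j) (trans (+-identityʳ _)
          (trans (sym (trans (*-congˡ s≈1) (trans (*-comm _ 1#) (*-identityˡ _))))
            (solve 2 (λ a b → a := b :+ (a :- b)) refl (c j * s) (C j ∙ z))))) ,
         λ j → trans (eq j) (trans (*-congˡ s≈1) (trans (*-comm _ 1#) (*-identityˡ _)))) ,
        λ i → refl)

      lift-vertex : ∀ t i → π-form i (lift t) ≈ vertex (ρ t) i
      lift-vertex t = proj₂ (proj₂ (lifted t))

    point : Vec Bool n → ℝ^ n
    point t i = π-form i (lift t)

    cube⇒point : ∀ s → cube X s → ∃[ t ] s ≋ point t
    cube⇒point s (b , b∈X , s≋b) = b , λ i → trans (s≋b i)
      (trans (reflexive (≡.cong (λ b′ → vertex b′ i) (proj₂ (proj₂ (retraction b)) b∈X)))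
        (sym (lift-vertex b i)))

    point∈P : ∀ t → conv (cube X) (point t)
    point∈P t = feasible⇒P (lift t) refl (lift-slack t)

    point-bound : ∀ t i → point t i ∈± 1#
    point-bound t i = ∈±-resp (sym (lift-vertex t i)) (vertex-bound (ρ t) i)

    P-bound : ∀ {x} → conv (cube X) x → ∀ i → x i ∈± 1#
    P-bound = conv-∈± {S = cube X} λ { s (b , _ , s≋b) i → ∈±-resp (sym (s≋b i)) (vertex-bound b i)
      }

    P-≤ : ∀ a M → (∀ t → a ∙ point t ≤ M) → ∀ {x} → conv (cube X) x → a ∙ x ≤ M
    P-≤ a M point≤M = conv-≤ {S = cube X} a M λ s s∈cube → let t , s≋ = cube⇒point s s∈cube
      in ≤-respˡ (∙-congˡ {a = a} λ i → sym (s≋ i)) (point≤M t)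

    private
      module E = Extension _⊹_⟨_⟩ {h = h} h-linear {s = slack} slack-linear {π = π-form} π-linear
        (maximum-Vec n)
        lift (λ t → refl) lift-slack (λ v hv slack≥0 a M point≤M → P-≤ a M point≤M
          (feasible⇒P v hv slack≥0))
        (proj₁ X-nonempty)

    slackFactorization : SlackFactorization point k
    slackFactorization = E.factorization point-bound

    close⇒near : ∀ x τ → Close point x τ → ∃[ q ] conv (cube X) q × (∀ i → x i - q i ∈± τ)
    close⇒near x τ close =
      let v , hv , slack≥0 , near = E.∃-near x τ close
      in (λ i → π-form i v) , feasible⇒P v hv slack≥0 , near

  -- Logarithms, norms and distances.

  fromℕ-cancel-≤ : ∀ {a b} → fromℕ a ≤ fromℕ b → a ℕ.≤ b
  fromℕ-cancel-≤ {a} {b} p with a ℕ.≤? b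
  ... | yes q = q
  ... | no  q = ⊥-elim (1≰0 (lin₁ (≤-trans (fromℕ-mono (ℕ.≰⇒> q)) p)
    (solve 1 (λ b → con (+ 0) :+ (con (+ 1) :+ b) := con (+ 1) :+ b) refl (fromℕ b))))

  ⁻¹-unique : ∀ {x y} → 0# < x → x * y ≈ 1# → y ≈ x ⁻¹
  ⁻¹-unique {x} {y} 0<x xy≈1 = trans (sym (trans (*-congʳ (inverseʳ 0<x)) (*-identityˡ y)))
    (trans (solve 3 (λ x i y → (x :* i) :* y := i :* (x :* y)) refl x (x ⁻¹) y)
      (trans (*-congˡ xy≈1) (trans (*-comm _ 1#) (*-identityˡ _))))

  -- If L is the binary logarithm of x, the first condition yields x ≤ 2 ^ q.
  ∃-ceiling : ∀ L → ∃[ q ] ¬ (fromℕ q ≤ L) × fromℕ q ≤ fromℕ 2 + L * L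
  ∃-ceiling L with ≤? 0# L
  ... | inj₁ 0≤L =
    let n , n≤L , L<1+n = floorℕ 0≤L
    -- As n ≤ L, the difference 2 + L² - (1 + n) is at least (L - 1)² + L.
    in suc n , <⇒≰ L<1+n , lin₃ n≤L 0≤L (sq≥0 (L - 1#))
         (trans (solve 3 (λ n l q → (con (+ 2) :+ q) :+ (n :+ (con (+ 0) :+ con (+ 0))) :=
           (con (+ 1) :+ n) :+ (l :+ (l :+ (q :- con (+ 2) :* l :+ con (+ 1))))) refl (fromℕ n) L
           (L * L))
           (+-congˡ (+-congˡ (+-congˡ (solve 1 (λ l → l :* l :- con (+ 2) :* l :+ con (+ 1) :=
             (l :- con (+ 1)) :* (l :- con (+ 1))) refl L)))))
  ... | inj₂ L<0 = 0 , <⇒≰ L<0 , ≤-respˡ (+-identityˡ 0#) (+-mono (fromℕ≥0 2) (sq≥0 L))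

  isLog₂-bound : ∀ {x L q} → IsLog₂ x L → ¬ (fromℕ q ≤ L) → x ≤ fromℕ (2 ℕ.^ q)
  isLog₂-bound {x} {L} {q} isLog q≰L = ≰⇒≥ λ 2^q≤x → q≰L
    (≤-respˡ (solve 1 (λ q → q :- con (+ 0) := q) refl (fromℕ q))
      (≤-respʳ (trans (*-congʳ fromℕ-1) (*-identityˡ L))
        -- The instance of exponent (q - 0) / 1.
        (Equivalence.from (isLog q 0 1 ℕ.≤-refl)
          (≤-respˡ (fromℕ-^ q) (≤-respʳ (solve 1 (λ x → x := con (+ 1) :* (x :* con (+ 1))) refl x)
            2^q≤x)))))

  isNorm-bound : ∀ {n} {c : ℝ^ n} {r} → IsNorm c r → ∀ i → c i ∈± r
  isNorm-bound {c = c} {r} (0≤r , r²≈) i =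
    ≤-respʳ (-‿involutive (c i)) (neg-mono (sq-≤⇒≤ 0≤r
      (≤-respˡ (solve 1 (λ c → c :* c := :- c :* :- c) refl (c i)) c²≤r²))) ,
    sq-≤⇒≤ 0≤r c²≤r²
    where
    c²≤r² : c i * c i ≤ r * r
    c²≤r² = ≤-respʳ (sym r²≈) (term≤sum (λ i → sq≥0 (c i)) i)

  -- The estimate bounds itself: with τ = κ (2 + R) one has R ≤ m τ + m, and 2 m κ ≤ 1 gives 2 m τ ≤
  -- 2 + R, so R can be absorbed on the left.
  norm-bound : ∀ {n} {x q : ℝ^ (suc n)} {κ} → 0# ≤ κ → κ * (fromℕ 2 * fromℕ (suc n) + fromℕ 4) ≤ 1#
    →
    (∀ i → q i ∈± 1#) → (∀ i → x i - q i ∈± κ * (fromℕ 2 + ∥ x ∥₁)) →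
    ∥ x ∥₁ ≤ fromℕ 2 * fromℕ (suc n) + fromℕ 2
  norm-bound {n} {x} {q} {κ} κ≥0 κ≤ q-bound near = lin₃ R≤ R≤ product
      (solve 4 (λ m R mτ S → (con (+ 2) :* m :+ con (+ 2)) :+ (R :+ (R :+ (con (+ 2) :* mτ)))
         := R :+ ((mτ :+ m) :+ ((mτ :+ m) :+ (con (+ 2) :+ R)))) refl m R (m * τ) S)
    where
    R = ∥ x ∥₁
    m = fromℕ (suc n)
    S = fromℕ 2 + R
    τ = κ * S
    S≥0 : 0# ≤ S
    S≥0 = ≤-respˡ (+-identityˡ 0#) (+-mono (fromℕ≥0 2) (sum≥0 λ i → ∈±-bound≥0 (∈±∣∣ (x i))))
    R≤ : R ≤ m * τ + m
    R≤ = ≤-respʳ (solve 2 (λ m t → m :* (t :+ con (+ 1)) := m :* t :+ m) refl m τ)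
      (sum-≤const λ i → ∣∣-least (∈±-resp (solve 2 (λ x q → (x :- q) :+ q := x) refl (x i) (q i))
        (∈±-+ (near i) (q-bound i))))
    2mκ≤1 : fromℕ 2 * m * κ ≤ 1#
    2mκ≤1 = lin₂ κ≤ (*-nonNegative κ≥0 (fromℕ≥0 4))
      (solve 3 (λ k m o → o :+ (k :* (con (+ 2) :* m :+ con (+ 4)) :+ con (+ 0)) := con (+ 2) :* m
        :* k :+ (o :+ k :* con (+ 4))) refl κ m 1#)
    product : fromℕ 2 * (m * τ) ≤ S
    product = ≤-respˡ (solve 3 (λ m k s → (con (+ 2) :* m :* k) :* s := con (+ 2) :*
      (m :* (k :* s))) refl m κ S)
      (≤-respʳ (*-identityˡ S) (*-monoʳ S≥0 2mκ≤1))

  perturbation-≤ : ∀ {n} {c x q : ℝ^ n} {r η ε} → IsNorm c r → fromℕ n * η ≤ ε →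
    (∀ i → x i - q i ∈± η) →
    c ∙ x ≤ c ∙ q + ε * r
  perturbation-≤ {n} {c} {x} {q} {r} {η} {ε} norm mη≤ε near = lin₂
    (proj₂ (∙-∈± (isNorm-bound norm) near)) (*-monoʳ (proj₁ norm) mη≤ε)
    (trans (+-congˡ (+-congʳ (trans (∙-comm c _)
      (trans (∙-sub x q c) (+-cong (∙-comm x c) (-‿cong (∙-comm q c)))))))
      (solve 6 (λ cx cq er m r e → (cq :+ er) :+ ((cx :- cq) :+ (m :* e) :* r) := cx :+
        (m :* (r :* e) :+ er)) refl
        (c ∙ x) (c ∙ q) (ε * r) (fromℕ n) r η))

  -- The squared distance is at most m η² ≤ (m η)² because 1 ≤ m; the factor m in place of its
  -- square root only costs precision.
  near⇒thicken : ∀ {n} {S : Subset (suc n)} {x q : ℝ^ (suc n)} {η ε} → fromℕ (suc n) * η ≤ ε → S q →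
    (∀ i → x i - q i ∈± η) →
    thicken S ε x
  near⇒thicken {n} {S} {x} {q} {η} {ε} mη≤ε q∈S near =
    let r , r≥0 , r²≈ = sqrt (sum≥0 λ i → sq≥0 (z i))
    in q , z , q∈S , (r , (r≥0 , r²≈) , sq-≤⇒≤ 0≤ε (≤-trans (≤-reflexive r²≈) z∙z≤)) ,
       λ i → solve 2 (λ x q → x := q :+ (x :- q)) refl (x i) (q i)
    where
    m = fromℕ (suc n)
    z : ℝ^ (suc n)
    z i = x i - q i
    η≥0 : 0# ≤ η
    η≥0 = ∈±-bound≥0 (near zero)
    mη≥0 : 0# ≤ m * η
    mη≥0 = *-nonNegative (fromℕ≥0 (suc n)) η≥0
    0≤ε : 0# ≤ ε
    0≤ε = ≤-trans mη≥0 mη≤ε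
    z∙z≤ : z ∙ z ≤ ε * ε
    z∙z≤ = ≤-trans (proj₂ (∙-∈± near near))
      (≤-trans (≤-trans (≤-reflexive (solve 2
        (λ m e → m :* (e :* e) := (m :* e) :* (con (+ 1) :* e)) refl m η))
        (*-monoˡ mη≥0 (*-monoʳ η≥0 (1≤suc n))))
        (≤-trans (*-monoˡ mη≥0 mη≤ε) (*-monoʳ 0≤ε mη≤ε)))

  -- Choice of the precision.

  -- q bounds log₂ (1/ε) from above, D = 2 ^ e is the factor by which the rows
  -- are scaled before rounding, 2 ^ T exceeds all entries, κ is the resulting
  -- error per unit of 2 + ∥ x ∥₁, and η the final distance to P in the maximum
  -- norm.

  module Precision (n k q : ℕ) where

    m N a e T : ℕ
    m = suc n
    N = m ℕ.+ k
    -- 2^(m + 3) pays for the factor 2 + ‖x‖₁ ≤ 2 m + 4, 2^m for the passage from the maximum norm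
    -- to the Euclidean norm, and 2^q for 1/ε.
    a = (m ℕ.+ 3) ℕ.+ (m ℕ.+ q)
    -- 2^(2 N) exceeds the spanning loss and 2^N the tolerance's predecessor N, so both are absorbed
    -- and an error of 2^-a is left.
    e = (2 ℕ.* N ℕ.+ N) ℕ.+ a
    -- Entries are at most 2 m D, right-hand sides at most 2 m D + N + 1 < (2 m + 1) D, and 2 m + 1
    -- ≤ 2^(m + 3).
    T = e ℕ.+ (m ℕ.+ 3)

    D : ℕ
    D = 2 ℕ.^ e

    2m+4≤ : 2 ℕ.* m ℕ.+ 4 ℕ.≤ 2 ℕ.^ (m ℕ.+ 3)
    2m+4≤ = ℕ.≤-trans (ℕ.m≤m+n _ (2 ℕ.* m))
      (ℕ.≤-trans (ℕ.≤-reflexive (ℕ-solve 1 (λ m → (ℕ-con 2 ⊠ m ⊞ ℕ-con 4) ⊞ ℕ-con 2 ⊠ m ≋ℕ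
        (ℕ-con 1 ⊞ m) ⊠ ℕ-con 4) ≡.refl m))
      (ℕ.≤-trans (ℕ.*-mono-≤ (n<2^n m) (ℕ.m≤m+n 4 4))
        (ℕ.≤-reflexive (≡.sym (ℕ.^-distribˡ-+-* 2 m 3)))))

    spanLoss*N≤ : spanLoss N ℕ.* suc N ℕ.≤ 2 ℕ.^ (2 ℕ.* N ℕ.+ N)
    spanLoss*N≤ = ℕ.≤-trans (ℕ.*-mono-≤ (ℕ.≤-trans (ℕ.n≤1+n _) (spanLoss<4^N N)) (n<2^n N))
      (ℕ.≤-reflexive (≡.sym (ℕ.^-distribˡ-+-* 2 (2 ℕ.* N) N)))

    N<D : suc (suc N) ℕ.≤ D
    N<D = ℕ.≤-trans (n<2^n (suc N)) (ℕ.^-monoʳ-≤ 2 (ℕ.≤-trans (ℕ.≤-reflexive (ℕ.+-comm 1 N))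
      (ℕ.+-mono-≤ (ℕ.m≤n+m N (2 ℕ.* N)) (ℕ.s≤s ℕ.z≤n))))

    entry≤ : D ℕ.* (2 ℕ.* m) ℕ.+ suc N ℕ.< 2 ℕ.^ T
    entry≤ = ℕ.≤-trans (ℕ.≤-reflexive (≡.sym (ℕ.+-suc _ (suc N)))) (ℕ.≤-trans (ℕ.+-monoʳ-≤ _ N<D)
      (ℕ.≤-trans (ℕ.≤-reflexive (ℕ-solve 2 (λ d m → d ⊠ m ⊞ d ≋ℕ d ⊠ (m ⊞ ℕ-con 1)) ≡.refl D
        (2 ℕ.* m)))
      (ℕ.≤-trans (ℕ.*-monoʳ-≤ D (ℕ.≤-trans (ℕ.+-monoʳ-≤ (2 ℕ.* m) (ℕ.m≤m+n 1 3)) 2m+4≤))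
        (ℕ.≤-reflexive (≡.sym (ℕ.^-distribˡ-+-* 2 e (m ℕ.+ 3)))))))

    1≤entry : 1 ℕ.≤ D ℕ.* (2 ℕ.* m)
    1≤entry = ℕ.*-mono-≤ {1} {D} {1} (ℕ.m^n>0 2 e) (ℕ.s≤s ℕ.z≤n)

    private
      pow : ℕ → ℝ
      pow j = fromℕ (2 ℕ.^ j)

      pow-+ : ∀ i j → pow (i ℕ.+ j) ≈ pow i * pow j
      pow-+ i j = trans (reflexive (≡.cong fromℕ (ℕ.^-distribˡ-+-* 2 i j)))
        (fromℕ-* (2 ℕ.^ i) (2 ℕ.^ j))

      1≤pow : ∀ j → 1# ≤ pow j
      1≤pow j = ≤-respˡ fromℕ-1 (fromℕ-mono (ℕ.m^n>0 2 j))

      0<pow : ∀ j → 0# < pow j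
      0<pow j = 0<-resp-≤ 0<1 (1≤pow j)

    0<D : 0# < fromℕ D
    0<D = 0<pow e

    κ η : ℝ
    κ = pow a ⁻¹
    η = pow (m ℕ.+ q) ⁻¹

    κ≥0 : 0# ≤ κ
    κ≥0 = ⁻¹≥0 (0<pow a)

    η≥0 : 0# ≤ η
    η≥0 = ⁻¹≥0 (0<pow (m ℕ.+ q))

    κ-large : fromℕ (spanLoss N) * fromℕ (suc N) ≤ κ * fromℕ D
    κ-large = ≤-respˡ (fromℕ-* (spanLoss N) (suc N))
      (≤-trans (fromℕ-mono spanLoss*N≤) (≤-reflexive (sym
      (trans (*-congˡ (pow-+ (2 ℕ.* N ℕ.+ N) a))
        (trans (solve 3 (λ k x y → k :* (x :* y) := x :* (y :* k)) refl κ (pow (2 ℕ.* N ℕ.+ N))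
        (pow a))
        (trans (*-congˡ (inverseʳ (0<pow a))) (trans (*-comm _ 1#) (*-identityˡ _))))))))

    κ[2m+4]≤η : κ * (fromℕ 2 * fromℕ m + fromℕ 4) ≤ η
    κ[2m+4]≤η = ≤-trans (*-monoˡ κ≥0 (≤-respˡ (trans (fromℕ-+ (2 ℕ.* m) 4) (+-congʳ (fromℕ-* 2 m)))
      (fromℕ-mono 2m+4≤)))
      (≤-reflexive (⁻¹-unique (0<pow (m ℕ.+ q))
        (trans (solve 3 (λ x k y → x :* (k :* y) := (y :* x) :* k) refl (pow (m ℕ.+ q)) κ
        (pow (m ℕ.+ 3)))
        (trans (*-congʳ (sym (pow-+ (m ℕ.+ 3) (m ℕ.+ q)))) (inverseʳ (0<pow a))))))

    η≤1 : η ≤ 1#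
    η≤1 = ≤-respˡ (*-identityˡ η) (≤-respʳ (inverseʳ (0<pow (m ℕ.+ q)))
      (*-monoʳ η≥0 (1≤pow (m ℕ.+ q))))

    mη≤ : ∀ {ε} → 1# ≤ pow q * ε → fromℕ m * η ≤ ε
    mη≤ {ε} 1≤2^qε = ≤-trans (*-monoʳ η≥0 (fromℕ-mono (ℕ.<⇒≤ (n<2^n m))))
      (≤-respˡ (trans (*-comm _ 1#) (*-identityˡ _)) (≤-respʳ collapse
        (*-monoˡ (*-nonNegative (fromℕ≥0 (2 ℕ.^ m)) η≥0) 1≤2^qε)))
      where
      collapse : pow m * η * (pow q * ε) ≈ ε
      collapse = trans (solve 4 (λ x h y e → (x :* h) :* (y :* e) := ((x :* y) :* h) :* e) refl
        (pow m) η (pow q) ε)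
        (trans (*-congʳ (trans (*-congʳ (sym (pow-+ m q))) (inverseʳ (0<pow (m ℕ.+ q)))))
          (*-identityˡ ε))

    rows : ℕ
    rows = 4 ℕ.* k ℕ.+ 2 ℕ.* m

    size≤ : ∀ {A : Matrix ℚ rows m} {B : Matrix ℚ rows k} {d : Vector ℚ rows} →
      (∀ i j → sizeℚ (A i j) ℕ.≤ T ℕ.+ 2) → (∀ i j → sizeℚ (B i j) ℕ.≤ T ℕ.+ 2) →
        (∀ i → sizeℚ (d i) ℕ.≤ T ℕ.+ 2) →
      sizeMatrix A ℕ.+ sizeMatrix B ℕ.+ sizeVector d ℕ.≤ rows ℕ.*
        ((m ℕ.+ k ℕ.+ 1) ℕ.* (6 ℕ.* m ℕ.+ 3 ℕ.* k ℕ.+ 9 ℕ.+ q))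
    size≤ {A} {B} {d} A≤ B≤ d≤ = ℕ.≤-trans (ℕ.+-mono-≤
      (ℕ.+-mono-≤ (sizeMatrix-≤ {A = A} A≤) (sizeMatrix-≤ {A = B} B≤)) (sizeVector-≤ {v = d} d≤))
      (ℕ.≤-reflexive (≡.trans
        (ℕ-solve 4 (λ r m k s → r ⊠ (m ⊠ s) ⊞ r ⊠ (k ⊠ s) ⊞ r ⊠ s ≋ℕ r ⊠ ((m ⊞ k ⊞ ℕ-con 1) ⊠ s))
          ≡.refl rows m k (suc (T ℕ.+ 2)))
        (≡.cong (λ s → rows ℕ.* ((m ℕ.+ k ℕ.+ 1) ℕ.* s))
          (ℕ-solve 3 (λ m k q → ℕ-con 1 ⊞ ((((ℕ-con 2 ⊠ (m ⊞ k) ⊞ (m ⊞ k)) ⊞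
            ((m ⊞ ℕ-con 3) ⊞ (m ⊞ q))) ⊞ (m ⊞ ℕ-con 3)) ⊞ ℕ-con 2)
            ≋ℕ ℕ-con 6 ⊠ m ⊞ ℕ-con 3 ⊠ k ⊞ ℕ-con 9 ⊞ q) ≡.refl m k q))))

  -- The number of rows, times the number of columns including the right-hand side, times one more
  -- than the entry size; 2 + w² takes the place of q and remains a valid bound for negative
  -- logarithms.
  sizeBound : ℝ → ℝ → ℝ → ℝ
  sizeBound u v w = (fromℕ 4 * v + fromℕ 2 * u) *
    ((u + v + fromℕ 1) * (fromℕ 6 * u + fromℕ 3 * v + fromℕ 9 + (fromℕ 2 + w * w)))

  sizeBound-isPolynomial : IsPolynomial sizeBound
  sizeBound-isPolynomial = (constant _ ⟨*⟩ var₂ ⟨+⟩ constant _ ⟨*⟩ var₁) ⟨*⟩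
    ((var₁ ⟨+⟩ var₂ ⟨+⟩ constant _) ⟨*⟩
     (constant _ ⟨*⟩ var₁ ⟨+⟩ constant _ ⟨*⟩ var₂ ⟨+⟩ constant _ ⟨+⟩
       (constant _ ⟨+⟩ var₃ ⟨*⟩ var₃)))

  fromℕ-sizeBound : ∀ m k q {L} → fromℕ q ≤ fromℕ 2 + L * L →
    fromℕ ((4 ℕ.* k ℕ.+ 2 ℕ.* m) ℕ.* ((m ℕ.+ k ℕ.+ 1) ℕ.* (6 ℕ.* m ℕ.+ 3 ℕ.* k ℕ.+ 9 ℕ.+ q))) ≤
      sizeBound (fromℕ m) (fromℕ k) L
  fromℕ-sizeBound m k q {L} q≤ = ≤-respˡ (sym
    (trans (fromℕ-* A (B ℕ.* (E ℕ.+ q))) (*-congˡ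
    (trans (fromℕ-* B (E ℕ.+ q)) (*-congˡ (fromℕ-+ E q))))))
    (≤-respʳ (*-cong A≈ (*-cong B≈ (+-congʳ E≈)))
      (*-monoˡ (fromℕ≥0 A) (*-monoˡ (fromℕ≥0 B) (+-mono ≤-refl q≤))))
    where
    A = 4 ℕ.* k ℕ.+ 2 ℕ.* m
    B = m ℕ.+ k ℕ.+ 1
    E = 6 ℕ.* m ℕ.+ 3 ℕ.* k ℕ.+ 9
    A≈ : fromℕ A ≈ fromℕ 4 * fromℕ k + fromℕ 2 * fromℕ m
    A≈ = trans (fromℕ-+ (4 ℕ.* k) (2 ℕ.* m)) (+-cong (fromℕ-* 4 k) (fromℕ-* 2 m))
    B≈ : fromℕ B ≈ fromℕ m + fromℕ k + fromℕ 1
    B≈ = trans (fromℕ-+ (m ℕ.+ k) 1) (+-congʳ (fromℕ-+ m k))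
    E≈ : fromℕ E ≈ fromℕ 6 * fromℕ m + fromℕ 3 * fromℕ k + fromℕ 9
    E≈ = trans (fromℕ-+ (6 ℕ.* m ℕ.+ 3 ℕ.* k) 9)
      (+-congʳ (trans (fromℕ-+ (6 ℕ.* m) (3 ℕ.* k)) (+-cong (fromℕ-* 6 m) (fromℕ-* 3 k))))

  -- Projections of rational polyhedra: convexity and attained maxima.

  module RationalSystem {r n k : ℕ} (B : Matrix ℚ r n) (C : Matrix ℚ r k) (d : Vector ℚ r) where

    private
      Q : Pred (ℝ^ n × ℝ^ k) 0ℓ
      Q = rationalPolyhedron B C d

      Bᵣ : Matrix ℝ r n
      Bᵣ i j = fromℚ (B i j)

      Cᵣ : Matrix ℝ r k
      Cᵣ i j = fromℚ (C i j)

    conv⊆projₓ : ∀ {S : Subset n} → (∀ s → S s → projₓ Q s) → ∀ {x} → conv S x → projₓ Q x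
    conv⊆projₓ S⊆ (N , μ , v , μ≥0 , Σμ≈1 , v∈S , x≋) =
      (λ j → sum (λ l → μ l * y l j)) , λ i → ≤-respˡ
        (sym (trans (+-cong (trans (∙-congˡ {a = Bᵣ i} x≋) (∙-combination (Bᵣ i) μ v))
          (∙-combination (Cᵣ i) μ y))
          (sym (∙-distribˡ μ (λ l → Bᵣ i ∙ v l) (λ l → Cᵣ i ∙ y l)))))
        (average-≤ μ≥0 Σμ≈1 λ l → proj₂ (S⊆ (v l) (v∈S l)) i)
      where
      y : Vector (ℝ^ k) N
      y l = proj₁ (S⊆ (v l) (v∈S l))

    private
      V : Set
      V = ℝ^ n × ℝ^ k × ℝ

      _⊹_⟨_⟩ : V → ℝ → V → V
      (x , y , s) ⊹ a ⟨ x′ , y′ , s′ ⟩ = (λ i → x i + a * x′ i) , (λ j → y j + a * y′ j) , s + a *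
        s′

      open Forms _⊹_⟨_⟩

      h : V → ℝ
      h (_ , _ , s) = s

      h-linear : Linear h
      h-linear v a w = refl

      x-linear : ∀ (c : ℝ^ n) → Linear (λ v → c ∙ proj₁ v)
      x-linear c = linear-∙ c {f = λ i v → proj₁ v i} λ i v a w → refl

      form : Fin r → V → ℝ
      form i (x , y , s) = (Bᵣ i ∙ x + Cᵣ i ∙ y) - fromℚ (d i) * s

      form-linear : ∀ i → Linear (form i)
      form-linear i = linear--
        (linear-+ (x-linear (Bᵣ i)) (linear-∙ (Cᵣ i) {f = λ j v → proj₁ (proj₂ v) j} λ j v a w →
          refl))
        (linear-* {f = h} (fromℚ (d i)) h-linear)

      form≤0⇒ : ∀ {u β s} → s ≈ 1# → u - β * s ≤ 0# → u ≤ β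
      form≤0⇒ {u} {β} s≈1 p = lin₁ (≤-respˡ (+-congˡ (-‿cong (*-congˡ s≈1))) p)
        (solve 2 (λ u b → b :+ (u :- b :* con (+ 1)) := u :+ con (+ 0)) refl u β)

      ⇒form≤0 : ∀ {u β} → u ≤ β → u - β * 1# ≤ 0#
      ⇒form≤0 {u} {β} p = lin₁ p (solve 2 (λ u b → con (+ 0) :+ u := (u :- b :* con (+ 1)) :+ b)
        refl u β)

    -- The maximum is sought on the polyhedron above, where linear programming attains it, so no
    -- compactness of the projection has to be shown.
    ∃-max : ∀ c {x₀} → projₓ Q x₀ → ∀ U → (∀ x → projₓ Q x → c ∙ x ≤ U) → ∃[ M ] IsMax c (projₓ Q) M
    ∃-max c {x₀} (y₀ , ∈Q) U bounded =
      let (x , y , s) , s≈1 , ≤0 , max = Affine.attains {h = h} h-linear form form-linear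
            {γ = λ v → c ∙ proj₁ v}
            (x-linear c) (x₀ , y₀ , 1#) refl (λ i → ⇒form≤0 (∈Q i)) U
            λ { (x , y , s) s≈1 ≤0 → bounded x (y , λ i → form≤0⇒ s≈1 (≤0 i)) }
      in c ∙ x , (x , (y , λ i → form≤0⇒ s≈1 (≤0 i)) , refl) ,
         λ { x′ (y′ , ∈Q′) → max (x′ , y′ , 1#) refl λ i → ⇒form≤0 (∈Q′ i) }

  module IntegerMatrices {n k : ℕ} (A : Fin (n ℕ.+ k) → Fin n → ℤ) (A′ : Fin (n ℕ.+ k) → Fin k → ℤ)
    (b : Fin (n ℕ.+ k) → ℤ) (Δ : ℕ) where

    open IntegerSystem A A′ b Δ

    matrix : Matrix ℚ (4 ℕ.* k ℕ.+ 2 ℕ.* n) n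
    matrix r i = integer (coefficient (decode r) i)

    matrix′ : Matrix ℚ (4 ℕ.* k ℕ.+ 2 ℕ.* n) k
    matrix′ r j = integer (coefficient′ (decode r) j)

    bounds : Vector ℚ (4 ℕ.* k ℕ.+ 2 ℕ.* n)
    bounds r = integer (bound (decode {n} r))

    private
      integer-∙ : ∀ {m} (f : Fin m → ℤ) x → (λ i → fromℚ (integer (f i))) ∙ x ≈ (λ i → fromℤ (f i))
        ∙ x
      integer-∙ f x = ∙-congʳ λ i → fromℚ-integer (f i)

    polyhedron⇒satisfied : ∀ {x y} → rationalPolyhedron matrix matrix′ bounds (x , y) → ∀ c →
      Satisfied c x y
    polyhedron⇒satisfied {x} {y} ∈Q c =
      let r , decode≡ = decode-surjective c
      in ≡.subst (λ c → Satisfied c x y) decode≡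
        (≤-respˡ (+-cong (integer-∙ (coefficient (decode r)) x)
          (integer-∙ (coefficient′ (decode r)) y))
          (≤-respʳ (fromℚ-integer (bound (decode r))) (∈Q r)))

    satisfied⇒polyhedron : ∀ {x y} → (∀ c → Satisfied c x y) → rationalPolyhedron matrix matrix′
      bounds (x , y)
    satisfied⇒polyhedron {x} {y} sat r =
      ≤-respˡ (sym (+-cong (integer-∙ (coefficient (decode r)) x)
        (integer-∙ (coefficient′ (decode r)) y)))
        (≤-respʳ (sym (fromℚ-integer (bound (decode r)))) (sat (decode r)))

  -- The approximating polytope and its properties.

  module Approximation {n k q : ℕ} {X : Pred (Vec Bool (suc n)) 0ℓ} (X-nonempty : Satisfiable X)
    (formulation : HasExtendedFormulation (conv (cube X)) k)
    {ε : ℝ} (ε-large : 1# ≤ fromℕ (2 ℕ.^ q) * ε) where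

    open Formulation X-nonempty formulation
    open Precision n k q

    private
      P : Subset (suc n)
      P = conv (cube X)

      module R = Rounding slackFactorization point-bound (proj₁ X-nonempty) D 0<D
      module I = IntegerSystem R.roundX R.roundY R.roundRhs (suc N)

    open IntegerMatrices R.roundX R.roundY R.roundRhs (suc N) public
      using (matrix; matrix′; bounds)
    open IntegerMatrices R.roundX R.roundY R.roundRhs (suc N)
      using (polyhedron⇒satisfied; satisfied⇒polyhedron)

    private
      Q : Pred (ℝ^ m × ℝ^ k) 0ℓ
      Q = rationalPolyhedron matrix matrix′ bounds

      module RS = RationalSystem matrix matrix′ bounds

      Q⇒feasible : ∀ x y → Q (x , y) → R.Feasible x y
      Q⇒feasible x y ∈Q = I.satisfied⇒feasible {x} {y} (polyhedron⇒satisfied {x} {y} ∈Q)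

      norm≤ : ∀ x y → R.Feasible x y → ∥ x ∥₁ ≤ fromℕ 2 * fromℕ m + fromℕ 2
      norm≤ x y feasible =
        let q , q∈P , near = close⇒near x (κ * (fromℕ 2 + ∥ x ∥₁))
              (R.feasible⇒close κ-large {x} {y} feasible)
        in norm-bound {x = x} {q} κ≥0 (≤-trans κ[2m+4]≤η η≤1) (P-bound {q} q∈P) near

      radius≤ : ∀ {R} → R ≤ fromℕ 2 * fromℕ m + fromℕ 2 → κ * (fromℕ 2 + R) ≤ η
      radius≤ {R} R≤ = ≤-trans (*-monoˡ κ≥0 (lin₁ R≤
        (solve 2 (λ m R → (con (+ 2) :* m :+ con (+ 4)) :+ R := (con (+ 2) :+ R) :+
          (con (+ 2) :* m :+ con (+ 2))) refl (fromℕ m) R))) κ[2m+4]≤η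

      -- The second use of the distance estimate: `norm≤` has turned its radius, which depends on x,
      -- into one that is at most η.
      near : ∀ {x} → projₓ Q x → ∃[ q ] P q × (∀ i → x i - q i ∈± η)
      near {x} (y , ∈Q) = close⇒near x η (close-mono {p = point} {x = x}
        (radius≤ (norm≤ x y (Q⇒feasible x y ∈Q)))
        (R.feasible⇒close κ-large {x} {y} (Q⇒feasible x y ∈Q)))

      mη≤ε : fromℕ m * η ≤ ε
      mη≤ε = mη≤ ε-large

    bounded : IsBounded Q
    bounded = M , λ x y ∈Q →
      let feasible = Q⇒feasible x y ∈Q
      in (λ i → ∈±-mono (≤-trans (term≤sum (λ i → ∈±-bound≥0 (∈±∣∣ (x i))) i) (norm≤ x y feasible))
        (∈±∣∣ (x i))) ,
         λ j → ∈±-mono 1≤M (nonNegative⇒∈± (proj₁ feasible j) (proj₁ (proj₂ feasible) j))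
      where
      M = fromℕ 2 * fromℕ m + fromℕ 2
      1≤M : 1# ≤ M
      1≤M = lin₃ (fromℕ≥0 m) (fromℕ≥0 m) 0≤1
        (solve 1 (λ m → (con (+ 2) :* m :+ con (+ 2)) :+ (con (+ 0) :+ (con (+ 0) :+ con (+ 0)))
        := con (+ 1) :+ (m :+ (m :+ con (+ 1)))) refl (fromℕ m))

    size : ∀ {L} → fromℕ q ≤ fromℕ 2 + L * L →
           fromℕ (sizeMatrix matrix ℕ.+ sizeMatrix matrix′ ℕ.+ sizeVector bounds) ≤ sizeBound
             (fromℕ m) (fromℕ k) L
    size q≤ = ≤-trans (fromℕ-mono (size≤ {matrix} {matrix′} {bounds}
        (λ r i → sizeℚ-integer {I.coefficient (decode r) i} {T}
          (ℕ.≤-trans (ℕ.s≤s (ℕ.≤-trans (I.coefficient-≤ 1≤entry A≤ A′≤ b≤ (decode r) i)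
          (ℕ.m≤m+n _ _))) entry≤))
        (λ r j → sizeℚ-integer {I.coefficient′ (decode r) j} {T}
          (ℕ.≤-trans (ℕ.s≤s (ℕ.≤-trans (I.coefficient′-≤ 1≤entry A≤ A′≤ b≤ (decode r) j)
          (ℕ.m≤m+n _ _))) entry≤))
        (λ r → sizeℚ-integer {I.bound (decode r)} {T}
          (ℕ.≤-trans (ℕ.s≤s (I.bound-≤ 1≤entry A≤ A′≤ b≤ (decode r))) entry≤))))
      (fromℕ-sizeBound m k q q≤)
      where
      A≤ : ∀ l i → ℤ.∣ R.roundX l i ∣ ℕ.≤ D ℕ.* (2 ℕ.* m)
      A≤ l i = fromℕ-cancel-≤ (R.roundX-bound l i)
      A′≤ : ∀ l j → ℤ.∣ R.roundY l j ∣ ℕ.≤ D ℕ.* (2 ℕ.* m)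
      A′≤ l j = fromℕ-cancel-≤ (R.roundY-bound l j)
      b≤ : ∀ l → ℤ.∣ R.roundRhs l ∣ ℕ.≤ D ℕ.* (2 ℕ.* m)
      b≤ l = fromℕ-cancel-≤ (R.roundRhs-bound l)

    point∈projₓ : ∀ t → projₓ Q (point t)
    point∈projₓ t = Y t , satisfied⇒polyhedron {point t} {Y t}
      (I.feasible⇒satisfied {point t} {Y t} (R.vertex-feasible t))
      where open SlackFactorization slackFactorization using (Y)

    P⊆projₓ : ∀ {x} → P x → projₓ Q x
    P⊆projₓ = RS.conv⊆projₓ {S = cube X} λ s s∈cube →
      let t , s≋ = cube⇒point s s∈cube
          y , ∈Q = point∈projₓ t
      in y , λ r → ≤-respˡ (+-congʳ (∙-congˡ {a = λ i → fromℚ (matrix r i)} λ i → sym (s≋ i)))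
        (∈Q r)

    projₓ⊆thicken : ∀ {x} → projₓ Q x → thicken P ε x
    projₓ⊆thicken x∈ = let q , q∈P , close = near x∈ in near⇒thicken {S = P} mη≤ε q∈P close

    gap : ∀ c {r M} → IsNorm c r → (∀ x → P x → c ∙ x ≤ M) → ∀ x → projₓ Q x → c ∙ x ≤ M + ε * r
    gap c {r} {M} norm max-P x x∈ = from-near (near x∈)
      where
      from-near : ∃[ q ] P q × (∀ i → x i - q i ∈± η) → c ∙ x ≤ M + ε * r
      from-near (q , q∈P , close) = ≤-trans (perturbation-≤ {c = c} {x} {q} {r} {η} norm mη≤ε close)
        (+-mono (max-P q q∈P) ≤-refl)

    max-P : ∀ c → ∃[ M ] IsMax c P M
    max-P c = from-maximum (maximum-Vec m (λ t → c ∙ point t))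
      where
      from-maximum : ∃[ t ] (∀ t′ → c ∙ point t′ ≤ c ∙ point t) → ∃[ M ] IsMax c P M
      from-maximum (t , max) = c ∙ point t , (point t , point∈P t , refl) , λ x → P-≤ c
        (c ∙ point t) max

    max-Q : ∀ c U → (∀ x → projₓ Q x → c ∙ x ≤ U) → ∃[ M ] IsMax c (projₓ Q) M
    max-Q c = RS.∃-max c {point (proj₁ X-nonempty)} (point∈projₓ (proj₁ X-nonempty))

    difference≤ : ∀ c {M₁ M₂ g} → IsMax c (projₓ Q) M₁ → (∀ x → projₓ Q x → c ∙ x ≤ M₂ + g) →
      M₁ - M₂ ≤ g
    difference≤ c {M₁} {M₂} {g} ((x , x∈ , c∙x≈M₁) , _) below = lin₁ (≤-respˡ c∙x≈M₁ (below x x∈))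
      (solve 3 (λ M₁ M₂ g → g :+ M₁ := (M₁ :- M₂) :+ (M₂ :+ g)) refl M₁ M₂ g)

    maxima : ∀ c → Σ[ M₁ ∈ ℝ ] Σ[ M₂ ∈ ℝ ] Σ[ r ∈ ℝ ]
             IsMax c (projₓ Q) M₁ × IsMax c P M₂ × IsNorm c r × M₁ - M₂ ≤ ε * r
    maxima c = assemble (sqrt (sum≥0 λ i → sq≥0 (c i))) (max-P c)
      where
      Goal : Set
      Goal = Σ[ M₁ ∈ ℝ ] Σ[ M₂ ∈ ℝ ] Σ[ r ∈ ℝ ] IsMax c (projₓ Q) M₁ × IsMax c P M₂ × IsNorm c r ×
        M₁ - M₂ ≤ ε * r
      finish : ∀ {r M₂} → IsNorm c r → IsMax c P M₂ → ∃[ M₁ ] IsMax c (projₓ Q) M₁ → Goal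
      finish {r} {M₂} norm max₂ (M₁ , max₁) = M₁ , M₂ , r , max₁ , max₂ , norm , difference≤ c max₁
        (gap c norm (proj₂ max₂))
      assemble : ∃[ r ] IsNorm c r → ∃[ M ] IsMax c P M → Goal
      assemble (r , norm) (M₂ , max₂) = finish norm max₂
        -- The gap estimate comes before the maximum over the projection: it supplies the upper
        -- bound from which that maximum is shown to exist.
        (max-Q c (M₂ + ε * r) (gap c norm (proj₂ max₂)))

  ε-large : ∀ {ε L q} → 0# < ε → IsLog₂ (ε ⁻¹) L → ¬ (fromℕ q ≤ L) → 1# ≤ fromℕ (2 ℕ.^ q) * ε
  ε-large {ε} {q = q} 0<ε isLog q≰L = ≤-respˡ (trans (*-comm _ _) (inverseʳ 0<ε))
    (*-monoʳ (proj₁ 0<ε) (isLog₂-bound {q = q} isLog q≰L))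

theorem6 : ExcludedMiddle 0ℓ → (𝓡 : CompleteOrderedField) →
    let open Polyhedra 𝓡 in
    Σ[ p ∈ Polynomial₃ ] ((n : ℕ) → 1 ℕ.≤ n →
    (X : Pred (Vec Bool n) 0ℓ) → Satisfiable X →
    let P = conv (cube X) in
    (xc : ℕ) → IsXc P xc →
    (ε : ℝ) → 0# < ε →
    (log1/ε : ℝ) → IsLog₂ (ε ⁻¹) log1/ε →
    let rows = 4 ℕ.* xc ℕ.+ 2 ℕ.* n in
    Σ[ B ∈ Matrix ℚ rows n ] Σ[ C ∈ Matrix ℚ rows xc ] Σ[ d ∈ Vector ℚ rows ]
    let Q = rationalPolyhedron B C d in
    IsBounded Q
    × fromℕ (sizeMatrix B ℕ.+ sizeMatrix C ℕ.+ sizeVector d)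
    ≤ eval p (fromℕ n) (fromℕ xc) log1/ε
    × P ⊆ projₓ Q
    × projₓ Q ⊆ thicken P ε
    × ((c : ℝ^ n) → Σ[ M₁ ∈ ℝ ] Σ[ M₂ ∈ ℝ ] Σ[ r ∈ ℝ ]
    IsMax c (projₓ Q) M₁ × IsMax c P M₂ × IsNorm c r
    × M₁ - M₂ ≤ ε * r))
theorem6 em 𝓡 = proj₁ sizeBound-isPolynomial , λ
  { (suc n) _ X X-nonempty xc (formulation , _) ε 0<ε log1/ε isLog →
      let q , q≰log , q≤ = ∃-ceiling log1/ε
          open Approximation {q = q} X-nonempty formulation (ε-large {q = q} 0<ε isLog q≰log)
      in matrix , matrix′ , bounds , bounded ,
         ≤-respʳ (sym (proj₂ sizeBound-isPolynomial _ _ log1/ε)) (size q≤) ,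
         P⊆projₓ , projₓ⊆thicken , maxima
  }
  where
  open Polyhedra 𝓡
  open Development em 𝓡
  open CommutativeRing commutativeRing using (sym)
  open IsTotalOrder isTotalOrder using () renaming (≤-respʳ-≈ to ≤-respʳ)
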